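{- There is an absolute constant $C>0$ such that the following holds for all integers $\ell,k\ge 1$ and all $\varepsilon\in(0,0.1)$. Let $g:\{0,1\}^\ell\to\{0,1\}$ be computed by a CNF formula all of whose clauses have width at most $k$, and let $$d:=C\,\ell^{k/(k+1)}\,\log^{2/(k+1)}(1/\varepsilon).$$ Then there exists a real polynomial $q$ in $\ell$ variables of degree at most $d$ such that (i) for every $x\in\{0,1\}^\ell$ with $g(x)=1$ we have $q(x)=1$; (ii) $|q(x)-g(x)|\le\varepsilon$ for all $x\in\{0,1\}^\ell$; (iii) the sum of the absolute values of the coefficients of $q$ is at most $32^d$.
   Context: A CNF formula is an AND of clauses; a clause is an OR of literals ($x_i$ or $\neg x_i$); its width is its number of literals. $\log$ denotes the base-2 logarithm, and $\log^{a}(y)$ means $(\log y)^{a}$. -}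

module Defs where

open import Algebra.Bundles.Raw using (RawRing)
import Algebra.Definitions.RawSemiring as RawSemiringDefs
open import Data.Bool.Base using (Bool; not; if_then_else_)
open import Data.Bool.ListAction using (any; all)
open import Data.Fin.Base using (Fin)
open import Data.Integer.Base using (+_)
open import Data.List.Base as List using (List; length)
open import Data.List.Relation.Unary.All using (All)
open import Data.List.Relation.Unary.Unique.Propositional using (Unique)
open import Data.Nat.Base as ℕ using (ℕ)
import Data.Nat.Properties as ℕ
open import Data.Product.Base using (_×_; _,_; proj₁; proj₂; ∃-syntax)
open import Data.Rational.Base as ℚ using (ℚ; 0ℚ; 1ℚ; ½)
import Data.Rational.Properties as ℚ
open import Data.Rational.Solver using (module +-*-Solver)
open import Data.Sum.Base using (inj₁; inj₂)
open import Data.Vec.Base as Vec using (Vec; lookup)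
open import Level using (0ℓ)
open import Relation.Binary.PropositionalEquality using (_≡_; refl; sym; trans; cong; subst)
open import Relation.Nullary.Negation using (¬_)

------------------------------------------------------------------------
-- Real numbers: Cauchy sequences of rationals

Eventually : (ℕ → Set) → Set
Eventually P = ∃[ N ] (∀ n → N ℕ.≤ n → P n)

Cauchy : (ℕ → ℚ) → Set
Cauchy x = ∀ δ → 0ℚ ℚ.< δ →
  ∃[ N ] (∀ m n → N ℕ.≤ m → N ℕ.≤ n → ℚ.∣ x m ℚ.- x n ∣ ℚ.< δ)

record ℝ : Set where
  constructor mkℝ
  field
    seq    : ℕ → ℚ
    cauchy : Cauchy seq

open ℝ public

infix 4 _≈_ _≤_ _<_

record _≈_ (x y : ℝ) : Set where
  constructor mk≈
  field
    close : ∀ δ → 0ℚ ℚ.< δ → Eventually λ n → ℚ.∣ seq x n ℚ.- seq y n ∣ ℚ.< δ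

record _≤_ (x y : ℝ) : Set where
  constructor mk≤
  field
    below : ∀ δ → 0ℚ ℚ.< δ → Eventually λ n → seq x n ℚ.< seq y n ℚ.+ δ

record _<_ (x y : ℝ) : Set where
  constructor mk<
  field
    gap       : ℚ
    gap>0     : 0ℚ ℚ.< gap
    separated : Eventually λ n → seq x n ℚ.+ gap ℚ.< seq y n

-- Abstract because type checking becomes infeasible if the moduli of
-- convergence unfold; nothing below depends on their values.
abstract
  half-pos : ∀ {δ} → 0ℚ ℚ.< δ → 0ℚ ℚ.< ½ ℚ.* δ
  half-pos {δ} 0<δ = subst (ℚ._< ½ ℚ.* δ) (ℚ.*-zeroʳ ½) (ℚ.*-monoʳ-<-pos ½ 0<δ)

  halves : ∀ δ → ½ ℚ.* δ ℚ.+ ½ ℚ.* δ ≡ δ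
  halves δ = trans (sym (ℚ.*-distribʳ-+ δ ½ ½)) (ℚ.*-identityˡ δ)

  const-cauchy : ∀ p → Cauchy (λ _ → p)
  const-cauchy p δ 0<δ = 0 , λ _ _ _ _ →
    subst (λ z → ℚ.∣ z ∣ ℚ.< δ) (sym (ℚ.+-inverseʳ p)) 0<δ

  +-cauchy : ∀ x y → Cauchy x → Cauchy y → Cauchy (λ n → x n ℚ.+ y n)
  +-cauchy x y cx cy δ 0<δ with cx (½ ℚ.* δ) (half-pos 0<δ) | cy (½ ℚ.* δ) (half-pos 0<δ)
  ... | N , p | M , q = N ℕ.⊔ M , λ m n h k → begin-strict
      ℚ.∣ (x m ℚ.+ y m) ℚ.- (x n ℚ.+ y n) ∣
        ≡⟨ cong ℚ.∣_∣ (regroup (x m) (y m) (x n) (y n)) ⟩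
      ℚ.∣ (x m ℚ.- x n) ℚ.+ (y m ℚ.- y n) ∣
        ≤⟨ ℚ.∣p+q∣≤∣p∣+∣q∣ (x m ℚ.- x n) (y m ℚ.- y n) ⟩
      ℚ.∣ x m ℚ.- x n ∣ ℚ.+ ℚ.∣ y m ℚ.- y n ∣
        <⟨ ℚ.+-mono-< (p m n (ℕ.≤-trans (ℕ.m≤m⊔n N M) h) (ℕ.≤-trans (ℕ.m≤m⊔n N M) k))
                      (q m n (ℕ.≤-trans (ℕ.m≤n⊔m N M) h) (ℕ.≤-trans (ℕ.m≤n⊔m N M) k)) ⟩
      ½ ℚ.* δ ℚ.+ ½ ℚ.* δ
        ≡⟨ halves δ ⟩
      δ ∎
    where
    open ℚ.≤-Reasoning
    open +-*-Solver
    regroup : ∀ a b c d → (a ℚ.+ b) ℚ.- (c ℚ.+ d) ≡ (a ℚ.- c) ℚ.+ (b ℚ.- d)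
    regroup = solve 4 (λ a b c d → (a :+ b) :- (c :+ d) := (a :- c) :+ (b :- d)) refl

  neg-cauchy : ∀ x → Cauchy x → Cauchy (λ n → ℚ.- x n)
  neg-cauchy x cx δ 0<δ with cx δ 0<δ
  ... | N , p = N , λ m n h k → subst (ℚ._< δ)
      (trans (sym (ℚ.∣-p∣≡∣p∣ (x m ℚ.- x n))) (cong ℚ.∣_∣ (flip-sign (x m) (x n)))) (p m n h k)
    where
    open +-*-Solver
    flip-sign : ∀ a b → ℚ.- (a ℚ.- b) ≡ (ℚ.- a) ℚ.- (ℚ.- b)
    flip-sign = solve 2 (λ a b → :- (a :- b) := (:- a) :- (:- b)) refl

  abs-cauchy : ∀ x → Cauchy x → Cauchy (λ n → ℚ.∣ x n ∣)
  abs-cauchy x cx δ 0<δ with cx δ 0<δ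
  ... | N , p = N , λ m n h k →
      reverse-triangle (x m) (x n) (p m n h k) (p n m k h)
    where
    open ℚ.≤-Reasoning
    open +-*-Solver
    split : ∀ a b → a ≡ (a ℚ.- b) ℚ.+ b
    split = solve 2 (λ a b → a := (a :- b) :+ b) refl
    cancel : ∀ a b → (a ℚ.+ b) ℚ.- b ≡ a
    cancel = solve 2 (λ a b → (a :+ b) :- b := a) refl
    swap : ∀ a b → ℚ.- (a ℚ.- b) ≡ b ℚ.- a
    swap = solve 2 (λ a b → :- (a :- b) := b :- a) refl
    one-side : ∀ a b → ℚ.∣ a ∣ ℚ.- ℚ.∣ b ∣ ℚ.≤ ℚ.∣ a ℚ.- b ∣
    one-side a b = begin
      ℚ.∣ a ∣ ℚ.- ℚ.∣ b ∣
        ≡⟨ cong (λ z → ℚ.∣ z ∣ ℚ.- ℚ.∣ b ∣) (split a b) ⟩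
      ℚ.∣ (a ℚ.- b) ℚ.+ b ∣ ℚ.- ℚ.∣ b ∣
        ≤⟨ ℚ.+-monoˡ-≤ (ℚ.- ℚ.∣ b ∣) (ℚ.∣p+q∣≤∣p∣+∣q∣ (a ℚ.- b) b) ⟩
      (ℚ.∣ a ℚ.- b ∣ ℚ.+ ℚ.∣ b ∣) ℚ.- ℚ.∣ b ∣
        ≡⟨ cancel ℚ.∣ a ℚ.- b ∣ ℚ.∣ b ∣ ⟩
      ℚ.∣ a ℚ.- b ∣ ∎
    reverse-triangle : ∀ a b → ℚ.∣ a ℚ.- b ∣ ℚ.< δ → ℚ.∣ b ℚ.- a ∣ ℚ.< δ →
                       ℚ.∣ ℚ.∣ a ∣ ℚ.- ℚ.∣ b ∣ ∣ ℚ.< δ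
    reverse-triangle a b u v with ℚ.∣p∣≡p∨∣p∣≡-p (ℚ.∣ a ∣ ℚ.- ℚ.∣ b ∣)
    ... | inj₁ e = ℚ.≤-<-trans (ℚ.≤-trans (ℚ.≤-reflexive e) (one-side a b)) u
    ... | inj₂ e = ℚ.≤-<-trans
      (ℚ.≤-trans (ℚ.≤-reflexive (trans e (swap ℚ.∣ a ∣ ℚ.∣ b ∣))) (one-side b a)) v

  cauchy⇒bounded : ∀ x → Cauchy x → ∃[ B ] (0ℚ ℚ.≤ B × Eventually λ n → ℚ.∣ x n ∣ ℚ.≤ B)
  cauchy⇒bounded x cx with cx 1ℚ (ℚ.positive⁻¹ 1ℚ)
  ... | N , p = 1ℚ ℚ.+ ℚ.∣ x N ∣
              , ℚ.+-mono-≤ (ℚ.<⇒≤ (ℚ.positive⁻¹ 1ℚ)) (ℚ.0≤∣p∣ (x N))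
              , N , λ n h → begin
      ℚ.∣ x n ∣
        ≡⟨ cong ℚ.∣_∣ (split (x n) (x N)) ⟩
      ℚ.∣ (x n ℚ.- x N) ℚ.+ x N ∣
        ≤⟨ ℚ.∣p+q∣≤∣p∣+∣q∣ (x n ℚ.- x N) (x N) ⟩
      ℚ.∣ x n ℚ.- x N ∣ ℚ.+ ℚ.∣ x N ∣
        ≤⟨ ℚ.+-monoˡ-≤ ℚ.∣ x N ∣ (ℚ.<⇒≤ (p n N h ℕ.≤-refl)) ⟩
      1ℚ ℚ.+ ℚ.∣ x N ∣ ∎
    where
    open ℚ.≤-Reasoning
    open +-*-Solver
    split : ∀ a b → a ≡ (a ℚ.- b) ℚ.+ b
    split = solve 2 (λ a b → a := (a :- b) :+ b) refl

  scale : ∀ B → 0ℚ ℚ.≤ B → ∀ δ → 0ℚ ℚ.< δ →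
          ∃[ η ] (0ℚ ℚ.< η × B ℚ.* η ℚ.< δ)
  scale B 0≤B δ 0<δ = η , 0<η , (begin-strict
      B ℚ.* η             <⟨ ℚ.*-monoˡ-<-pos η B<B+1 ⟩
      (B ℚ.+ 1ℚ) ℚ.* η    ≡⟨ sym (ℚ.*-assoc (B ℚ.+ 1ℚ) (ℚ.1/ (B ℚ.+ 1ℚ)) δ) ⟩
      ((B ℚ.+ 1ℚ) ℚ.* ℚ.1/ (B ℚ.+ 1ℚ)) ℚ.* δ
                          ≡⟨ cong (ℚ._* δ) (ℚ.*-inverseʳ (B ℚ.+ 1ℚ)) ⟩
      1ℚ ℚ.* δ            ≡⟨ ℚ.*-identityˡ δ ⟩
      δ ∎)
    where
    open ℚ.≤-Reasoning
    instance
      B+1-pos : ℚ.Positive (B ℚ.+ 1ℚ)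
      B+1-pos = ℚ.positive (ℚ.+-mono-≤-< 0≤B (ℚ.positive⁻¹ 1ℚ))
      B+1-nonZero : ℚ.NonZero (B ℚ.+ 1ℚ)
      B+1-nonZero = ℚ.pos⇒nonZero (B ℚ.+ 1ℚ)
      inv-pos : ℚ.Positive (ℚ.1/ (B ℚ.+ 1ℚ))
      inv-pos = ℚ.1/pos⇒pos (B ℚ.+ 1ℚ)
    η : ℚ
    η = ℚ.1/ (B ℚ.+ 1ℚ) ℚ.* δ
    0<η : 0ℚ ℚ.< η
    0<η = subst (ℚ._< η) (ℚ.*-zeroʳ (ℚ.1/ (B ℚ.+ 1ℚ))) (ℚ.*-monoʳ-<-pos (ℚ.1/ (B ℚ.+ 1ℚ)) 0<δ)
    instance
      η-pos : ℚ.Positive η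
      η-pos = ℚ.positive 0<η
    B<B+1 : B ℚ.< B ℚ.+ 1ℚ
    B<B+1 = subst (ℚ._< B ℚ.+ 1ℚ) (ℚ.+-identityʳ B) (ℚ.+-monoʳ-< B (ℚ.positive⁻¹ 1ℚ))

  *-mono-∣∣ : ∀ a b {A E} → 0ℚ ℚ.≤ A → ℚ.∣ a ∣ ℚ.≤ A → ℚ.∣ b ∣ ℚ.≤ E → ℚ.∣ a ℚ.* b ∣ ℚ.≤ A ℚ.* E
  *-mono-∣∣ a b {A} {E} 0≤A u v = begin
    ℚ.∣ a ℚ.* b ∣         ≡⟨ ℚ.∣p*q∣≡∣p∣*∣q∣ a b ⟩
    ℚ.∣ a ∣ ℚ.* ℚ.∣ b ∣   ≤⟨ ℚ.*-monoʳ-≤-nonNeg ℚ.∣ b ∣ {{ℚ.∣-∣-nonNeg b}} u ⟩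
    A ℚ.* ℚ.∣ b ∣         ≤⟨ ℚ.*-monoˡ-≤-nonNeg A {{ℚ.nonNegative 0≤A}} v ⟩
    A ℚ.* E ∎
    where open ℚ.≤-Reasoning

  *-close : ∀ a b c d {B D η θ δ} → 0ℚ ℚ.≤ B → 0ℚ ℚ.≤ D →
            ℚ.∣ a ∣ ℚ.≤ B → ℚ.∣ d ∣ ℚ.≤ D →
            ℚ.∣ b ℚ.- d ∣ ℚ.< η → ℚ.∣ a ℚ.- c ∣ ℚ.< θ →
            B ℚ.* η ℚ.< ½ ℚ.* δ → D ℚ.* θ ℚ.< ½ ℚ.* δ →
            ℚ.∣ a ℚ.* b ℚ.- c ℚ.* d ∣ ℚ.< δ
  *-close a b c d {B} {D} {η} {θ} {δ} 0≤B 0≤D a≤B d≤D b~d a~c Bη Dθ = begin-strict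
    ℚ.∣ a ℚ.* b ℚ.- c ℚ.* d ∣
      ≡⟨ cong ℚ.∣_∣ (regroup a b c d) ⟩
    ℚ.∣ a ℚ.* (b ℚ.- d) ℚ.+ d ℚ.* (a ℚ.- c) ∣
      ≤⟨ ℚ.∣p+q∣≤∣p∣+∣q∣ (a ℚ.* (b ℚ.- d)) (d ℚ.* (a ℚ.- c)) ⟩
    ℚ.∣ a ℚ.* (b ℚ.- d) ∣ ℚ.+ ℚ.∣ d ℚ.* (a ℚ.- c) ∣
      ≤⟨ ℚ.+-mono-≤ (*-mono-∣∣ a (b ℚ.- d) 0≤B a≤B (ℚ.<⇒≤ b~d))
                    (*-mono-∣∣ d (a ℚ.- c) 0≤D d≤D (ℚ.<⇒≤ a~c)) ⟩
    B ℚ.* η ℚ.+ D ℚ.* θ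
      <⟨ ℚ.+-mono-< Bη Dθ ⟩
    ½ ℚ.* δ ℚ.+ ½ ℚ.* δ
      ≡⟨ halves δ ⟩
    δ ∎
    where
    open ℚ.≤-Reasoning
    open +-*-Solver
    regroup : ∀ a b c d → a ℚ.* b ℚ.- c ℚ.* d ≡ a ℚ.* (b ℚ.- d) ℚ.+ d ℚ.* (a ℚ.- c)
    regroup = solve 4 (λ a b c d → a :* b :- c :* d := a :* (b :- d) :+ d :* (a :- c)) refl

  *-cauchy : ∀ x y → Cauchy x → Cauchy y → Cauchy (λ n → x n ℚ.* y n)
  *-cauchy x y cx cy δ 0<δ =
    let (B , 0≤B , N₁ , bx)  = cauchy⇒bounded x cx
        (D , 0≤D , N₂ , by)  = cauchy⇒bounded y cy
        (η , 0<η , Bη<δ/2)   = scale B 0≤B (½ ℚ.* δ) (half-pos 0<δ)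
        (θ , 0<θ , Dθ<δ/2)   = scale D 0≤D (½ ℚ.* δ) (half-pos 0<δ)
        (N₃ , p)             = cx θ 0<θ
        (N₄ , q)             = cy η 0<η
        N₁₂≤ : ∀ {m} → N₁ ℕ.⊔ N₂ ℕ.⊔ (N₃ ℕ.⊔ N₄) ℕ.≤ m → N₁ ℕ.⊔ N₂ ℕ.≤ m
        N₁₂≤ = ℕ.m⊔n≤o⇒m≤o (N₁ ℕ.⊔ N₂) (N₃ ℕ.⊔ N₄)
        N₃₄≤ : ∀ {m} → N₁ ℕ.⊔ N₂ ℕ.⊔ (N₃ ℕ.⊔ N₄) ℕ.≤ m → N₃ ℕ.⊔ N₄ ℕ.≤ m
        N₃₄≤ = ℕ.m⊔n≤o⇒n≤o (N₁ ℕ.⊔ N₂) (N₃ ℕ.⊔ N₄)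
    in N₁ ℕ.⊔ N₂ ℕ.⊔ (N₃ ℕ.⊔ N₄) , λ m n h k →
      *-close (x m) (y m) (x n) (y n) 0≤B 0≤D
        (bx m (ℕ.m⊔n≤o⇒m≤o N₁ N₂ (N₁₂≤ h)))
        (by n (ℕ.m⊔n≤o⇒n≤o N₁ N₂ (N₁₂≤ k)))
        (q m n (ℕ.m⊔n≤o⇒n≤o N₃ N₄ (N₃₄≤ h)) (ℕ.m⊔n≤o⇒n≤o N₃ N₄ (N₃₄≤ k)))
        (p m n (ℕ.m⊔n≤o⇒m≤o N₃ N₄ (N₃₄≤ h)) (ℕ.m⊔n≤o⇒m≤o N₃ N₄ (N₃₄≤ k)))
        Bη<δ/2 Dθ<δ/2

fromℚ : ℚ → ℝ
fromℚ p = mkℝ (λ _ → p) (const-cauchy p)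

fromℕ : ℕ → ℝ
fromℕ n = fromℚ (+ n ℚ./ 1)

0ℝ 1ℝ : ℝ
0ℝ = fromℚ 0ℚ
1ℝ = fromℚ 1ℚ

infixl 6 _+_ _-_
infixl 7 _*_
infix  8 -_

_+_ : ℝ → ℝ → ℝ
x + y = mkℝ (λ n → seq x n ℚ.+ seq y n) (+-cauchy (seq x) (seq y) (cauchy x) (cauchy y))

_*_ : ℝ → ℝ → ℝ
x * y = mkℝ (λ n → seq x n ℚ.* seq y n) (*-cauchy (seq x) (seq y) (cauchy x) (cauchy y))

-_ : ℝ → ℝ
- x = mkℝ (λ n → ℚ.- seq x n) (neg-cauchy (seq x) (cauchy x))

_-_ : ℝ → ℝ → ℝ
x - y = x + (- y)

∣_∣ : ℝ → ℝ
∣ x ∣ = mkℝ (λ n → ℚ.∣ seq x n ∣) (abs-cauchy (seq x) (cauchy x))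

rawRing : RawRing 0ℓ 0ℓ
rawRing = record
  { Carrier = ℝ ; _≈_ = _≈_ ; _+_ = _+_ ; _*_ = _*_ ; -_ = -_ ; 0# = 0ℝ ; 1# = 1ℝ }

open RawSemiringDefs (RawRing.rawSemiring rawRing) public using (_^_)

------------------------------------------------------------------------
-- Roots, exponentials and logarithms, given as the graphs of the
-- corresponding (uniquely determined) functions

-- y = x ^ (p / q), for x ≥ 0 and q ≥ 1.
record IsRationalPower (x : ℝ) (p q : ℕ) (y : ℝ) : Set where
  field
    nonNegative : 0ℝ ≤ y
    power       : y ^ q ≈ x ^ p

-- y = b ^ x, for a base b > 1 and a real exponent x.  Every rational is of
-- the form (m - n) / q, and b ^ ((m - n) / q) ≤ y says b ^ m ≤ b ^ n * y ^ q;
-- thus y is pinned down as the supremum of the b ^ r over rationals r ≤ x and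
-- the infimum over rationals r ≥ x.
record IsExponential (b x y : ℝ) : Set where
  field
    positive : 0ℝ < y
    lower    : ∀ m n q → 1 ℕ.≤ q → fromℕ m ≤ fromℕ n + fromℕ q * x →
               b ^ m ≤ b ^ n * y ^ q
    upper    : ∀ m n q → 1 ℕ.≤ q → fromℕ n + fromℕ q * x ≤ fromℕ m →
               b ^ n * y ^ q ≤ b ^ m

-- l = log₂ y
IsLog₂ : (y l : ℝ) → Set
IsLog₂ y l = IsExponential (fromℕ 2) l y

------------------------------------------------------------------------
-- Real polynomials in n variables

Exponent : ℕ → Set
Exponent n = Vec ℕ n

-- A finite sum of terms c · x₁^α₁ ⋯ xₙ^αₙ.  The exponents are required to be
-- distinct, so that the listed numbers are the coefficients of the polynomial;
-- zero coefficients are allowed.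
record Polynomial (n : ℕ) : Set where
  field
    terms    : List (ℝ × Exponent n)
    distinct : Unique (List.map proj₂ terms)

open Polynomial public

sumℝ : List ℝ → ℝ
sumℝ = List.foldr _+_ 0ℝ

monomial : ∀ {n} → Exponent n → Vec ℝ n → ℝ
monomial α x = Vec.foldr (λ _ → ℝ) _*_ 1ℝ (Vec.zipWith _^_ x α)

eval : ∀ {n} → Polynomial n → Vec ℝ n → ℝ
eval q x = sumℝ (List.map (λ (c , α) → c * monomial α x) (terms q))

-- The total degree of q is at most the real number d.
HasDegreeAtMost : ∀ {n} → Polynomial n → ℝ → Set
HasDegreeAtMost q d = All (λ (c , α) → ¬ c ≈ 0ℝ → fromℕ (Vec.sum α) ≤ d) (terms q)

coefficientNorm : ∀ {n} → Polynomial n → ℝ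
coefficientNorm q = sumℝ (List.map (λ (c , _) → ∣ c ∣) (terms q))

------------------------------------------------------------------------
-- CNF formulas

data Literal (n : ℕ) : Set where
  pos neg : Fin n → Literal n

Clause : ℕ → Set
Clause n = List (Literal n)

CNF : ℕ → Set
CNF n = List (Clause n)

evalLiteral : ∀ {n} → Vec Bool n → Literal n → Bool
evalLiteral x (pos i) = lookup x i
evalLiteral x (neg i) = not (lookup x i)

evalClause : ∀ {n} → Vec Bool n → Clause n → Bool
evalClause x = any (evalLiteral x)

evalCNF : ∀ {n} → CNF n → Vec Bool n → Bool
evalCNF φ x = all (evalClause x) φ

HasWidthAtMost : ∀ {n} → CNF n → ℕ → Set
HasWidthAtMost φ k = All (λ c → length c ℕ.≤ k) φ

_Computes_ : ∀ {n} → CNF n → (Vec Bool n → Bool) → Set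
φ Computes g = ∀ x → evalCNF φ x ≡ g x

⟦_⟧ : Bool → ℝ
⟦ b ⟧ = if b then 1ℝ else 0ℝ

{-# OPTIONS --safe #-}

-- Let ω be a tuple of r variables and resample a random coordinate of it repeatedly, never
-- revealing a falsified clause of φ.  On states this is the operator D R D, where R is the sum
-- over the coordinates of the resampling operators and D = D(x) multiplies by the indicator that
-- no clause with all variables in ω is falsified by x.  A product of n such operators only looks
-- at r + n variables, so the mean over ω of (D R D)^n 1 is a polynomial in x of degree r + n.
-- If φ holds at x then D = 1 and D R D 1 = r.  If x falsifies a clause, a random ω contains its
-- variables with probability at least μ = (r/4ℓ)^k, and by the Efron–Stein inequality D R D has
-- norm at most r - μ.  Applying the Chebyshev polynomial that is large at r and bounded by 1 on
-- [-(r - μ), r - μ] turns s steps into an error 2(1 + M/r)^(-s) as soon as (M/r)² ≤ μ/r, that is,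
-- M² (4ℓ)^k ≤ r^(k+1).  With M ≈ log(1/ε) and s ≈ r this gives degree O(r) for
-- r ≈ ℓ^(k/(k+1)) log(1/ε)^(2/(k+1)).  When 4r > ℓ, the exact polynomial of φ serves.

module Submission where

-- Two demands shape the construction. The value at satisfying inputs has to be exactly 1: there
-- every function obtained from the constant 1 stays constant, so its mean is one number that does
-- not depend on `x`, and the polynomial is divided by that number. And the approximation itself is
-- built over the rationals, where no eigenbasis is at hand: the norm of the operator is derived
-- from its quadratic form, and the Chebyshev bound from a conserved energy, without the spectral
-- theorem. The coefficient norm does not follow from the degree, because the Chebyshev recurrence
-- rescales and adds. Degree and norm are therefore carried together through every step, relative to
-- the variables of the current tuple: multiplying by the detector is then free, and only the
-- exchange of a variable has a price, one degree and a factor 3. Real numbers enter only at the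
-- end, to pick the naturals `M` and `r` and to compare the result with `ε` and `32^d`. Logarithm
-- and powers are known through their graphs alone, so each comparison is reduced to an inequality
-- between integer powers.

module Rat where

  -- Rational inequalities, powers and the embedding of the naturals.

  open import Data.Rational.Base
  open import Data.Rational.Properties
  open import Data.Rational.Solver using (module +-*-Solver)
  import Data.Rational.Unnormalised.Base as ℚᵘ
  import Data.Rational.Unnormalised.Properties as ℚᵘ
  open import Data.Nat.Base as ℕ using (ℕ; zero; suc)
  import Data.Nat.Properties as ℕ
  open import Data.Integer.Base as ℤ using ()
  import Data.Integer.Properties as ℤ
  open import Data.Product.Base using (_×_; _,_; ∃-syntax)
  open import Data.Sum.Base using (inj₁; inj₂)
  open import Relation.Binary.PropositionalEquality
  open import Relation.Nullary.Decidable.Core using (yes; no)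
  open import Algebra.Bundles using (CommutativeRing)
  open import Algebra.Properties.CommutativeSemiring.Exp
    (CommutativeRing.commutativeSemiring +-*-commutativeRing)
    using (_^_; ^-assocʳ; ^-distrib-*; ^-homo-*) public
  open import Data.Empty using (⊥-elim)

  -- The usual route to an inequality below: name the nonnegative slack `s` and leave the identity
  -- to the ring solver.
  p≡q+s⇒q≤p : ∀ {p q} s → 0ℚ ≤ s → p ≡ q + s → q ≤ p
  p≡q+s⇒q≤p {p} {q} s 0≤s eq = begin
    q        ≡⟨ sym (+-identityʳ q) ⟩
    q + 0ℚ   ≤⟨ +-monoʳ-≤ q 0≤s ⟩
    q + s    ≡⟨ sym eq ⟩
    p        ∎
    where open ≤-Reasoning

  p≤q⇒0≤q-p : ∀ {p q} → p ≤ q → 0ℚ ≤ q - p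
  p≤q⇒0≤q-p {p} {q} p≤q = begin
    0ℚ      ≡⟨ sym (+-inverseʳ p) ⟩
    p - p   ≤⟨ +-monoˡ-≤ (- p) p≤q ⟩
    q - p   ∎
    where open ≤-Reasoning

  0≤1 : 0ℚ ≤ 1ℚ
  0≤1 = nonNegative⁻¹ 1ℚ

  0<1 : 0ℚ < 1ℚ
  0<1 = positive⁻¹ 1ℚ

  0≤p+q : ∀ {p q} → 0ℚ ≤ p → 0ℚ ≤ q → 0ℚ ≤ p + q
  0≤p+q = +-mono-≤

  *-monoʳ-≤-0≤ : ∀ r {p q} → 0ℚ ≤ r → p ≤ q → p * r ≤ q * r
  *-monoʳ-≤-0≤ r 0≤r = *-monoʳ-≤-nonNeg r {{nonNegative 0≤r}}

  *-monoˡ-≤-0≤ : ∀ r {p q} → 0ℚ ≤ r → p ≤ q → r * p ≤ r * q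
  *-monoˡ-≤-0≤ r 0≤r = *-monoˡ-≤-nonNeg r {{nonNegative 0≤r}}

  0≤p*q : ∀ {p q} → 0ℚ ≤ p → 0ℚ ≤ q → 0ℚ ≤ p * q
  0≤p*q {p} {q} 0≤p 0≤q = subst (_≤ p * q) (*-zeroˡ q) (*-monoʳ-≤-0≤ q 0≤q 0≤p)

  0<p*q : ∀ {p q} → 0ℚ < p → 0ℚ < q → 0ℚ < p * q
  0<p*q {p} {q} 0<p 0<q = positive⁻¹ (p * q) {{pos*pos⇒pos p {{positive 0<p}} q {{positive 0<q}}}}

  *-mono-≤ : ∀ {p q r s} → 0ℚ ≤ p → 0ℚ ≤ r → p ≤ q → r ≤ s → p * r ≤ q * s
  *-mono-≤ {p} {q} {r} {s} 0≤p 0≤r p≤q r≤s =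
    ≤-trans (*-monoʳ-≤-0≤ r 0≤r p≤q) (*-monoˡ-≤-0≤ q (≤-trans 0≤p p≤q) r≤s)

  *-cancelˡ-≤-0< : ∀ r {p q} → 0ℚ < r → r * p ≤ r * q → p ≤ q
  *-cancelˡ-≤-0< r 0<r = *-cancelˡ-≤-pos r {{positive 0<r}}

  neg-square : ∀ p → - p * - p ≡ p * p
  neg-square = solve 1 (λ p → (:- p) :* (:- p) := p :* p) refl
    where open +-*-Solver

  0≤p² : ∀ p → 0ℚ ≤ p * p
  0≤p² p with ≤-total 0ℚ p
  ... | inj₁ 0≤p = 0≤p*q 0≤p 0≤p
  ... | inj₂ p≤0 = subst (0ℚ ≤_) (neg-square p) (0≤p*q (neg-antimono-≤ p≤0) (neg-antimono-≤ p≤0))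

  p²≤q²⇒∣p∣≤q : ∀ {p q} → 0ℚ ≤ q → p * p ≤ q * q → ∣ p ∣ ≤ q
  p²≤q²⇒∣p∣≤q {p} {q} 0≤q p²≤q² with ∣ p ∣ ≤? q
  ... | yes ∣p∣≤q = ∣p∣≤q
  ... | no ∣p∣≰q = ⊥-elim (<-irrefl refl (<-≤-trans q²<p² p²≤q²))
    where
    q<∣p∣ = ≰⇒> ∣p∣≰q
    ∣p∣²≡p² : ∣ p ∣ * ∣ p ∣ ≡ p * p
    ∣p∣²≡p² with ∣p∣≡p∨∣p∣≡-p p
    ... | inj₁ e = cong₂ _*_ e e
    ... | inj₂ e = trans (cong₂ _*_ e e) (neg-square p)
    q²<p² : q * q < p * p
    q²<p² = subst (q * q <_) ∣p∣²≡p²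
      (≤-<-trans (*-monoˡ-≤-0≤ q 0≤q (<⇒≤ q<∣p∣))
                 (*-monoˡ-<-pos ∣ p ∣ {{positive (≤-<-trans 0≤q q<∣p∣)}} q<∣p∣))

  p≤∣p∣ : ∀ p → p ≤ ∣ p ∣
  p≤∣p∣ p with ≤-total 0ℚ p
  ... | inj₁ 0≤p = ≤-reflexive (sym (0≤p⇒∣p∣≡p 0≤p))
  ... | inj₂ p≤0 = ≤-trans p≤0 (0≤∣p∣ p)

  1^n≡1 : ∀ n → 1ℚ ^ n ≡ 1ℚ
  1^n≡1 zero    = refl
  1^n≡1 (suc n) = trans (*-identityˡ _) (1^n≡1 n)

  0≤p^n : ∀ {p} n → 0ℚ ≤ p → 0ℚ ≤ p ^ n
  0≤p^n zero    0≤p = 0≤1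
  0≤p^n (suc n) 0≤p = 0≤p*q 0≤p (0≤p^n n 0≤p)

  0<p^n : ∀ {p} n → 0ℚ < p → 0ℚ < p ^ n
  0<p^n zero    0<p = 0<1
  0<p^n (suc n) 0<p = 0<p*q 0<p (0<p^n n 0<p)

  ^-monoˡ-≤ : ∀ {p q} n → 0ℚ ≤ p → p ≤ q → p ^ n ≤ q ^ n
  ^-monoˡ-≤ zero    0≤p p≤q = ≤-refl
  ^-monoˡ-≤ (suc n) 0≤p p≤q = *-mono-≤ 0≤p (0≤p^n n 0≤p) p≤q (^-monoˡ-≤ n 0≤p p≤q)

  1≤p^n : ∀ {p} n → 1ℚ ≤ p → 1ℚ ≤ p ^ n
  1≤p^n zero    1≤p = ≤-refl
  1≤p^n (suc n) 1≤p = *-mono-≤ 0≤1 0≤1 1≤p (1≤p^n n 1≤p)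

  ^-monoʳ-≤ : ∀ {p m n} → 1ℚ ≤ p → m ℕ.≤ n → p ^ m ≤ p ^ n
  ^-monoʳ-≤ {n = n} 1≤p ℕ.z≤n       = 1≤p^n n 1≤p
  ^-monoʳ-≤ {p}     1≤p (ℕ.s≤s m≤n) = *-monoˡ-≤-0≤ p (≤-trans 0≤1 1≤p) (^-monoʳ-≤ 1≤p m≤n)

  ^-antimonoʳ-≤ : ∀ {p m n} → 0ℚ ≤ p → p ≤ 1ℚ → m ℕ.≤ n → p ^ n ≤ p ^ m
  ^-antimonoʳ-≤ {n = zero}      0≤p p≤1 ℕ.z≤n = ≤-refl
  ^-antimonoʳ-≤ {p} {n = suc n} 0≤p p≤1 ℕ.z≤n = ≤-trans
    (*-mono-≤ 0≤p (0≤p^n n 0≤p) p≤1 (^-antimonoʳ-≤ {n = n} 0≤p p≤1 ℕ.z≤n)) (≤-reflexive (*-identityˡ 1ℚ))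
  ^-antimonoʳ-≤ {p} 0≤p p≤1 (ℕ.s≤s m≤n) = *-monoˡ-≤-0≤ p 0≤p (^-antimonoʳ-≤ 0≤p p≤1 m≤n)

  ι : ℕ → ℚ
  ι n = ℤ.+ n / 1

  private
    toℚᵘ-ι : ∀ n → toℚᵘ (ι n) ℚᵘ.≃ ℚᵘ.mkℚᵘ (ℤ.+ n) 0
    toℚᵘ-ι n = toℚᵘ-fromℚᵘ (ℚᵘ.mkℚᵘ (ℤ.+ n) 0)

  ι-+ : ∀ m n → ι (m ℕ.+ n) ≡ ι m + ι n
  ι-+ m n = toℚᵘ-injective (ℚᵘ.≃-trans (toℚᵘ-ι (m ℕ.+ n))
    (ℚᵘ.≃-trans (ℚᵘ.*≡* eq) (ℚᵘ.≃-sym (ℚᵘ.≃-trans (toℚᵘ-homo-+ (ι m) (ι n))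
      (ℚᵘ.+-cong (toℚᵘ-ι m) (toℚᵘ-ι n))))))
    where
    eq : ℤ.+ (m ℕ.+ n) ℤ.* (ℤ.+ 1 ℤ.* ℤ.+ 1) ≡ (ℤ.+ m ℤ.* ℤ.+ 1 ℤ.+ ℤ.+ n ℤ.* ℤ.+ 1) ℤ.* ℤ.+ 1
    eq = trans (ℤ.*-identityʳ _) (trans (cong₂ ℤ._+_ (sym (ℤ.*-identityʳ (ℤ.+ m))) (sym (ℤ.*-identityʳ (ℤ.+ n))))
           (sym (ℤ.*-identityʳ _)))

  ι-* : ∀ m n → ι (m ℕ.* n) ≡ ι m * ι n
  ι-* m n = toℚᵘ-injective (ℚᵘ.≃-trans (toℚᵘ-ι (m ℕ.* n))
    (ℚᵘ.≃-trans (ℚᵘ.*≡* eq) (ℚᵘ.≃-sym (ℚᵘ.≃-trans (toℚᵘ-homo-* (ι m) (ι n))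
      (ℚᵘ.*-cong (toℚᵘ-ι m) (toℚᵘ-ι n))))))
    where
    eq : ℤ.+ (m ℕ.* n) ℤ.* (ℤ.+ 1 ℤ.* ℤ.+ 1) ≡ (ℤ.+ m ℤ.* ℤ.+ n) ℤ.* ℤ.+ 1
    eq = cong (ℤ._* ℤ.+ 1) (ℤ.pos-* m n)

  ι-suc : ∀ n → ι (suc n) ≡ 1ℚ + ι n
  ι-suc = ι-+ 1

  ι-^ : ∀ m n → ι (m ℕ.^ n) ≡ ι m ^ n
  ι-^ m zero    = refl
  ι-^ m (suc n) = trans (ι-* m (m ℕ.^ n)) (cong (ι m *_) (ι-^ m n))

  0≤ι : ∀ n → 0ℚ ≤ ι n
  0≤ι n = nonNegative⁻¹ (ι n) {{normalize-nonNeg n 1}}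

  0<ι : ∀ {n} → 1 ℕ.≤ n → 0ℚ < ι n
  0<ι {suc n} _ = positive⁻¹ (ι (suc n)) {{normalize-pos (suc n) 1}}

  ι-mono-≤ : ∀ {m n} → m ℕ.≤ n → ι m ≤ ι n
  ι-mono-≤ {m} {n} m≤n = p≡q+s⇒q≤p (ι (n ℕ.∸ m)) (0≤ι (n ℕ.∸ m))
    (trans (cong ι (sym (ℕ.m+[n∸m]≡n m≤n))) (ι-+ m (n ℕ.∸ m)))

  ι-mono-< : ∀ {m n} → m ℕ.< n → ι m < ι n
  ι-mono-< {m} {n} m<n = <-≤-trans
    (subst₂ _<_ (+-identityˡ (ι m)) (sym (ι-suc m)) (+-monoˡ-< (ι m) 0<1)) (ι-mono-≤ m<n)

  ι-cancel-≤ : ∀ {m n} → ι m ≤ ι n → m ℕ.≤ n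
  ι-cancel-≤ {m} {n} ιm≤ιn with m ℕ.≤? n
  ... | yes m≤n = m≤n
  ... | no m≰n = ⊥-elim (<-irrefl refl (<-≤-trans (ι-mono-< (ℕ.≰⇒> m≰n)) ιm≤ιn))

  bernoulli : ∀ b n → 0ℚ ≤ b → 1ℚ + ι n * b ≤ (1ℚ + b) ^ n
  bernoulli b zero    0≤b = ≤-reflexive (trans (cong (1ℚ +_) (*-zeroˡ b)) (+-identityʳ 1ℚ))
  bernoulli b (suc n) 0≤b = ≤-trans
    (p≡q+s⇒q≤p (ι n * (b * b)) (0≤p*q (0≤ι n) (0≤p² b))
      (trans (expand b (ι n)) (cong (λ m → 1ℚ + m * b + ι n * (b * b)) (sym (ι-suc n)))))
    (*-monoˡ-≤-0≤ (1ℚ + b) (0≤p+q 0≤1 0≤b) (bernoulli b n 0≤b))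
    where
    open +-*-Solver
    expand : ∀ b m → (1ℚ + b) * (1ℚ + m * b) ≡ 1ℚ + (1ℚ + m) * b + m * (b * b)
    expand = solve 2 (λ b m → (con 1ℚ :+ b) :* (con 1ℚ :+ m :* b)
      := con 1ℚ :+ (con 1ℚ :+ m) :* b :+ m :* (b :* b)) refl

  -- Search down from a known bound: the first candidate that fails lies below `p`, so its successor
  -- is at most `1 + p`. If 0 is reached, `- 1 ≤ p` takes over.
  round-up : ∀ N p → - 1ℚ ≤ p → p ≤ ι N → ∃[ n ] (p ≤ ι n × ι n ≤ 1ℚ + p)
  round-up zero    p -1≤p p≤N = 0 , p≤N , subst (_≤ 1ℚ + p) (+-inverseʳ 1ℚ) (+-monoʳ-≤ 1ℚ -1≤p)
  round-up (suc N) p -1≤p p≤N with p ≤? ι N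
  ... | yes p≤N′ = round-up N p -1≤p p≤N′
  ... | no p≰N = suc N , p≤N , subst (_≤ 1ℚ + p) (sym (ι-suc N)) (+-monoʳ-≤ 1ℚ (<⇒≤ (≰⇒> p≰N)))

  archimedean : ∀ p → ∃[ N ] p ≤ ι N
  archimedean p@(mkℚ n d-1 _) = ℤ.∣ n ∣ , toℚᵘ-cancel-≤
    (ℚᵘ.≤-trans (ℚᵘ.*≤* (begin
      n ℤ.* ℤ.+ 1                 ≡⟨ ℤ.*-identityʳ n ⟩
      n                         ≤⟨ n≤∣n∣ n ⟩
      ℤ.+ ℤ.∣ n ∣                 ≤⟨ ℤ.+≤+ (ℕ.m≤m*n ℤ.∣ n ∣ (suc d-1)) ⟩
      ℤ.+ (ℤ.∣ n ∣ ℕ.* suc d-1)   ≡⟨ ℤ.pos-* ℤ.∣ n ∣ (suc d-1) ⟩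
      ℤ.+ ℤ.∣ n ∣ ℤ.* ℤ.+ suc d-1   ∎)) (ℚᵘ.≤-reflexive (ℚᵘ.≃-sym (toℚᵘ-ι ℤ.∣ n ∣))))
    where
    open ℤ.≤-Reasoning
    n≤∣n∣ : ∀ n → n ℤ.≤ ℤ.+ ℤ.∣ n ∣
    n≤∣n∣ (ℤ.+ n)       = ℤ.≤-refl
    n≤∣n∣ ℤ.-[1+ n ]  = ℤ.-≤+

-- Multilinear polynomials on the cube: degree and coefficient norm.

module Multilinear where
  open Rat
  open import Data.Rational.Base
  open import Data.Rational.Properties
  open import Data.Rational.Solver using (module +-*-Solver)
  open import Data.Nat.Base as ℕ using (ℕ; zero; suc)
  import Data.Nat.Properties as ℕ
  open import Data.Bool.Base using (Bool; true; false; if_then_else_)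
  open import Data.Fin.Base using (Fin; zero; suc)
  open import Data.List.Base as List using (List; []; _∷_; length)
  import Data.List.Properties as List
  open import Data.List.Membership.Propositional using (_∈_)
  open import Data.List.Membership.Propositional.Properties using (∈-allFin)
  open import Data.List.Relation.Unary.Any using (here; there)
  open import Data.List.Relation.Binary.Subset.Propositional using (_⊆_)
  open import Data.Product.Base using (_,_; ∃-syntax)
  open import Data.Sum.Base using (_⊎_; inj₁; inj₂)
  open import Data.Vec.Base as Vec using (Vec; []; _∷_; lookup)
  import Data.Vec.Properties as Vec
  open import Function.Base using (_∘_)
  open import Relation.Binary.PropositionalEquality

  Cube : ℕ → Set
  Cube n = Vec Bool n

  sumCube : ∀ {n} → (Cube n → ℚ) → ℚ
  sumCube {zero}  f = f []
  sumCube {suc n} f = sumCube (f ∘ (false ∷_)) + sumCube (f ∘ (true ∷_))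

  sumCube-cong : ∀ {n} {f g : Cube n → ℚ} → (∀ α → f α ≡ g α) → sumCube f ≡ sumCube g
  sumCube-cong {zero}  f≗g = f≗g []
  sumCube-cong {suc n} f≗g = cong₂ _+_ (sumCube-cong (f≗g ∘ (false ∷_))) (sumCube-cong (f≗g ∘ (true ∷_)))

  sumCube-mono : ∀ {n} {f g : Cube n → ℚ} → (∀ α → f α ≤ g α) → sumCube f ≤ sumCube g
  sumCube-mono {zero}  f≤g = f≤g []
  sumCube-mono {suc n} f≤g = +-mono-≤ (sumCube-mono (f≤g ∘ (false ∷_))) (sumCube-mono (f≤g ∘ (true ∷_)))

  sumCube-+ : ∀ {n} (f g : Cube n → ℚ) → sumCube (λ α → f α + g α) ≡ sumCube f + sumCube g
  sumCube-+ {zero}  f g = refl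
  sumCube-+ {suc n} f g = trans
    (cong₂ _+_ (sumCube-+ (f ∘ (false ∷_)) (g ∘ (false ∷_))) (sumCube-+ (f ∘ (true ∷_)) (g ∘ (true ∷_))))
    (interchange (sumCube (f ∘ (false ∷_))) _ _ _)
    where
    open +-*-Solver
    interchange : ∀ a b c d → (a + b) + (c + d) ≡ (a + c) + (b + d)
    interchange = solve 4 (λ a b c d → (a :+ b) :+ (c :+ d) := (a :+ c) :+ (b :+ d)) refl

  sumCube-* : ∀ {n} c (f : Cube n → ℚ) → sumCube (λ α → c * f α) ≡ c * sumCube f
  sumCube-* {zero}  c f = refl
  sumCube-* {suc n} c f = trans
    (cong₂ _+_ (sumCube-* c (f ∘ (false ∷_))) (sumCube-* c (f ∘ (true ∷_))))
    (sym (*-distribˡ-+ c _ _))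

  sumCube-0 : ∀ n → sumCube {n} (λ _ → 0ℚ) ≡ 0ℚ
  sumCube-0 zero    = refl
  sumCube-0 (suc n) = cong₂ _+_ (sumCube-0 n) (sumCube-0 n)

  bit : Bool → ℕ
  bit b = if b then 1 else 0

  weight : ∀ {n} → Cube n → ℕ
  weight α = Vec.sum (Vec.map bit α)

  mon : ∀ {n} → Cube n → Cube n → ℚ
  mon []          []      = 1ℚ
  mon (false ∷ α) (b ∷ x) = mon α x
  mon (true  ∷ α) (b ∷ x) = ι (bit b) * mon α x

  -- The coefficient of mon α in the multilinear polynomial that agrees with F on the cube.
  coef : ∀ {n} → (Cube n → ℚ) → Cube n → ℚ
  coef F []          = F []
  coef F (false ∷ α) = coef (F ∘ (false ∷_)) α
  coef F (true  ∷ α) = coef (λ x → F (true ∷ x) - F (false ∷ x)) α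

  coef-cong : ∀ {n} {F G : Cube n → ℚ} → (∀ x → F x ≡ G x) → ∀ α → coef F α ≡ coef G α
  coef-cong F≗G []          = F≗G []
  coef-cong F≗G (false ∷ α) = coef-cong (F≗G ∘ (false ∷_)) α
  coef-cong F≗G (true  ∷ α) = coef-cong (λ x → cong₂ _-_ (F≗G (true ∷ x)) (F≗G (false ∷ x))) α

  coef-+ : ∀ {n} (F G : Cube n → ℚ) α → coef (λ x → F x + G x) α ≡ coef F α + coef G α
  coef-+ F G []          = refl
  coef-+ F G (false ∷ α) = coef-+ (F ∘ (false ∷_)) (G ∘ (false ∷_)) α
  coef-+ F G (true  ∷ α) = trans
    (coef-cong (λ x → interchange (F (true ∷ x)) (G (true ∷ x)) (F (false ∷ x)) (G (false ∷ x))) α)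
    (coef-+ (λ x → F (true ∷ x) - F (false ∷ x)) (λ x → G (true ∷ x) - G (false ∷ x)) α)
    where
    open +-*-Solver
    interchange : ∀ a b c d → (a + b) - (c + d) ≡ (a - c) + (b - d)
    interchange = solve 4 (λ a b c d → (a :+ b) :- (c :+ d) := (a :- c) :+ (b :- d)) refl

  coef-* : ∀ {n} c (F : Cube n → ℚ) α → coef (λ x → c * F x) α ≡ c * coef F α
  coef-* c F []          = refl
  coef-* c F (false ∷ α) = coef-* c (F ∘ (false ∷_)) α
  coef-* c F (true  ∷ α) = trans
    (coef-cong (λ x → factor c (F (true ∷ x)) (F (false ∷ x))) α)
    (coef-* c (λ x → F (true ∷ x) - F (false ∷ x)) α)
    where
    open +-*-Solver
    factor : ∀ c a b → c * a - c * b ≡ c * (a - b)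
    factor = solve 3 (λ c a b → c :* a :- c :* b := c :* (a :- b)) refl

  coef-0 : ∀ {n} {F : Cube n → ℚ} → (∀ x → F x ≡ 0ℚ) → ∀ α → coef F α ≡ 0ℚ
  coef-0 F≗0 []          = F≗0 []
  coef-0 F≗0 (false ∷ α) = coef-0 (F≗0 ∘ (false ∷_)) α
  coef-0 F≗0 (true  ∷ α) = coef-0 (λ x → cong₂ _-_ (F≗0 (true ∷ x)) (F≗0 (false ∷ x))) α

  expansion : ∀ {n} (F : Cube n → ℚ) x → sumCube (λ α → coef F α * mon α x) ≡ F x
  expansion F []      = *-identityʳ (F [])
  expansion F (b ∷ x) = begin
    sumCube (λ α → coef F₀ α * mon α x) + sumCube (λ α → coef ΔF α * (ι (bit b) * mon α x))
      ≡⟨ cong (sumCube (λ α → coef F₀ α * mon α x) +_)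
           (trans (sumCube-cong (λ α → rotate (coef ΔF α) (ι (bit b)) (mon α x)))
                  (sumCube-* (ι (bit b)) (λ α → coef ΔF α * mon α x))) ⟩
    sumCube (λ α → coef F₀ α * mon α x) + ι (bit b) * sumCube (λ α → coef ΔF α * mon α x)
      ≡⟨ cong₂ (λ u v → u + ι (bit b) * v) (expansion F₀ x) (expansion ΔF x) ⟩
    F₀ x + ι (bit b) * ΔF x
      ≡⟨ select b ⟩
    F (b ∷ x) ∎
    where
    open ≡-Reasoning
    open +-*-Solver
    F₀ = F ∘ (false ∷_)
    ΔF = λ x → F (true ∷ x) - F (false ∷ x)
    rotate : ∀ a b c → a * (b * c) ≡ b * (a * c)
    rotate = solve 3 (λ a b c → a :* (b :* c) := b :* (a :* c)) refl
    select : ∀ b → F₀ x + ι (bit b) * ΔF x ≡ F (b ∷ x)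
    select false = solve 2 (λ p q → p :+ con 0ℚ :* (q :- p) := p) refl (F₀ x) (F (true ∷ x))
    select true  = solve 2 (λ p q → p :+ con 1ℚ :* (q :- p) := q) refl (F₀ x) (F (true ∷ x))

  -- The polynomial is kept as its function on the cube. The multilinear form is unique, so degree
  -- and coefficient norm are properties of `F`, and sums or means of such functions need no normal
  -- form.
  record IsPoly {n} (d : ℕ) (N : ℚ) (F : Cube n → ℚ) : Set where
    constructor mkPoly
    field
      degree : ∀ α → d ℕ.< weight α → coef F α ≡ 0ℚ
      norm   : sumCube (λ α → ∣ coef F α ∣) ≤ N

  open IsPoly public

  poly-cong : ∀ {n d N} {F G : Cube n → ℚ} → (∀ x → F x ≡ G x) → IsPoly d N F → IsPoly d N G
  poly-cong F≗G p = mkPoly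
    (λ α d<α → trans (sym (coef-cong F≗G α)) (degree p α d<α))
    (≤-trans (≤-reflexive (sumCube-cong (λ α → cong ∣_∣ (sym (coef-cong F≗G α))))) (norm p))

  poly-weaken : ∀ {n d d′ N N′} {F : Cube n → ℚ} → d ℕ.≤ d′ → N ≤ N′ → IsPoly d N F → IsPoly d′ N′ F
  poly-weaken d≤d′ N≤N′ p = mkPoly
    (λ α d′<α → degree p α (ℕ.≤-<-trans d≤d′ d′<α)) (≤-trans (norm p) N≤N′)

  poly-0 : ∀ {n d} → IsPoly {n} d 0ℚ (λ _ → 0ℚ)
  poly-0 {n} = mkPoly (λ α _ → coef-0 (λ _ → refl) α)
    (≤-reflexive (trans (sumCube-cong {n} (λ α → cong ∣_∣ (coef-0 {n} {λ _ → 0ℚ} (λ _ → refl) α))) (sumCube-0 n)))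

  poly-+ : ∀ {n d N M} {F G : Cube n → ℚ} → IsPoly d N F → IsPoly d M G →
           IsPoly d (N + M) (λ x → F x + G x)
  poly-+ {F = F} {G} p q = mkPoly
    (λ α d<α → trans (coef-+ F G α) (cong₂ _+_ (degree p α d<α) (degree q α d<α)))
    (≤-trans (sumCube-mono (λ α → ≤-trans (≤-reflexive (cong ∣_∣ (coef-+ F G α)))
                                          (∣p+q∣≤∣p∣+∣q∣ (coef F α) (coef G α))))
      (≤-trans (≤-reflexive (sumCube-+ (∣_∣ ∘ coef F) (∣_∣ ∘ coef G))) (+-mono-≤ (norm p) (norm q))))

  poly-* : ∀ {n d N} c {F : Cube n → ℚ} → IsPoly d N F → IsPoly d (∣ c ∣ * N) (λ x → c * F x)
  poly-* c {F} p = mkPoly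
    (λ α d<α → trans (coef-* c F α) (trans (cong (c *_) (degree p α d<α)) (*-zeroʳ c)))
    (≤-trans (≤-reflexive (trans
        (sumCube-cong (λ α → trans (cong ∣_∣ (coef-* c F α)) (∣p*q∣≡∣p∣*∣q∣ c (coef F α))))
        (sumCube-* ∣ c ∣ (∣_∣ ∘ coef F))))
      (*-monoˡ-≤-0≤ ∣ c ∣ (0≤∣p∣ c) (norm p)))

  -- `V` may repeat variables, as tuples drawn with replacement do; the bounds are in terms of
  -- `length V`, so repetition merely weakens them.
  Junta : ∀ {n} → List (Fin n) → (Cube n → ℚ) → Set
  Junta V F = ∀ x y → (∀ i → i ∈ V → lookup x i ≡ lookup y i) → F x ≡ F y

  Bounded : ∀ {n} → ℚ → (Cube n → ℚ) → Set
  Bounded B F = ∀ x → ∣ F x ∣ ≤ B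

  junta-⊆ : ∀ {n V W} {F : Cube n → ℚ} → V ⊆ W → Junta V F → Junta W F
  junta-⊆ V⊆W j x y x~y = j x y (λ i i∈V → x~y i (V⊆W i∈V))

  junta-* : ∀ {n V} {F G : Cube n → ℚ} → Junta V F → Junta V G → Junta V (λ x → F x * G x)
  junta-* j k x y x~y = cong₂ _*_ (j x y x~y) (k x y x~y)

  tailVars : ∀ {n} → List (Fin (suc n)) → List (Fin n)
  tailVars []          = []
  tailVars (zero  ∷ V) = tailVars V
  tailVars (suc i ∷ V) = i ∷ tailVars V

  ∈-tailVars : ∀ {n i} (V : List (Fin (suc n))) → suc i ∈ V → i ∈ tailVars V
  ∈-tailVars (zero  ∷ V) (there i∈V)  = ∈-tailVars V i∈V
  ∈-tailVars (suc j ∷ V) (here refl)  = here refl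
  ∈-tailVars (suc j ∷ V) (there i∈V)  = there (∈-tailVars V i∈V)

  length-tailVars : ∀ {n} (V : List (Fin (suc n))) → length (tailVars V) ℕ.≤ length V
  length-tailVars []          = ℕ.z≤n
  length-tailVars (zero  ∷ V) = ℕ.m≤n⇒m≤1+n (length-tailVars V)
  length-tailVars (suc i ∷ V) = ℕ.s≤s (length-tailVars V)

  -- Only if the first variable occurs in `V` may the induction for juntas spend a factor 3, and
  -- exactly then the remaining list is shorter.
  head-relevant? : ∀ {n} (V : List (Fin (suc n))) →
    length (tailVars V) ℕ.< length V ⊎ (∀ {i} → i ∈ V → ∃[ j ] i ≡ suc j)
  head-relevant? []          = inj₂ λ ()
  head-relevant? (zero  ∷ V) = inj₁ (ℕ.s≤s (length-tailVars V))
  head-relevant? (suc j ∷ V) with head-relevant? V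
  ... | inj₁ shorter = inj₁ (ℕ.s≤s shorter)
  ... | inj₂ allSuc  = inj₂ λ { (here refl) → j , refl ; (there i∈V) → allSuc i∈V }

  junta-tail : ∀ {n} {V : List (Fin (suc n))} {F} → Junta V F → ∀ b → Junta (tailVars V) (F ∘ (b ∷_))
  junta-tail {V = V} j b x y x~y = j (b ∷ x) (b ∷ y)
    λ { zero _ → refl ; (suc i) i∈V → x~y i (∈-tailVars V i∈V) }

  3ℚ : ℚ
  3ℚ = ι 3

  0≤3^n : ∀ n → 0ℚ ≤ 3ℚ ^ n
  0≤3^n n = 0≤p^n n (0≤ι 3)

  1≤3 : 1ℚ ≤ 3ℚ
  1≤3 = ι-mono-≤ {1} {3} (ℕ.s≤s ℕ.z≤n)

  -- Split off the first variable. If `V` mentions it, the restriction to `false` keeps the bound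
  -- `B` and the difference of the restrictions has bound `B + B`, both on a shorter list: a factor
  -- 1 + 2 = 3 per variable. If not, the difference vanishes.
  junta-isPoly : ∀ {n} (V : List (Fin n)) {B} {F : Cube n → ℚ} → Junta V F → 0ℚ ≤ B → Bounded B F →
                 IsPoly (length V) (3ℚ ^ length V * B) F
  junta-isPoly {zero} V {B} {F} j 0≤B bd = mkPoly (λ { [] () })
    (≤-trans (bd []) (subst (_≤ 3ℚ ^ length V * B) (*-identityˡ B)
      (*-monoʳ-≤-0≤ B 0≤B (1≤p^n (length V) 1≤3))))
  junta-isPoly {suc n} V {B} {F} j 0≤B bd with head-relevant? V
  ... | inj₂ allSuc = mkPoly deg′ norm′
    where
    open ≤-Reasoning
    F₀ = F ∘ (false ∷_)
    ΔF = λ x → F (true ∷ x) - F (false ∷ x)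
    IH : IsPoly (length V) (3ℚ ^ length V * B) F₀
    IH = poly-weaken (length-tailVars V)
      (*-monoʳ-≤-0≤ B 0≤B (^-monoʳ-≤ 1≤3 (length-tailVars V)))
      (junta-isPoly (tailVars V) (junta-tail {V = V} j false) 0≤B (bd ∘ (false ∷_)))
    agree : ∀ x i → i ∈ V → lookup (true ∷ x) i ≡ lookup (false ∷ x) i
    agree x i i∈V with allSuc i∈V
    ... | k , refl = refl
    coef-ΔF : ∀ α → coef ΔF α ≡ 0ℚ
    coef-ΔF = coef-0 λ x → trans (cong (_- F₀ x) (j (true ∷ x) (false ∷ x) (agree x))) (+-inverseʳ (F₀ x))
    deg′ : ∀ α → length V ℕ.< weight α → coef F α ≡ 0ℚ
    deg′ (false ∷ α) d<α = degree IH α d<α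
    deg′ (true  ∷ α) d<α = coef-ΔF α
    norm′ : sumCube (λ α → ∣ coef F α ∣) ≤ 3ℚ ^ length V * B
    norm′ = begin
      sumCube (λ α → ∣ coef F₀ α ∣) + sumCube (λ α → ∣ coef ΔF α ∣)
        ≡⟨ cong (sumCube (λ α → ∣ coef F₀ α ∣) +_)
             (trans (sumCube-cong (λ α → cong ∣_∣ (coef-ΔF α))) (sumCube-0 n)) ⟩
      sumCube (λ α → ∣ coef F₀ α ∣) + 0ℚ
        ≡⟨ +-identityʳ _ ⟩
      sumCube (λ α → ∣ coef F₀ α ∣)
        ≤⟨ norm IH ⟩
      3ℚ ^ length V * B ∎
  ... | inj₁ shorter = mkPoly deg′ norm′
    where
    open ≤-Reasoning
    open +-*-Solver
    t = length (tailVars V)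
    F₀ = F ∘ (false ∷_)
    ΔF = λ x → F (true ∷ x) - F (false ∷ x)
    IH₀ : IsPoly t (3ℚ ^ t * B) F₀
    IH₀ = junta-isPoly (tailVars V) (junta-tail {V = V} j false) 0≤B (bd ∘ (false ∷_))
    IHΔ : IsPoly t (3ℚ ^ t * (B + B)) ΔF
    IHΔ = junta-isPoly (tailVars V)
      (λ x y x~y → cong₂ _-_ (junta-tail {V = V} j true x y x~y) (junta-tail {V = V} j false x y x~y))
      (0≤p+q 0≤B 0≤B)
      (λ x → ≤-trans (∣p-q∣≤∣p∣+∣q∣ (F (true ∷ x)) (F (false ∷ x))) (+-mono-≤ (bd (true ∷ x)) (bd (false ∷ x))))
    deg′ : ∀ α → length V ℕ.< weight α → coef F α ≡ 0ℚ
    deg′ (false ∷ α) d<α = degree IH₀ α (ℕ.<-trans shorter d<α)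
    deg′ (true  ∷ α) d<α = degree IHΔ α (ℕ.<-≤-trans shorter (ℕ.s≤s⁻¹ d<α))
    collect : ∀ a b → a * b + a * (b + b) ≡ 3ℚ * a * b
    collect = solve 2 (λ a b → a :* b :+ a :* (b :+ b) := con 3ℚ :* a :* b) refl
    norm′ : sumCube (λ α → ∣ coef F α ∣) ≤ 3ℚ ^ length V * B
    norm′ = begin
      sumCube (λ α → ∣ coef F₀ α ∣) + sumCube (λ α → ∣ coef ΔF α ∣)
        ≤⟨ +-mono-≤ (norm IH₀) (norm IHΔ) ⟩
      3ℚ ^ t * B + 3ℚ ^ t * (B + B)
        ≡⟨ collect (3ℚ ^ t) B ⟩
      3ℚ ^ suc t * B
        ≤⟨ *-monoʳ-≤-0≤ B 0≤B (^-monoʳ-≤ 1≤3 shorter) ⟩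
      3ℚ ^ length V * B ∎

  bounded-isPoly : ∀ {n} {F : Cube n → ℚ} → Bounded 1ℚ F → IsPoly n (3ℚ ^ n) F
  bounded-isPoly {n} {F} bd = subst₂ (λ d N → IsPoly d N F) (List.length-tabulate {n = n} (λ i → i))
    (trans (*-identityʳ _) (cong (3ℚ ^_) (List.length-tabulate {n = n} (λ i → i))))
    (junta-isPoly (List.allFin n)
      (λ x y x~y → cong F (trans (sym (Vec.tabulate∘lookup x))
        (trans (Vec.tabulate-cong (λ i → x~y i (∈-allFin i))) (Vec.tabulate∘lookup y))))
      0≤1 bd)

-- Means, inner products and Chebyshev polynomials of a self-adjoint contraction.

module Mean where
  open Rat
  open import Data.Rational.Base
  open import Data.Rational.Properties
  open import Data.Rational.Solver using (module +-*-Solver)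
  open import Data.Nat.Base using (ℕ; zero; suc)
  open import Data.Product.Base using (_×_; _,_; proj₁; proj₂)
  open import Relation.Binary.PropositionalEquality

  -- Iterated averages satisfy these axioms by induction on the coordinates, so the inequalities of
  -- this module never look inside the sample space.
  record IsMean {Ω : Set} (𝔼 : (Ω → ℚ) → ℚ) : Set where
    field
      mean-cong : ∀ {f g} → (∀ ω → f ω ≡ g ω) → 𝔼 f ≡ 𝔼 g
      mean-+    : ∀ f g → 𝔼 (λ ω → f ω + g ω) ≡ 𝔼 f + 𝔼 g
      mean-*    : ∀ c f → 𝔼 (λ ω → c * f ω) ≡ c * 𝔼 f
      mean-mono : ∀ {f g} → (∀ ω → f ω ≤ g ω) → 𝔼 f ≤ 𝔼 g
      mean-1    : 𝔼 (λ _ → 1ℚ) ≡ 1ℚ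

    mean-const : ∀ c → 𝔼 (λ _ → c) ≡ c
    mean-const c = trans (mean-cong (λ _ → sym (*-identityʳ c)))
      (trans (mean-* c (λ _ → 1ℚ)) (trans (cong (c *_) mean-1) (*-identityʳ c)))

    mean-≥0 : ∀ {f} → (∀ ω → 0ℚ ≤ f ω) → 0ℚ ≤ 𝔼 f
    mean-≥0 {f} 0≤f = subst (_≤ 𝔼 f) (mean-const 0ℚ) (mean-mono 0≤f)

    mean-linear₃ : ∀ a b c f g h →
      𝔼 (λ ω → a * f ω + b * g ω + c * h ω) ≡ a * 𝔼 f + b * 𝔼 g + c * 𝔼 h
    mean-linear₃ a b c f g h = trans (mean-+ (λ ω → a * f ω + b * g ω) (λ ω → c * h ω))
      (cong₂ _+_ (trans (mean-+ (λ ω → a * f ω) (λ ω → b * g ω)) (cong₂ _+_ (mean-* a f) (mean-* b g)))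
                 (mean-* c h))

    variance : ∀ f → 𝔼 (λ ω → (f ω - 𝔼 f) * (f ω - 𝔼 f)) ≡ 𝔼 (λ ω → f ω * f ω) - 𝔼 f * 𝔼 f
    variance f = trans (mean-cong (λ ω → expand (f ω) (𝔼 f)))
      (trans (mean-linear₃ 1ℚ (- (𝔼 f + 𝔼 f)) (𝔼 f * 𝔼 f) (λ ω → f ω * f ω) f (λ _ → 1ℚ))
      (trans (cong (λ u → 1ℚ * 𝔼 (λ ω → f ω * f ω) + - (𝔼 f + 𝔼 f) * 𝔼 f + 𝔼 f * 𝔼 f * u) mean-1)
        (collect (𝔼 (λ ω → f ω * f ω)) (𝔼 f))))
      where
      open +-*-Solver
      expand : ∀ x m → (x - m) * (x - m) ≡ 1ℚ * (x * x) + - (m + m) * x + m * m * 1ℚ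
      expand = solve 2 (λ x m → (x :- m) :* (x :- m)
        := con 1ℚ :* (x :* x) :+ :- (m :+ m) :* x :+ m :* m :* con 1ℚ) refl
      collect : ∀ s m → 1ℚ * s + - (m + m) * m + m * m * 1ℚ ≡ s - m * m
      collect = solve 2 (λ s m → con 1ℚ :* s :+ :- (m :+ m) :* m :+ m :* m :* con 1ℚ := s :- m :* m) refl

    mean²≤mean-² : ∀ f → 𝔼 f * 𝔼 f ≤ 𝔼 (λ ω → f ω * f ω)
    mean²≤mean-² f = p≡q+s⇒q≤p _ (mean-≥0 (λ ω → 0≤p² (f ω - 𝔼 f)))
      (sym (trans (cong (𝔼 f * 𝔼 f +_) (variance f)) (cancel (𝔼 f * 𝔼 f) (𝔼 (λ ω → f ω * f ω)))))
      where
      open +-*-Solver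
      cancel : ∀ a b → a + (b - a) ≡ b
      cancel = solve 2 (λ a b → a :+ (b :- a) := b) refl

    -- Cauchy–Schwarz for a function f supported where the indicator h is 1.
    mean²-support : ∀ f h p → 0ℚ < p → 𝔼 h ≤ p →
      (∀ ω → h ω * h ω ≡ h ω) → (∀ ω → f ω * h ω ≡ f ω) →
      𝔼 f * 𝔼 f ≤ p * 𝔼 (λ ω → f ω * f ω)
    mean²-support f h p 0<p 𝔼h≤p h²≡h fh≡f = *-cancelˡ-≤-0< p 0<p (p≡q+s⇒q≤p s 0≤s (split p m q))
      where
      open +-*-Solver
      m = 𝔼 f
      q = 𝔼 (λ ω → f ω * f ω)
      s = (p * p * q + - (p * m + p * m) * m + m * m * p)
      expand : ∀ ω → (p * f ω - m * h ω) * (p * f ω - m * h ω)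
                   ≡ p * p * (f ω * f ω) + - (p * m + p * m) * f ω + m * m * h ω
      expand ω = trans (solve 4 (λ p f m h → (p :* f :- m :* h) :* (p :* f :- m :* h)
          := p :* p :* (f :* f) :+ :- (p :* m :+ p :* m) :* (f :* h) :+ m :* m :* (h :* h)) refl p (f ω) m (h ω))
        (cong₂ (λ u v → p * p * (f ω * f ω) + - (p * m + p * m) * u + m * m * v) (fh≡f ω) (h²≡h ω))
      0≤s : 0ℚ ≤ s
      0≤s = ≤-trans (mean-≥0 (λ ω → 0≤p² (p * f ω - m * h ω)))
        (≤-trans (≤-reflexive (trans (mean-cong expand)
            (mean-linear₃ (p * p) (- (p * m + p * m)) (m * m) (λ ω → f ω * f ω) f h)))
          (+-monoʳ-≤ (p * p * q + - (p * m + p * m) * m) (*-monoˡ-≤-0≤ (m * m) (0≤p² m) 𝔼h≤p)))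
      split : ∀ p m q → p * (p * q) ≡ p * (m * m) + (p * p * q + - (p * m + p * m) * m + m * m * p)
      split = solve 3 (λ p m q → p :* (p :* q)
        := p :* (m :* m) :+ (p :* p :* q :+ :- (p :* m :+ p :* m) :* m :+ m :* m :* p)) refl

  module InnerProduct {Ω : Set} {𝔼 : (Ω → ℚ) → ℚ} (isMean : IsMean 𝔼) where

    open IsMean isMean

    ⟨_,_⟩ : (Ω → ℚ) → (Ω → ℚ) → ℚ
    ⟨ f , g ⟩ = 𝔼 (λ ω → f ω * g ω)

    infixl 6 _⊕_ _⊖_
    infixr 7 _⊙_

    _⊕_ _⊖_ : (Ω → ℚ) → (Ω → ℚ) → Ω → ℚ
    (f ⊕ g) ω = f ω + g ω
    (f ⊖ g) ω = f ω - g ω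

    _⊙_ : ℚ → (Ω → ℚ) → Ω → ℚ
    (c ⊙ f) ω = c * f ω

    ip-comm : ∀ f g → ⟨ f , g ⟩ ≡ ⟨ g , f ⟩
    ip-comm f g = mean-cong (λ ω → *-comm (f ω) (g ω))

    ip-* : ∀ c f h → ⟨ c ⊙ f , h ⟩ ≡ c * ⟨ f , h ⟩
    ip-* c f h = trans (mean-cong (λ ω → *-assoc c (f ω) (h ω))) (mean-* c _)

    ip-- : ∀ f g h → ⟨ f ⊖ g , h ⟩ ≡ ⟨ f , h ⟩ - ⟨ g , h ⟩
    ip-- f g h = trans (mean-cong (λ ω → distrib (f ω) (g ω) (h ω)))
      (trans (mean-+ _ _) (cong (⟨ f , h ⟩ +_) (trans (mean-* (- 1ℚ) _) (negate ⟨ g , h ⟩))))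
      where
      open +-*-Solver
      distrib : ∀ a b c → (a - b) * c ≡ a * c + (- 1ℚ) * (b * c)
      distrib = solve 3 (λ a b c → (a :- b) :* c := a :* c :+ (:- con 1ℚ) :* (b :* c)) refl
      negate : ∀ a → (- 1ℚ) * a ≡ - a
      negate = solve 1 (λ a → (:- con 1ℚ) :* a := :- a) refl

    ip-*ʳ : ∀ c f h → ⟨ f , c ⊙ h ⟩ ≡ c * ⟨ f , h ⟩
    ip-*ʳ c f h = trans (ip-comm f _) (trans (ip-* c h f) (cong (c *_) (ip-comm h f)))

    ip--ʳ : ∀ f g h → ⟨ h , f ⊖ g ⟩ ≡ ⟨ h , f ⟩ - ⟨ h , g ⟩
    ip--ʳ f g h = trans (ip-comm h _) (trans (ip-- f g h) (cong₂ _-_ (ip-comm f h) (ip-comm g h)))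

    ip-≥0 : ∀ f → 0ℚ ≤ ⟨ f , f ⟩
    ip-≥0 f = mean-≥0 (λ ω → 0≤p² (f ω))

    norm-⊖ : ∀ f g → ⟨ f ⊖ g , f ⊖ g ⟩ ≡ ⟨ f , f ⟩ - (⟨ f , g ⟩ + ⟨ f , g ⟩) + ⟨ g , g ⟩
    norm-⊖ f g = trans (ip-- f g (f ⊖ g))
      (trans (cong₂ _-_ (ip--ʳ f g f) (ip--ʳ f g g))
      (trans (cong (λ u → (⟨ f , f ⟩ - ⟨ f , g ⟩) - (u - ⟨ g , g ⟩)) (ip-comm g f))
        (collect ⟨ f , f ⟩ ⟨ f , g ⟩ ⟨ g , g ⟩)))
      where
      open +-*-Solver
      collect : ∀ a b c → (a - b) - (b - c) ≡ a - (b + b) + c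
      collect = solve 3 (λ a b c → (a :- b) :- (b :- c) := a :- (b :+ b) :+ c) refl

    module _ (A : (Ω → ℚ) → Ω → ℚ)
             (A-* : ∀ c f ω → A (c ⊙ f) ω ≡ c * A f ω)
             (A-- : ∀ f g ω → A (f ⊖ g) ω ≡ A f ω - A g ω)
             (A-sym : ∀ f g → ⟨ A f , g ⟩ ≡ ⟨ f , A g ⟩)
             (A-psd : ∀ f → 0ℚ ≤ ⟨ A f , f ⟩)
             (κ : ℚ) (0<κ : 0ℚ < κ)
             (A≤κ : ∀ f → ⟨ A f , f ⟩ ≤ κ * ⟨ f , f ⟩) where

      -- The form ⟨A·,·⟩ is nonnegative at κf - Af.
      psd-norm-bound : ∀ f → ⟨ A f , A f ⟩ ≤ κ * (κ * ⟨ f , f ⟩)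
      psd-norm-bound f = *-cancelˡ-≤-0< κ 0<κ (begin
        κ * X              ≤⟨ p≡q+s⇒q≤p _ 0≤s (rearrange κ Y Z X) ⟩
        κ * (κ * Y) + (Z - κ * X)
                           ≤⟨ +-mono-≤ (*-monoˡ-≤-0≤ κ (<⇒≤ 0<κ) (*-monoˡ-≤-0≤ κ (<⇒≤ 0<κ) (A≤κ f)))
                                       (+-monoˡ-≤ (- (κ * X)) (A≤κ (A f))) ⟩
        κ * (κ * (κ * W)) + (κ * X - κ * X)
                           ≡⟨ trans (cong (κ * (κ * (κ * W)) +_) (+-inverseʳ (κ * X))) (+-identityʳ _) ⟩
        κ * (κ * (κ * W))  ∎)
        where
        open ≤-Reasoning
        open +-*-Solver
        X = ⟨ A f , A f ⟩
        Y = ⟨ A f , f ⟩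
        Z = ⟨ A (A f) , A f ⟩
        W = ⟨ f , f ⟩
        h = κ ⊙ f ⊖ A f
        Ah : ∀ ω → A h ω ≡ (κ ⊙ A f ⊖ A (A f)) ω
        Ah ω = trans (A-- (κ ⊙ f) (A f) ω) (cong (_- A (A f) ω) (A-* κ f ω))
        eq : ⟨ A h , h ⟩ ≡ κ * (κ * Y) - κ * X - (κ * X - Z)
        eq = trans (mean-cong (λ ω → cong (_* h ω) (Ah ω)))
          (trans (ip-- (κ ⊙ A f) (A (A f)) h)
          (cong₂ _-_
            (trans (ip-* κ (A f) h) (trans (cong (κ *_)
              (trans (ip--ʳ (κ ⊙ f) (A f) (A f)) (cong (_- X) (ip-*ʳ κ (A f) f))))
              (distrib κ (κ * Y) X)))
            (trans (ip--ʳ (κ ⊙ f) (A f) (A (A f))) (cong (_- Z)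
              (trans (ip-*ʳ κ (A (A f)) f) (cong (κ *_) (A-sym (A f) f)))))))
          where
          distrib : ∀ a b c → a * (b - c) ≡ a * b - a * c
          distrib = solve 3 (λ a b c → a :* (b :- c) := a :* b :- a :* c) refl
        0≤s : 0ℚ ≤ κ * (κ * Y) - κ * X - (κ * X - Z)
        0≤s = subst (0ℚ ≤_) eq (A-psd h)
        rearrange : ∀ κ Y Z X → κ * (κ * Y) + (Z - κ * X)
                  ≡ κ * X + (κ * (κ * Y) - κ * X - (κ * X - Z))
        rearrange = solve 4 (λ κ Y Z X → κ :* (κ :* Y) :+ (Z :- κ :* X)
                  := κ :* X :+ (κ :* (κ :* Y) :- κ :* X :- (κ :* X :- Z))) refl

    -- T_n(B) 1 and U_{n-1}(B) 1 for the Chebyshev polynomials of both kinds.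
    chebyshev : ((Ω → ℚ) → Ω → ℚ) → ℕ → (Ω → ℚ) × (Ω → ℚ)
    chebyshev B zero    = (λ _ → 1ℚ) , (λ _ → 0ℚ)
    chebyshev B (suc n) =
      let (t , u) = chebyshev B n ; e = t ⊕ B u in B e ⊖ u , e

    module _ (B : (Ω → ℚ) → Ω → ℚ)
             (B-0 : ∀ ω → B (λ _ → 0ℚ) ω ≡ 0ℚ)
             (B-sym : ∀ f g → ⟨ B f , g ⟩ ≡ ⟨ f , B g ⟩)
             (B≤1 : ∀ f → ⟨ B f , B f ⟩ ≤ ⟨ f , f ⟩) where

      private
        energy : (Ω → ℚ) × (Ω → ℚ) → ℚ
        energy (t , u) = ⟨ t , t ⟩ + (⟨ u , u ⟩ - ⟨ B u , B u ⟩)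

        -- Pell's equation T² + (1 - x²) U² = 1.
        energy-chebyshev : ∀ n → energy (chebyshev B n) ≡ 1ℚ
        energy-chebyshev zero = cong₂ _+_ (mean-const 1ℚ) (cong₂ _-_ (mean-const 0ℚ)
          (trans (mean-cong (λ ω → cong₂ _*_ (B-0 ω) (B-0 ω))) (mean-const 0ℚ)))
        energy-chebyshev (suc n) = trans step (energy-chebyshev n)
          where
          open +-*-Solver
          t = proj₁ (chebyshev B n)
          u = proj₂ (chebyshev B n)
          e = t ⊕ B u
          norm-t : ⟨ t , t ⟩ ≡ ⟨ e , e ⟩ - (⟨ e , B u ⟩ + ⟨ e , B u ⟩) + ⟨ B u , B u ⟩
          norm-t = trans (mean-cong (λ ω → cong₂ _*_ (recover ω) (recover ω))) (norm-⊖ e (B u))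
            where
            recover : ∀ ω → t ω ≡ (t ω + B u ω) - B u ω
            recover ω = solve 2 (λ a b → a := (a :+ b) :- b) refl (t ω) (B u ω)
          -- By the symmetry of `B`, both sides equal `⟨ e , e ⟩ - 2 ⟨ e , B u ⟩ + ⟨ u , u ⟩`: the
          -- norms of `B e` cancel on the left and those of `B u` on the right.
          step : ⟨ B e ⊖ u , B e ⊖ u ⟩ + (⟨ e , e ⟩ - ⟨ B e , B e ⟩) ≡ ⟨ t , t ⟩ + (⟨ u , u ⟩ - ⟨ B u , B u ⟩)
          step = trans (cong (_+ (⟨ e , e ⟩ - ⟨ B e , B e ⟩))
                   (trans (norm-⊖ (B e) u) (cong (λ p → ⟨ B e , B e ⟩ - (p + p) + ⟨ u , u ⟩) (B-sym e u))))
            (trans (collect ⟨ B e , B e ⟩ ⟨ e , B u ⟩ ⟨ u , u ⟩ ⟨ e , e ⟩ ⟨ B u , B u ⟩)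
              (cong (_+ (⟨ u , u ⟩ - ⟨ B u , B u ⟩)) (sym norm-t)))
            where
            collect : ∀ a p c d q → (a - (p + p) + c) + (d - a) ≡ (d - (p + p) + q) + (c - q)
            collect = solve 5 (λ a p c d q → (a :- (p :+ p) :+ c) :+ (d :- a)
              := (d :- (p :+ p) :+ q) :+ (c :- q)) refl

      -- Pell's equation puts the squared norm of `t` at 1 minus `⟨ u , u ⟩ - ⟨ B u , B u ⟩`, and
      -- the subtracted term is nonnegative for a contraction. The mean is then bounded by the norm.
      chebyshev-mean-≤1 : ∀ n → ∣ 𝔼 (proj₁ (chebyshev B n)) ∣ ≤ 1ℚ
      chebyshev-mean-≤1 n = p²≤q²⇒∣p∣≤q 0≤1 (≤-trans (mean²≤mean-² t)
        (p≡q+s⇒q≤p (⟨ u , u ⟩ - ⟨ B u , B u ⟩) (p≤q⇒0≤q-p (B≤1 u)) (sym (energy-chebyshev n))))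
        where
        t = proj₁ (chebyshev B n)
        u = proj₂ (chebyshev B n)

-- Product spaces, resampling and the Efron-Stein inequality.

module Walk where
  open Rat
  open Mean
  open import Data.Rational.Base
  open import Data.Rational.Properties
  open import Data.Rational.Solver using (module +-*-Solver)
  open import Data.Nat.Base using (ℕ; zero; suc)
  open import Data.Fin.Base using (Fin; zero; suc)
  open import Data.Vec.Base using (Vec; []; _∷_)
  open import Function.Base using (_∘_)
  open import Relation.Binary.PropositionalEquality
  open import Algebra.Bundles using (CommutativeRing)
  open import Algebra.Properties.Semiring.Sum (CommutativeRing.semiring +-*-commutativeRing) public
    using (sum; sum-cong-≗; ∑-distrib-+; *-distribˡ-sum)

  sum-mono : ∀ {n} {f g : Fin n → ℚ} → (∀ i → f i ≤ g i) → sum f ≤ sum g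
  sum-mono {zero}  f≤g = ≤-refl
  sum-mono {suc n} f≤g = +-mono-≤ (f≤g zero) (sum-mono (f≤g ∘ suc))

  sum-1 : ∀ n → sum {n} (λ _ → 1ℚ) ≡ ι n
  sum-1 zero    = refl
  sum-1 (suc n) = trans (cong (1ℚ +_) (sum-1 n)) (sym (ι-suc n))

  module ProductSpace (ℓ : ℕ) (w : ℚ) (0≤w : 0ℚ ≤ w) (w*ℓ≡1 : w * ι ℓ ≡ 1ℚ) where

    avg : (Fin ℓ → ℚ) → ℚ
    avg f = w * sum f

    avg-isMean : IsMean avg
    avg-isMean = record
      { mean-cong = λ f≗g → cong (w *_) (sum-cong-≗ f≗g)
      ; mean-+    = λ f g → trans (cong (w *_) (∑-distrib-+ f g)) (*-distribˡ-+ w (sum f) (sum g))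
      ; mean-*    = λ c f → trans (cong (w *_) (sym (*-distribˡ-sum c f)))
          (solve 3 (λ w c s → w :* (c :* s) := c :* (w :* s)) refl w c (sum f))
      ; mean-mono = λ f≤g → *-monoˡ-≤-0≤ w 0≤w (sum-mono f≤g)
      ; mean-1    = trans (cong (w *_) (sum-1 ℓ)) w*ℓ≡1
      }
      where open +-*-Solver

    private module Avg = IsMean avg-isMean

    fubini : ∀ {Ω} {𝔼 : (Ω → ℚ) → ℚ} → IsMean 𝔼 → ∀ (f : Fin ℓ → Ω → ℚ) →
             avg (λ y → 𝔼 (f y)) ≡ 𝔼 (λ ω → avg (λ y → f y ω))
    fubini {Ω} {𝔼} isMean f = trans (cong (w *_) (swap f)) (sym (mean-* w _))
      where
      open IsMean isMean
      swap : ∀ {n} (f : Fin n → Ω → ℚ) → sum (λ y → 𝔼 (f y)) ≡ 𝔼 (λ ω → sum (λ y → f y ω))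
      swap {zero}  f = sym (mean-const 0ℚ)
      swap {suc n} f = trans (cong (𝔼 (f zero) +_) (swap (f ∘ suc))) (sym (mean-+ (f zero) _))

    Tuple : ℕ → Set
    Tuple r = Vec (Fin ℓ) r

    𝔼 : ∀ r → (Tuple r → ℚ) → ℚ
    𝔼 zero    f = f []
    𝔼 (suc r) f = avg (λ y → 𝔼 r (λ v → f (y ∷ v)))

    𝔼-isMean : ∀ r → IsMean (𝔼 r)
    𝔼-isMean zero = record
      { mean-cong = λ f≗g → f≗g []
      ; mean-+    = λ f g → refl
      ; mean-*    = λ c f → refl
      ; mean-mono = λ f≤g → f≤g []
      ; mean-1    = refl
      }
    𝔼-isMean (suc r) = record
      { mean-cong = λ f≗g → Avg.mean-cong (λ y → IH.mean-cong (λ v → f≗g (y ∷ v)))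
      ; mean-+    = λ f g → trans (Avg.mean-cong (λ y → IH.mean-+ _ _)) (Avg.mean-+ _ _)
      ; mean-*    = λ c f → trans (Avg.mean-cong (λ y → IH.mean-* c _)) (Avg.mean-* c _)
      ; mean-mono = λ f≤g → Avg.mean-mono (λ y → IH.mean-mono (λ v → f≤g (y ∷ v)))
      ; mean-1    = trans (Avg.mean-cong (λ y → IH.mean-1)) Avg.mean-1
      }
      where module IH = IsMean (𝔼-isMean r)

    ip : ∀ r → (Tuple r → ℚ) → (Tuple r → ℚ) → ℚ
    ip r = InnerProduct.⟨_,_⟩ (𝔼-isMean r)

    -- An unnormalised sum over coordinates: the empty tuple has none to resample, hence 0 and not
    -- the identity, and constants are multiplied by `r`.
    resample : ∀ r → (Tuple r → ℚ) → Tuple r → ℚ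
    resample zero    f []      = 0ℚ
    resample (suc r) f (y ∷ v) = avg (λ z → f (z ∷ v)) + resample r (λ v → f (y ∷ v)) v

    resample-cong : ∀ r {f g} → (∀ ω → f ω ≡ g ω) → ∀ ω → resample r f ω ≡ resample r g ω
    resample-cong zero    f≗g []      = refl
    resample-cong (suc r) f≗g (y ∷ v) = cong₂ _+_ (Avg.mean-cong (λ z → f≗g (z ∷ v)))
      (resample-cong r (λ v → f≗g (y ∷ v)) v)

    resample-* : ∀ r c f ω → resample r (λ ω → c * f ω) ω ≡ c * resample r f ω
    resample-* zero    c f []      = sym (*-zeroʳ c)
    resample-* (suc r) c f (y ∷ v) = trans
      (cong₂ _+_ (Avg.mean-* c _) (resample-* r c _ v)) (sym (*-distribˡ-+ c _ _))

    resample-+ : ∀ r f g ω → resample r (λ ω → f ω + g ω) ω ≡ resample r f ω + resample r g ω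
    resample-+ zero    f g []      = refl
    resample-+ (suc r) f g (y ∷ v) = trans
      (cong₂ _+_ (Avg.mean-+ _ _) (resample-+ r _ _ v))
      (solve 4 (λ a b c d → (a :+ b) :+ (c :+ d) := (a :+ c) :+ (b :+ d)) refl
        (avg (λ z → f (z ∷ v))) (avg (λ z → g (z ∷ v))) _ _)
      where open +-*-Solver

    resample-1 : ∀ r ω → resample r (λ _ → 1ℚ) ω ≡ ι r
    resample-1 zero    []      = refl
    resample-1 (suc r) (y ∷ v) = trans (cong₂ _+_ Avg.mean-1 (resample-1 r v)) (sym (ι-suc r))

    -- Averaging out one coordinate is an orthogonal projection, so its form is a mean of products
    -- of partial averages. Symmetry and positivity of the whole sum can then be read off by
    -- induction on the coordinates.
    resample-ip : ∀ r f g → ip (suc r) (resample (suc r) f) g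
      ≡ 𝔼 r (λ v → avg (λ y → f (y ∷ v)) * avg (λ y → g (y ∷ v)))
        + avg (λ y → ip r (resample r (λ v → f (y ∷ v))) (λ v → g (y ∷ v)))
    resample-ip r f g = trans
      (Avg.mean-cong (λ y → trans (V.mean-cong (λ v → *-distribʳ-+ (g (y ∷ v)) (avg (λ z → f (z ∷ v))) (resample r (λ v → f (y ∷ v)) v))) (V.mean-+ _ _)))
      (trans (Avg.mean-+ _ _) (cong (_+ avg (λ y → ip r (resample r (λ v → f (y ∷ v))) (λ v → g (y ∷ v))))
        (trans (fubini (𝔼-isMean r) _) (V.mean-cong (λ v → Avg.mean-* (avg (λ y → f (y ∷ v))) (λ y → g (y ∷ v)))))))
      where module V = IsMean (𝔼-isMean r)

    resample-sym : ∀ r f g → ip r (resample r f) g ≡ ip r f (resample r g)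
    resample-sym r f g = trans (swap r f g) (InnerProduct.ip-comm (𝔼-isMean r) (resample r g) f)
      where
      swap : ∀ r f g → ip r (resample r f) g ≡ ip r (resample r g) f
      swap zero    f g = trans (*-zeroˡ (g [])) (sym (*-zeroˡ (f [])))
      swap (suc r) f g = trans (resample-ip r f g) (trans
        (cong₂ _+_ (IsMean.mean-cong (𝔼-isMean r) (λ v → *-comm (avg (λ y → f (y ∷ v))) _))
                   (Avg.mean-cong (λ y → swap r (λ v → f (y ∷ v)) (λ v → g (y ∷ v)))))
        (sym (resample-ip r g f)))

    resample-psd : ∀ r f → 0ℚ ≤ ip r (resample r f) f
    resample-psd zero    f = ≤-reflexive (sym (*-zeroˡ (f [])))
    resample-psd (suc r) f = subst (0ℚ ≤_) (sym (resample-ip r f f)) (0≤p+q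
      (IsMean.mean-≥0 (𝔼-isMean r) (λ v → 0≤p² (avg (λ y → f (y ∷ v)))))
      (Avg.mean-≥0 (λ y → resample-psd r (λ v → f (y ∷ v)))))

    -- The two-coordinate case of the Efron–Stein inequality.
    marginals : ∀ r f →
      𝔼 r (λ v → avg (λ y → f (y ∷ v)) * avg (λ y → f (y ∷ v)))
        + avg (λ y → 𝔼 r (λ v → f (y ∷ v)) * 𝔼 r (λ v → f (y ∷ v)))
      ≤ ip (suc r) f f + 𝔼 (suc r) f * 𝔼 (suc r) f
    -- The slack is Jensen's inequality for `centred y`, averaged over `y`: its left side is the
    -- variance of `G`, its right side is `T - S`.
    marginals r f = p≡q+s⇒q≤p (T - S - (avg (λ y → G y * G y) - M * M))
      (p≤q⇒0≤q-p (subst₂ _≤_ lhs rhs (Avg.mean-mono (λ y → V.mean²≤mean-² (centred y)))))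
      (arrange T M S (avg (λ y → G y * G y)))
      where
      open +-*-Solver
      module V = IsMean (𝔼-isMean r)
      F : Tuple r → ℚ
      F v = avg (λ y → f (y ∷ v))
      G : Fin ℓ → ℚ
      G y = 𝔼 r (λ v → f (y ∷ v))
      M = 𝔼 (suc r) f
      S = 𝔼 r (λ v → F v * F v)
      T = ip (suc r) f f
      centred : Fin ℓ → Tuple r → ℚ
      centred y v = f (y ∷ v) - F v
      𝔼-- : ∀ f g → 𝔼 r (λ v → f v - g v) ≡ 𝔼 r f - 𝔼 r g
      𝔼-- f g = trans (V.mean-cong (λ v → solve 2 (λ a b → a :- b
          := con 1ℚ :* a :+ (:- con 1ℚ) :* b :+ con 0ℚ :* a) refl (f v) (g v)))
        (trans (V.mean-linear₃ 1ℚ (- 1ℚ) 0ℚ f g f)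
          (solve 2 (λ a b → con 1ℚ :* a :+ (:- con 1ℚ) :* b :+ con 0ℚ :* a := a :- b) refl (𝔼 r f) (𝔼 r g)))
      𝔼-F : 𝔼 r F ≡ M
      𝔼-F = sym (fubini (𝔼-isMean r) (λ y v → f (y ∷ v)))
      lhs : avg (λ y → 𝔼 r (centred y) * 𝔼 r (centred y)) ≡ avg (λ y → G y * G y) - M * M
      lhs = trans (Avg.mean-cong (λ y → cong₂ _*_ (mean-centred y) (mean-centred y))) (Avg.variance G)
        where
        mean-centred : ∀ y → 𝔼 r (centred y) ≡ G y - avg G
        mean-centred y = trans (𝔼-- (λ v → f (y ∷ v)) F) (cong (λ m → G y - m) 𝔼-F)
      rhs : avg (λ y → 𝔼 r (λ v → centred y v * centred y v)) ≡ T - S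
      rhs = trans (fubini (𝔼-isMean r) (λ y v → centred y v * centred y v))
        (trans (V.mean-cong (λ v → Avg.variance (λ y → f (y ∷ v))))
        (trans (𝔼-- (λ v → avg (λ y → f (y ∷ v) * f (y ∷ v))) (λ v → F v * F v))
          (cong (_- S) (sym (fubini (𝔼-isMean r) (λ y v → f (y ∷ v) * f (y ∷ v)))))))
      arrange : ∀ t m s g → t + m * m ≡ s + g + (t - s - (g - m * m))
      arrange = solve 4 (λ t m s g → t :+ m :* m := s :+ g :+ (t :- s :- (g :- m :* m))) refl

    -- The form of `resample` sums the squared norms of the partial averages, so after rearranging
    -- this bounds the variance of `f` by the sum of its mean conditional variances. The inductive
    -- hypothesis is applied in each slice of the first coordinate and averaged; `marginals` pays
    -- for the squared slice means that remain.
    efron-stein : ∀ r f → ip r (resample r f) f + ip r f f ≤ ι r * ip r f f + 𝔼 r f * 𝔼 r f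
    efron-stein zero f = ≤-reflexive (solve 1 (λ a → con 0ℚ :* a :+ a :* a := con 0ℚ :* (a :* a) :+ a :* a)
      refl (f []))
      where open +-*-Solver
    efron-stein (suc r) f = begin
      ip (suc r) (resample (suc r) f) f + T
        ≡⟨ cong (_+ T) (resample-ip r f f) ⟩
      S + avg (λ y → ip r (resample r (f∷ y)) (f∷ y)) + T
        ≡⟨ trans (+-assoc S _ T) (cong (S +_) (sym (Avg.mean-+ _ _))) ⟩
      S + avg (λ y → ip r (resample r (f∷ y)) (f∷ y) + ip r (f∷ y) (f∷ y))
        ≤⟨ +-monoʳ-≤ S (Avg.mean-mono (λ y → efron-stein r (f∷ y))) ⟩
      S + avg (λ y → ι r * ip r (f∷ y) (f∷ y) + 𝔼 r (f∷ y) * 𝔼 r (f∷ y))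
        ≡⟨ cong (S +_) (trans (Avg.mean-+ _ _) (cong (_+ Q) (Avg.mean-* (ι r) _))) ⟩
      S + (ι r * T + Q)
        ≡⟨ solve 3 (λ s t q → s :+ (t :+ q) := t :+ (s :+ q)) refl S (ι r * T) Q ⟩
      ι r * T + (S + Q)
        ≤⟨ +-monoʳ-≤ (ι r * T) (marginals r f) ⟩
      ι r * T + (T + 𝔼 (suc r) f * 𝔼 (suc r) f)
        ≡⟨ solve 3 (λ n t m → n :* t :+ (t :+ m) := (con 1ℚ :+ n) :* t :+ m) refl (ι r) T (𝔼 (suc r) f * 𝔼 (suc r) f) ⟩
      (1ℚ + ι r) * T + 𝔼 (suc r) f * 𝔼 (suc r) f
        ≡⟨ cong (λ n → n * T + 𝔼 (suc r) f * 𝔼 (suc r) f) (sym (ι-suc r)) ⟩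
      ι (suc r) * T + 𝔼 (suc r) f * 𝔼 (suc r) f ∎
      where
      open ≤-Reasoning
      open +-*-Solver
      f∷ : Fin ℓ → Tuple r → ℚ
      f∷ y v = f (y ∷ v)
      T = ip (suc r) f f
      S = 𝔼 r (λ v → avg (λ y → f (y ∷ v)) * avg (λ y → f (y ∷ v)))
      Q = avg (λ y → 𝔼 r (f∷ y) * 𝔼 r (f∷ y))

-- The probability that random draws cover a given set of variables.

module Hit where
  open Rat
  open Mean
  open Walk
  open Multilinear
  open import Data.Rational.Base
  open import Data.Rational.Properties hiding (_≟_)
  open import Data.Rational.Solver using (module +-*-Solver)
  open import Data.Bool.Base using (Bool; true; false)
  open import Data.Nat.Base as ℕ using (ℕ; zero; suc; _∸_)
  import Data.Nat.Properties as ℕ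
  import Data.Nat.Solver as ℕ
  open import Data.Fin.Base using (Fin; zero; suc)
  open import Data.Fin.Properties using (_≟_)
  open import Data.List.Base using (List; []; _∷_; length)
  open import Data.List.Membership.Propositional using (_∈_)
  open import Data.List.Relation.Unary.Any using (here; there)
  open import Data.Vec.Base as Vec using (Vec; []; _∷_; lookup; _[_]≔_; toList)
  import Data.Vec.Properties as Vec
  open import Relation.Binary.PropositionalEquality
  open import Relation.Nullary.Decidable.Core using (yes; no)

  -- A set, so that a variable repeated within a clause has to be drawn only once.
  varSet : ∀ {n} → List (Fin n) → Cube n
  varSet []       = Vec.replicate _ false
  varSet (i ∷ vs) = varSet vs [ i ]≔ true

  weight-update : ∀ {n} (α : Cube n) i b →
    weight (α [ i ]≔ b) ℕ.+ bit (lookup α i) ≡ bit b ℕ.+ weight α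
  weight-update (a ∷ α) zero    b =
    trans (ℕ.+-assoc (bit b) (weight α) (bit a)) (cong (bit b ℕ.+_) (ℕ.+-comm (weight α) (bit a)))
  weight-update (a ∷ α) (suc i) b = trans (ℕ.+-assoc (bit a) (weight (α [ i ]≔ b)) (bit (lookup α i)))
    (trans (cong (bit a ℕ.+_) (weight-update α i b))
      (solve 3 (λ a b w → a :+ (b :+ w) := b :+ (a :+ w)) refl (bit a) (bit b) (weight α)))
    where open ℕ.+-*-Solver

  weight-varSet : ∀ {n} (vs : List (Fin n)) → weight (varSet vs) ℕ.≤ length vs
  weight-varSet {n} []   = ℕ.≤-reflexive (weight-∅ n)
    where
    weight-∅ : ∀ n → weight (Vec.replicate n false) ≡ 0
    weight-∅ zero    = refl
    weight-∅ (suc n) = weight-∅ n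
  weight-varSet (i ∷ vs) = ℕ.≤-trans (ℕ.m≤m+n _ (bit (lookup (varSet vs) i)))
    (ℕ.≤-trans (ℕ.≤-reflexive (weight-update (varSet vs) i true)) (ℕ.s≤s (weight-varSet vs)))

  ∈-varSet : ∀ {n} {i : Fin n} vs → i ∈ vs → lookup (varSet vs) i ≡ true
  ∈-varSet {i = i} (j ∷ vs) i∈ with i ≟ j
  ... | yes refl = Vec.lookup∘updateAt i (varSet vs)
  ∈-varSet {i = i} (j ∷ vs) (here i≡j)  | no i≢j with () ← i≢j i≡j
  ∈-varSet {i = i} (j ∷ vs) (there i∈) | no i≢j =
    trans (Vec.lookup∘updateAt′ i j i≢j (varSet vs)) (∈-varSet vs i∈)

  -- The falling factorial: the number of ways to assign `k` distinct elements to different ones of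
  -- `r` draws.
  falling : ℕ → ℕ → ℕ
  falling r       zero    = 1
  falling zero    (suc k) = 0
  falling (suc r) (suc k) = suc r ℕ.* falling r k

  -- Either the first draw receives no element, or it receives one of the `suc k`.
  falling-pascal : ∀ r k → falling (suc r) (suc k) ≡ falling r (suc k) ℕ.+ suc k ℕ.* falling r k
  falling-pascal zero    zero    = refl
  falling-pascal zero    (suc k) = sym (ℕ.*-zeroʳ (suc (suc k)))
  falling-pascal (suc r) zero    = solve 1 (λ r → (con 2 :+ r) :* con 1
      := (con 1 :+ r) :* con 1 :+ con 1 :* con 1) refl r
    where open ℕ.+-*-Solver
  falling-pascal (suc r) (suc k) = begin
    suc (suc r) ℕ.* p                              ≡⟨⟩
    p ℕ.+ suc r ℕ.* p                              ≡⟨ cong (λ q → p ℕ.+ suc r ℕ.* q) (falling-pascal r k) ⟩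
    p ℕ.+ suc r ℕ.* (falling r (suc k) ℕ.+ suc k ℕ.* falling r k)
      ≡⟨ solve 4 (λ r k a b → (con 1 :+ r) :* b :+ (con 1 :+ r) :* (a :+ (con 1 :+ k) :* b)
           := (con 1 :+ r) :* a :+ (con 2 :+ k) :* ((con 1 :+ r) :* b)) refl
           r k (falling r (suc k)) (falling r k) ⟩
    suc r ℕ.* falling r (suc k) ℕ.+ suc (suc k) ℕ.* p ∎
    where
    open ≡-Reasoning
    open ℕ.+-*-Solver
    p = falling (suc r) (suc k)

  power≤falling : ∀ r k → (r ∸ k) ℕ.^ k ℕ.≤ falling r k
  power≤falling r       zero    = ℕ.≤-refl
  power≤falling zero    (suc k) = ℕ.≤-refl
  power≤falling (suc r) (suc k) =
    ℕ.*-mono-≤ (ℕ.≤-trans (ℕ.m∸n≤m r k) (ℕ.n≤1+n r)) (power≤falling r k)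

  1-ny≤[1-y]^n : ∀ y n → 0ℚ ≤ y → y ≤ 1ℚ → 1ℚ - ι n * y ≤ (1ℚ - y) ^ n
  1-ny≤[1-y]^n y zero    0≤y y≤1 = ≤-reflexive (solve 1 (λ y → con 1ℚ :- con 0ℚ :* y := con 1ℚ) refl y)
    where open +-*-Solver
  1-ny≤[1-y]^n y (suc n) 0≤y y≤1 = ≤-trans
    (p≡q+s⇒q≤p (ι n * (y * y)) (0≤p*q (0≤ι n) (0≤p² y))
      (trans (solve 2 (λ y n → (con 1ℚ :- y) :* (con 1ℚ :- n :* y)
        := con 1ℚ :- (con 1ℚ :+ n) :* y :+ n :* (y :* y)) refl y (ι n))
        (cong (λ m → 1ℚ - m * y + ι n * (y * y)) (sym (ι-suc n)))))
    (*-monoˡ-≤-0≤ (1ℚ - y) (p≤q⇒0≤q-p y≤1) (1-ny≤[1-y]^n y n 0≤y y≤1))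
    where open +-*-Solver

  -- A converse to Bernoulli's inequality: the doubled `y` outweighs the quadratic terms as long as
  -- `ι n * (y + y) ≤ 1`.
  [1-2y]^n≤1-ny : ∀ y n → 0ℚ ≤ y → ι n * (y + y) ≤ 1ℚ → y + y ≤ 1ℚ → (1ℚ - (y + y)) ^ n ≤ 1ℚ - ι n * y
  [1-2y]^n≤1-ny y zero    0≤y _     _    = ≤-reflexive (solve 1 (λ y → con 1ℚ := con 1ℚ :- con 0ℚ :* y) refl y)
    where open +-*-Solver
  [1-2y]^n≤1-ny y (suc n) 0≤y ny≤1 2y≤1 = ≤-trans
    (*-monoˡ-≤-0≤ (1ℚ - (y + y)) (p≤q⇒0≤q-p 2y≤1) ([1-2y]^n≤1-ny y n 0≤y n2y≤1 2y≤1))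
    (p≡q+s⇒q≤p (y * (1ℚ - ι n * (y + y))) (0≤p*q 0≤y (p≤q⇒0≤q-p n2y≤1))
      (trans (cong (λ m → 1ℚ - m * y) (ι-suc n))
        (solve 2 (λ y n → con 1ℚ :- (con 1ℚ :+ n) :* y
          := (con 1ℚ :- (y :+ y)) :* (con 1ℚ :- n :* y) :+ y :* (con 1ℚ :- n :* (y :+ y))) refl y (ι n))))
    where
    open +-*-Solver
    n2y≤1 : ι n * (y + y) ≤ 1ℚ
    n2y≤1 = ≤-trans (*-monoʳ-≤-0≤ (y + y) (0≤p+q 0≤y 0≤y) (ι-mono-≤ (ℕ.n≤1+n n))) ny≤1

  module Hitting (ℓ : ℕ) (w : ℚ) (0≤w : 0ℚ ≤ w) (w*ℓ≡1 : w * ι ℓ ≡ 1ℚ) where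

    open ProductSpace ℓ w 0≤w w*ℓ≡1

    hit : ∀ {r} → Cube ℓ → Tuple r → Bool
    hit T []      = weight T ℕ.≡ᵇ 0
    hit T (y ∷ v) = hit (T [ y ]≔ false) v

    weight-∅⇒lookup : ∀ {n} (α : Cube n) i → weight α ≡ 0 → lookup α i ≡ false
    weight-∅⇒lookup (false ∷ α) zero    _  = refl
    weight-∅⇒lookup (false ∷ α) (suc i) eq = weight-∅⇒lookup α i eq

    hit⇒∈ : ∀ {r} T (ω : Tuple r) → hit T ω ≡ true → ∀ i → lookup T i ≡ true → i ∈ toList ω
    hit⇒∈ T [] h i Ti with weight T in eq
    ... | zero with () ← trans (sym Ti) (weight-∅⇒lookup T i eq)
    hit⇒∈ T (y ∷ v) h i Ti with i ≟ y
    ... | yes i≡y = here i≡y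
    ... | no i≢y  = there (hit⇒∈ (T [ y ]≔ false) v h i (trans (Vec.lookup∘updateAt′ i y i≢y T) Ti))

    avg-lookup : ∀ (T : Cube ℓ) → avg (λ y → ι (bit (lookup T y))) ≡ w * ι (weight T)
    avg-lookup T = cong (w *_) (sum-lookup T)
      where
      sum-lookup : ∀ {n} (T : Cube n) → sum (λ y → ι (bit (lookup T y))) ≡ ι (weight T)
      sum-lookup []      = refl
      sum-lookup (b ∷ T) = trans (cong (ι (bit b) +_) (sum-lookup T)) (sym (ι-+ (bit b) (weight T)))

    hitProb : ∀ r → Cube ℓ → ℚ
    hitProb r T = 𝔼 r (λ ω → ι (bit (hit T ω)))

    module _ (K : ℕ) (Kw≤1 : ι K * w ≤ 1ℚ) where

      -- With k = weight T ≤ K, each element of T is drawn exactly once with probability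
      -- falling r k · (1 - k/ℓ)^(r-k) / ℓ^k.
      exactHit : ℕ → ℕ → ℚ
      exactHit r k = (1ℚ - ι K * w) ^ r * (w ^ k * ι (falling r k))

      private
        θ = 1ℚ - ι K * w

        0≤θ : 0ℚ ≤ θ
        0≤θ = p≤q⇒0≤q-p Kw≤1

        θ≤1-kw : ∀ {k} → k ℕ.≤ K → θ ≤ 1ℚ - ι k * w
        θ≤1-kw k≤K = +-monoʳ-≤ 1ℚ (neg-antimono-≤ (*-monoʳ-≤-0≤ w 0≤w (ι-mono-≤ k≤K)))

        θ≤1 : θ ≤ 1ℚ
        θ≤1 = ≤-trans (θ≤1-kw {0} ℕ.z≤n) (≤-reflexive (solve 1 (λ w → con 1ℚ :- con 0ℚ :* w := con 1ℚ) refl w))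
          where open +-*-Solver

      -- Condition on the first draw, which lies in `T` with probability `w * ι k`. `falling-pascal`
      -- splits `exactHit` into the same two cases, and one factor `1 - ι K * w` is at most the
      -- probability of missing `T`. With `K` fixed, that base survives when the induction lowers
      -- `k`.
      exactHit≤hitProb : ∀ r T k → weight T ≡ k → k ℕ.≤ K → exactHit r k ≤ hitProb r T
      exactHit≤hitProb zero T zero    eq k≤K rewrite eq = ≤-refl
      exactHit≤hitProb zero T (suc k) eq k≤K rewrite eq =
        ≤-reflexive (solve 1 (λ a → con 1ℚ :* (a :* con 0ℚ) := con 0ℚ) refl (w ^ suc k))
        where open +-*-Solver
      exactHit≤hitProb (suc r) T zero eq k≤K = begin
        θ ^ suc r * (1ℚ * 1ℚ)             ≤⟨ *-monoʳ-≤-0≤ (1ℚ * 1ℚ) (0≤p*q 0≤1 0≤1) θ^[1+r]≤θ^r ⟩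
        θ ^ r * (1ℚ * 1ℚ)                 ≡⟨ sym (IsMean.mean-const avg-isMean _) ⟩
        avg (λ y → exactHit r 0)          ≤⟨ IsMean.mean-mono avg-isMean
          (λ y → exactHit≤hitProb r (T [ y ]≔ false) 0 (weight-stays y) k≤K) ⟩
        hitProb (suc r) T                 ∎
        where
        open ≤-Reasoning
        θ^[1+r]≤θ^r : θ * θ ^ r ≤ θ ^ r
        θ^[1+r]≤θ^r = ≤-trans (*-monoʳ-≤-0≤ (θ ^ r) (0≤p^n r 0≤θ) θ≤1) (≤-reflexive (*-identityˡ (θ ^ r)))
        weight-stays : ∀ y → weight (T [ y ]≔ false) ≡ 0
        weight-stays y = ℕ.m+n≡0⇒m≡0 _ (trans (weight-update T y false) eq)
      exactHit≤hitProb (suc r) T (suc k) eq k<K = begin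
        θ * θ ^ r * (w * w ^ k * ι (falling (suc r) (suc k)))
          ≡⟨ cong (λ f → θ * θ ^ r * (w * w ^ k * f)) (trans (cong ι (falling-pascal r k))
               (trans (ι-+ (falling r (suc k)) _) (cong (ι (falling r (suc k)) +_) (ι-* (suc k) (falling r k))))) ⟩
        θ * θ ^ r * (w * w ^ k * (F₁ + ι (suc k) * F₀))
          ≡⟨ solve 6 (λ t tr wk f₁ f₀ n → t :* tr :* (wk :* (f₁ :+ n :* f₀))
               := t :* (tr :* wk :* f₁) :+ t :* (tr :* wk :* (n :* f₀))) refl
               θ (θ ^ r) (w * w ^ k) F₁ F₀ (ι (suc k)) ⟩
        θ * (θ ^ r * (w * w ^ k) * F₁) + θ * (θ ^ r * (w * w ^ k) * (ι (suc k) * F₀))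
          ≤⟨ +-mono-≤ (*-monoʳ-≤-0≤ _ (0≤p*q (0≤p*q (0≤p^n r 0≤θ) (0≤p^n (suc k) 0≤w)) (0≤ι (falling r (suc k)))) (θ≤1-kw k<K))
                      (*-monoʳ-≤-0≤ _ (0≤p*q (0≤p*q (0≤p^n r 0≤θ) (0≤p^n (suc k) 0≤w)) (0≤p*q (0≤ι (suc k)) (0≤ι (falling r k)))) θ≤1) ⟩
        (1ℚ - ι (suc k) * w) * (θ ^ r * (w * w ^ k) * F₁) + 1ℚ * (θ ^ r * (w * w ^ k) * (ι (suc k) * F₀))
          ≡⟨ solve 6 (λ tr w wk f₁ f₀ n →
               (con 1ℚ :- n :* w) :* (tr :* (w :* wk) :* f₁) :+ con 1ℚ :* (tr :* (w :* wk) :* (n :* f₀))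
               := (tr :* (wk :* f₀) :- tr :* ((w :* wk) :* f₁)) :* (w :* n) :+ tr :* ((w :* wk) :* f₁)) refl
               (θ ^ r) w (w ^ k) F₁ F₀ (ι (suc k)) ⟩
        -- A convex combination of the values for a hit and a miss, written as an affine function of
        -- the hit probability: replacing that probability by the indicator of a hit moves
        -- everything under `avg`.
        (exactHit r k - exactHit r (suc k)) * (w * ι (suc k)) + exactHit r (suc k)
          ≡⟨ cong (λ m → (exactHit r k - exactHit r (suc k)) * m + exactHit r (suc k))
               (trans (cong (λ n → w * ι n) (sym eq)) (sym (avg-lookup T))) ⟩
        (exactHit r k - exactHit r (suc k)) * avg (λ y → ι (bit (lookup T y))) + exactHit r (suc k)
          ≡⟨ cong₂ _+_ (sym (A.mean-* (exactHit r k - exactHit r (suc k)) (λ y → ι (bit (lookup T y))))) (sym (A.mean-const _)) ⟩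
        avg (λ y → (exactHit r k - exactHit r (suc k)) * ι (bit (lookup T y))) + avg (λ _ → exactHit r (suc k))
          ≡⟨ sym (A.mean-+ _ _) ⟩
        avg (λ y → (exactHit r k - exactHit r (suc k)) * ι (bit (lookup T y)) + exactHit r (suc k))
          ≤⟨ A.mean-mono step ⟩
        hitProb (suc r) T ∎
        where
        open ≤-Reasoning
        open +-*-Solver
        module A = IsMean avg-isMean
        F₀ = ι (falling r k)
        F₁ = ι (falling r (suc k))
        step : ∀ y → (exactHit r k - exactHit r (suc k)) * ι (bit (lookup T y)) + exactHit r (suc k)
                   ≤ hitProb r (T [ y ]≔ false)
        step y with lookup T y | weight-update T y false
        ... | true  | e = ≤-trans
          (≤-reflexive (solve 2 (λ a b → (a :- b) :* con 1ℚ :+ b := a) refl (exactHit r k) (exactHit r (suc k))))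
          (exactHit≤hitProb r _ k (ℕ.suc-injective (trans (ℕ.+-comm 1 _) (trans e eq))) (ℕ.<⇒≤ k<K))
        ... | false | e = ≤-trans
          (≤-reflexive (solve 2 (λ a b → (a :- b) :* con 0ℚ :+ b := b) refl (exactHit r k) (exactHit r (suc k))))
          (exactHit≤hitProb r _ (suc k) (trans (sym (ℕ.+-identityʳ _)) (trans e eq)) k<K)

    -- The factor 1/4 is made of two halves per element: `½ ^ K` bounds `(1 - ι K * w) ^ r` from
    -- below, and the factors of the falling factorial are at least r/2 because `2 K ≤ r`. Smaller
    -- sets are covered since the base is at most 1.
    hitProb-lower : ∀ r K T → 1 ℕ.≤ r → 2 ℕ.* K ℕ.≤ r → 4 ℕ.* r ℕ.≤ ℓ → weight T ℕ.≤ K →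
                    (½ * (½ * (ι r * w))) ^ K ≤ hitProb r T
    hitProb-lower r K T 1≤r 2K≤r 4r≤ℓ k≤K = begin
      (½ * (½ * (ι r * w))) ^ K
        ≡⟨ ^-distrib-* ½ (½ * (ι r * w)) K ⟩
      ½ ^ K * (½ * (ι r * w)) ^ K
        ≤⟨ *-mono-≤ (0≤p^n K 0≤½) (0≤p^n K 0≤x) ½^K≤θ^r (^-antimonoʳ-≤ 0≤x x≤1 k≤K) ⟩
      θ ^ r * (½ * (ι r * w)) ^ k
        ≤⟨ *-monoˡ-≤-0≤ (θ ^ r) (0≤p^n r (p≤q⇒0≤q-p Kw≤1)) x^k≤ ⟩
      θ ^ r * (w ^ k * ι (falling r k))
        ≤⟨ exactHit≤hitProb K Kw≤1 r T k refl k≤K ⟩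
      hitProb r T ∎
      where
      open ≤-Reasoning
      open +-*-Solver
      k = weight T
      θ = 1ℚ - ι K * w
      0≤½ : 0ℚ ≤ ½
      0≤½ = nonNegative⁻¹ ½
      scaled : ∀ {n} → n ℕ.≤ ℓ → ι n * w ≤ 1ℚ
      scaled n≤ℓ = ≤-trans (*-monoʳ-≤-0≤ w 0≤w (ι-mono-≤ n≤ℓ)) (≤-reflexive (trans (*-comm (ι ℓ) w) w*ℓ≡1))
      r≤4r : r ℕ.≤ 4 ℕ.* r
      r≤4r = ℕ.m≤m+n r _
      2K≤ℓ : 2 ℕ.* K ℕ.≤ ℓ
      2K≤ℓ = ℕ.≤-trans 2K≤r (ℕ.≤-trans r≤4r 4r≤ℓ)
      2Kw≤1 : ι K * (w + w) ≤ 1ℚ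
      2Kw≤1 = ≤-trans (≤-reflexive (trans (solve 2 (λ k w → k :* (w :+ w) := con (ι 2) :* k :* w) refl (ι K) w)
        (cong (_* w) (sym (ι-* 2 K))))) (scaled 2K≤ℓ)
      Kw≤1 : ι K * w ≤ 1ℚ
      Kw≤1 = scaled (ℕ.≤-trans (ℕ.m≤m+n K _) 2K≤ℓ)
      4rw≤1 : ι 4 * ι r * w ≤ 1ℚ
      4rw≤1 = subst (λ q → q * w ≤ 1ℚ) (ι-* 4 r) (scaled 4r≤ℓ)
      x = ½ * (ι r * w)
      0≤rw : 0ℚ ≤ ι r * w
      0≤rw = 0≤p*q (0≤ι r) 0≤w
      0≤x : 0ℚ ≤ x
      0≤x = 0≤p*q 0≤½ 0≤rw
      x≤1 : x ≤ 1ℚ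
      x≤1 = ≤-trans (p≡q+s⇒q≤p _ (0≤p*q (0≤ι 7) (0≤p*q 0≤½ 0≤rw))
        (solve 2 (λ r w → con (ι 4) :* r :* w := con ½ :* (r :* w) :+ con (ι 7) :* (con ½ :* (r :* w))) refl (ι r) w)) 4rw≤1
      ½r≤r∸k : ½ * ι r ≤ ι (r ∸ k)
      ½r≤r∸k = *-cancelˡ-≤-0< (ι 2) (0<ι {2} (ℕ.s≤s ℕ.z≤n)) (begin
        ι 2 * (½ * ι r)       ≡⟨ solve 1 (λ r → con (ι 2) :* (con ½ :* r) := r) refl (ι r) ⟩
        ι r                   ≤⟨ ι-mono-≤ r≤2[r∸k] ⟩
        ι (2 ℕ.* (r ∸ k))     ≡⟨ ι-* 2 (r ∸ k) ⟩
        ι 2 * ι (r ∸ k)       ∎)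
        where
        r≤2[r∸k] : r ℕ.≤ 2 ℕ.* (r ∸ k)
        r≤2[r∸k] = subst (r ℕ.≤_) (sym (ℕ.*-distribˡ-∸ 2 r k))
          (ℕ.m+n≤o⇒m≤o∸n r (ℕ.≤-trans (ℕ.+-monoʳ-≤ r (ℕ.≤-trans (ℕ.*-monoʳ-≤ 2 k≤K) 2K≤r))
            (ℕ.≤-reflexive (cong (r ℕ.+_) (sym (ℕ.+-identityʳ r))))))
      x^k≤ : (½ * (ι r * w)) ^ k ≤ w ^ k * ι (falling r k)
      x^k≤ = begin
        (½ * (ι r * w)) ^ k      ≡⟨ cong (_^ k) (solve 2 (λ r w → con ½ :* (r :* w) := w :* (con ½ :* r)) refl (ι r) w) ⟩
        (w * (½ * ι r)) ^ k      ≡⟨ ^-distrib-* w (½ * ι r) k ⟩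
        w ^ k * (½ * ι r) ^ k    ≤⟨ *-monoˡ-≤-0≤ (w ^ k) (0≤p^n k 0≤w)
          (^-monoˡ-≤ k (0≤p*q 0≤½ (0≤ι r)) ½r≤r∸k) ⟩
        w ^ k * ι (r ∸ k) ^ k    ≡⟨ cong (w ^ k *_) (sym (ι-^ (r ∸ k) k)) ⟩
        w ^ k * ι ((r ∸ k) ℕ.^ k) ≤⟨ *-monoˡ-≤-0≤ (w ^ k) (0≤p^n k 0≤w) (ι-mono-≤ (power≤falling r k)) ⟩
        w ^ k * ι (falling r k)  ∎
      ½^K≤θ^r : ½ ^ K ≤ θ ^ r
      -- `(1 - 2 w) ^ r` is at least ½ because `4 r ≤ ℓ`. Raised to the power `K` and with the
      -- exponents swapped, its inner power `(1 - 2 w) ^ K` compares with `1 - K w`.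
      ½^K≤θ^r = begin
        ½ ^ K                        ≤⟨ ^-monoˡ-≤ K 0≤½ ½≤[1-2w]^r ⟩
        ((1ℚ - (w + w)) ^ r) ^ K     ≡⟨ trans (^-assocʳ (1ℚ - (w + w)) r K) (trans (cong ((1ℚ - (w + w)) ^_) (ℕ.*-comm r K))
                                          (sym (^-assocʳ (1ℚ - (w + w)) K r))) ⟩
        ((1ℚ - (w + w)) ^ K) ^ r     ≤⟨ ^-monoˡ-≤ r (0≤p^n K (p≤q⇒0≤q-p 2w≤1)) ([1-2y]^n≤1-ny w K 0≤w 2Kw≤1 2w≤1) ⟩
        θ ^ r                        ∎
        where
        2w≤1 : w + w ≤ 1ℚ
        2w≤1 = subst (_≤ 1ℚ) (solve 1 (λ w → con (ι 2) :* w := w :+ w) refl w)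
          (scaled (ℕ.≤-trans (ℕ.s≤s (ℕ.s≤s ℕ.z≤n)) (ℕ.≤-trans (ℕ.*-monoʳ-≤ 4 1≤r) 4r≤ℓ)))
        ½≤[1-2w]^r : ½ ≤ (1ℚ - (w + w)) ^ r
        ½≤[1-2w]^r = ≤-trans
          (p≡q+s⇒q≤p (½ * (1ℚ - ι 4 * ι r * w)) (0≤p*q 0≤½ (p≤q⇒0≤q-p 4rw≤1))
            (solve 2 (λ r w → con 1ℚ :- r :* (w :+ w) := con ½ :+ con ½ :* (con 1ℚ :- con (ι 4) :* r :* w)) refl (ι r) w))
          (1-ny≤[1-y]^n (w + w) r (0≤p+q 0≤w 0≤w) 2w≤1)

-- Degree and norm relative to the variables already revealed.

module Relative where
  open Rat
  open Mean
  open Walk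
  open Multilinear
  open import Data.Rational.Base
  open import Data.Rational.Properties
  open import Data.Rational.Solver using (module +-*-Solver)
  open import Data.Nat.Base as ℕ using (ℕ; zero; suc)
  import Data.Nat.Properties as ℕ
  open import Data.Fin.Base using (Fin; zero; suc)
  open import Data.List.Base using (List; []; _∷_; _++_; length)
  import Data.List.Properties as List
  open import Data.List.Membership.Propositional.Properties using (∈-++⁺ˡ; ∈-++⁺ʳ; ∈-++⁻)
  open import Data.List.Relation.Unary.Any using (here; there)
  open import Data.List.Relation.Binary.Subset.Propositional using (_⊆_)
  open import Data.Sum.Base using (inj₁; inj₂)
  open import Data.Vec.Base using ([]; _∷_; toList)
  open import Function.Base using (_∘_)
  open import Relation.Binary.PropositionalEquality

  poly-- : ∀ {n d N M} {F G : Cube n → ℚ} → IsPoly d N F → IsPoly d M G →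
           IsPoly d (N + M) (λ x → F x - G x)
  poly-- {N = N} {M} {F} {G} p q = poly-weaken ℕ.≤-refl (≤-reflexive (cong (N +_) (*-identityˡ M)))
    (poly-cong (λ x → cong (F x +_) (solve 1 (λ a → (:- con 1ℚ) :* a := :- a) refl (G x)))
      (poly-+ p (poly-* (- 1ℚ) q)))
    where open +-*-Solver

  poly-sum : ∀ {n d N m} {F : Fin m → Cube n → ℚ} → (∀ i → IsPoly d N (F i)) →
             IsPoly d (ι m * N) (λ x → sum (λ i → F i x))
  poly-sum {N = N} {zero}  p = poly-weaken ℕ.≤-refl (≤-reflexive (sym (*-zeroˡ N))) poly-0
  poly-sum {N = N} {suc m} p = poly-weaken ℕ.≤-refl
    (≤-reflexive (trans (solve 2 (λ N m → N :+ m :* N := (con 1ℚ :+ m) :* N) refl N (ι m))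
      (cong (_* N) (sym (ι-suc m)))))
    (poly-+ (p zero) (poly-sum (p ∘ suc)))
    where open +-*-Solver

  -- F is a combination of products of a function of the variables V with at most n further
  -- variables; the quantification over W makes this stable under exchanging variables of V.
  RelPoly : ∀ {n} → List (Fin n) → ℕ → ℚ → (Cube n → ℚ) → Set
  RelPoly V m N F = ∀ W G → Junta (V ++ W) G → Bounded 1ℚ G →
    IsPoly (length V ℕ.+ length W ℕ.+ m) (3ℚ ^ (length V ℕ.+ length W) * N) (λ x → G x * F x)

  rel-weaken : ∀ {n V m m′ N N′} {F : Cube n → ℚ} → m ℕ.≤ m′ → N ≤ N′ → RelPoly V m N F → RelPoly V m′ N′ F
  rel-weaken {V = V} m≤m′ N≤N′ p W G j bd = poly-weaken (ℕ.+-monoʳ-≤ (length V ℕ.+ length W) m≤m′)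
    (*-monoˡ-≤-0≤ _ (0≤3^n (length V ℕ.+ length W)) N≤N′) (p W G j bd)

  rel-0 : ∀ {n V m} → RelPoly {n} V m 0ℚ (λ _ → 0ℚ)
  rel-0 {V = V} W G j bd = poly-weaken ℕ.≤-refl (≤-reflexive (sym (*-zeroʳ (3ℚ ^ (length V ℕ.+ length W)))))
    (poly-cong (λ x → sym (*-zeroʳ (G x))) poly-0)

  rel-1 : ∀ {n V} → RelPoly {n} V 0 1ℚ (λ _ → 1ℚ)
  rel-1 {V = V} W G j bd rewrite sym (List.length-++ V {W}) =
    poly-weaken (ℕ.m≤m+n _ 0) ≤-refl
      (poly-cong (λ x → sym (*-identityʳ (G x))) (junta-isPoly (V ++ W) j 0≤1 bd))

  rel-+ : ∀ {n V m N M} {F F′ : Cube n → ℚ} → RelPoly V m N F → RelPoly V m M F′ →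
          RelPoly V m (N + M) (λ x → F x + F′ x)
  rel-+ {V = V} {F = F} {F′} p q W G j bd = poly-weaken ℕ.≤-refl
    (≤-reflexive (sym (*-distribˡ-+ (3ℚ ^ (length V ℕ.+ length W)) _ _)))
    (poly-cong (λ x → sym (*-distribˡ-+ (G x) (F x) (F′ x))) (poly-+ (p W G j bd) (q W G j bd)))

  rel-- : ∀ {n V m N M} {F F′ : Cube n → ℚ} → RelPoly V m N F → RelPoly V m M F′ →
          RelPoly V m (N + M) (λ x → F x - F′ x)
  rel-- {V = V} {F = F} {F′} p q W G j bd = poly-weaken ℕ.≤-refl
    (≤-reflexive (sym (*-distribˡ-+ (3ℚ ^ (length V ℕ.+ length W)) _ _)))
    (poly-cong (λ x → solve 3 (λ g a b → g :* a :- g :* b := g :* (a :- b)) refl (G x) (F x) (F′ x))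
      (poly-- (p W G j bd) (q W G j bd)))
    where open +-*-Solver

  rel-* : ∀ {n V m N} c {F : Cube n → ℚ} → RelPoly V m N F → RelPoly V m (∣ c ∣ * N) (λ x → c * F x)
  rel-* {V = V} {N = N} c {F} p W G j bd = poly-weaken ℕ.≤-refl
    (≤-reflexive (solve 3 (λ c t n → c :* (t :* n) := t :* (c :* n)) refl ∣ c ∣ (3ℚ ^ (length V ℕ.+ length W)) N))
    (poly-cong (λ x → solve 3 (λ c g f → c :* (g :* f) := g :* (c :* f)) refl c (G x) (F x))
      (poly-* c (p W G j bd)))
    where open +-*-Solver

  -- The factor `D` is absorbed into the test function `G`, which remains a bounded junta on the
  -- same variables. This is why checking for falsified clauses costs neither degree nor norm.
  rel-junta : ∀ {n V m N} {D F : Cube n → ℚ} → Junta V D → Bounded 1ℚ D → RelPoly V m N F →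
              RelPoly V m N (λ x → D x * F x)
  rel-junta {V = V} {D = D} {F} jD bD p W G j bd = poly-cong (λ x → *-assoc (G x) (D x) (F x))
    (p W (λ x → G x * D x) (junta-* {V = V ++ W} j (junta-⊆ {V = V} ∈-++⁺ˡ jD))
      (λ x → ≤-trans (≤-reflexive (∣p*q∣≡∣p∣*∣q∣ (G x) (D x)))
        (*-mono-≤ (0≤∣p∣ (G x)) (0≤∣p∣ (D x)) (bd x) (bD x))))

  rel-⊆ : ∀ {n V V′ m N} {F : Cube n → ℚ} → V ⊆ V′ → length V ≡ length V′ → RelPoly V′ m N F → RelPoly V m N F
  rel-⊆ {V = V} {V′} {m} {N} {F} V⊆V′ same p W G j bd =
    subst (λ l → IsPoly (l ℕ.+ length W ℕ.+ m) (3ℚ ^ (l ℕ.+ length W) * N) (λ x → G x * F x)) (sym same)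
      (p W G (junta-⊆ {V = V ++ W} ++-mono j) bd)
    where
    ++-mono : V ++ W ⊆ V′ ++ W
    ++-mono i∈ with ∈-++⁻ V i∈
    ... | inj₁ i∈V = ∈-++⁺ˡ (V⊆V′ i∈V)
    ... | inj₂ i∈W = ∈-++⁺ʳ V′ i∈W

  -- A test on `y ∷ V` becomes a test on `z ∷ V` once `y` joins `W`. The longer `W` accounts for one
  -- more degree and a factor 3.
  rel-exchange : ∀ {n} {V : List (Fin n)} {m N} {F : Cube n → ℚ} y z → RelPoly (z ∷ V) m N F →
                 RelPoly (y ∷ V) (suc m) (3ℚ * N) F
  rel-exchange {V = V} {m} {N} {F} y z p W G j bd = poly-weaken (ℕ.≤-reflexive deg) (≤-reflexive norm′)
    (p (y ∷ W) G (junta-⊆ {V = y ∷ V ++ W} incl j) bd)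
    where
    open +-*-Solver
    incl : y ∷ V ++ W ⊆ z ∷ V ++ y ∷ W
    incl (here i≡y) = there (∈-++⁺ʳ V (here i≡y))
    incl (there i∈) with ∈-++⁻ V i∈
    ... | inj₁ i∈V = there (∈-++⁺ˡ i∈V)
    ... | inj₂ i∈W = there (∈-++⁺ʳ V (there i∈W))
    v = length V
    l = length W
    deg : suc (v ℕ.+ suc l ℕ.+ m) ≡ suc (v ℕ.+ l ℕ.+ suc m)
    deg = cong suc (trans (cong (ℕ._+ m) (ℕ.+-suc v l)) (sym (ℕ.+-suc (v ℕ.+ l) m)))
    norm′ : 3ℚ ^ suc (v ℕ.+ suc l) * N ≡ 3ℚ ^ suc (v ℕ.+ l) * (3ℚ * N)
    norm′ = trans (cong (λ e → 3ℚ ^ suc e * N) (ℕ.+-suc v l))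
      (solve 3 (λ a t n → a :* (a :* t) :* n := a :* t :* (a :* n)) refl 3ℚ (3ℚ ^ (v ℕ.+ l)) N)

  module RelativeMean (ℓ : ℕ) (w : ℚ) (0≤w : 0ℚ ≤ w) (w*ℓ≡1 : w * ι ℓ ≡ 1ℚ) where

    open ProductSpace ℓ w 0≤w w*ℓ≡1

    poly-avg : ∀ {n d N} {F : Fin ℓ → Cube n → ℚ} → (∀ y → IsPoly d N (F y)) →
               IsPoly d N (λ x → avg (λ y → F y x))
    poly-avg {N = N} p = poly-weaken ℕ.≤-refl (≤-reflexive norm′) (poly-* w (poly-sum p))
      where
      norm′ : ∣ w ∣ * (ι ℓ * N) ≡ N
      norm′ = trans (cong (_* (ι ℓ * N)) (0≤p⇒∣p∣≡p 0≤w))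
        (trans (sym (*-assoc w (ι ℓ) N)) (trans (cong (_* N) w*ℓ≡1) (*-identityˡ N)))

    poly-𝔼 : ∀ {n d N} r {F : Tuple r → Cube n → ℚ} → (∀ ω → IsPoly d N (F ω)) →
             IsPoly d N (λ x → 𝔼 r (λ ω → F ω x))
    poly-𝔼 zero    p = p []
    poly-𝔼 (suc r) p = poly-avg (λ y → poly-𝔼 r (λ v → p (y ∷ v)))

    rel-avg : ∀ {n V m N} {F : Fin ℓ → Cube n → ℚ} → (∀ y → RelPoly V m N (F y)) →
              RelPoly V m N (λ x → avg (λ y → F y x))
    rel-avg {F = F} p W G j bd = poly-cong (λ x → IsMean.mean-* avg-isMean (G x) (λ y → F y x))
      (poly-avg (λ y → p y W G j bd))

    -- `U` collects the coordinates already passed, which stay revealed while the recursion treats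
    -- the rest of the tuple. Each of the `r` summands costs one exchange, and averaging over `z`
    -- does not increase the norm bound.
    rel-resample : ∀ r {U m N} {F : Cube ℓ → Tuple r → ℚ} →
      (∀ ω → RelPoly (toList ω ++ U) m N (λ x → F x ω)) →
      ∀ ω → RelPoly (toList ω ++ U) (suc m) (ι r * (3ℚ * N)) (λ x → resample r (F x) ω)
    rel-resample zero {N = N} p [] = rel-weaken ℕ.≤-refl (≤-reflexive (sym (*-zeroˡ (3ℚ * N)))) rel-0
    rel-resample (suc r) {U} {N = N} {F} p (y ∷ v) = rel-weaken ℕ.≤-refl
      (≤-reflexive (trans (solve 2 (λ r n → n :+ r :* n := (con 1ℚ :+ r) :* n) refl (ι r) (3ℚ * N))
        (cong (_* (3ℚ * N)) (sym (ι-suc r)))))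
      (rel-+ (rel-avg (λ z → rel-exchange y z (p (z ∷ v))))
        (rel-⊆ (front v) (front-length v)
          (rel-resample r {U = y ∷ U} {F = λ x v → F x (y ∷ v)}
            (λ v → rel-⊆ (back v) (sym (front-length v)) (p (y ∷ v))) v)))
      where
      open +-*-Solver
      front : ∀ (v : Tuple r) → y ∷ toList v ++ U ⊆ toList v ++ y ∷ U
      front v (here i≡y) = ∈-++⁺ʳ (toList v) (here i≡y)
      front v (there i∈) with ∈-++⁻ (toList v) i∈
      ... | inj₁ i∈v = ∈-++⁺ˡ i∈v
      ... | inj₂ i∈U = ∈-++⁺ʳ (toList v) (there i∈U)
      back : ∀ (v : Tuple r) → toList v ++ y ∷ U ⊆ y ∷ toList v ++ U
      back v i∈ with ∈-++⁻ (toList v) i∈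
      ... | inj₁ i∈v         = there (∈-++⁺ˡ i∈v)
      ... | inj₂ (here i≡y)  = here i≡y
      ... | inj₂ (there i∈U) = there (∈-++⁺ʳ (toList v) i∈U)
      front-length : ∀ (v : Tuple r) → length (y ∷ toList v ++ U) ≡ length (toList v ++ y ∷ U)
      front-length v = trans (cong suc (List.length-++ (toList v)))
        (trans (sym (ℕ.+-suc (length (toList v)) (length U))) (sym (List.length-++ (toList v))))

-- Detecting a falsified clause from part of the variables.

module Detect where
  open import Defs using (Literal; pos; neg; Clause; CNF; evalLiteral; evalClause; evalCNF)
  open Rat
  open Multilinear
  open import Data.Rational.Base
  open import Data.Rational.Properties hiding (_≟_)
  open import Data.Bool.Base using (Bool; true; false; not; _∧_; _∨_)
  import Data.Bool.Properties as Bool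
  open import Data.Nat.Base using (ℕ)
  open import Data.Fin.Base using (Fin)
  open import Data.Fin.Properties using (_≟_)
  open import Data.List.Base as List using (List; []; _∷_)
  open import Data.List.Membership.Propositional using (_∈_)
  import Data.List.Membership.DecPropositional as DecMembership
  open import Data.List.Relation.Unary.All as All using (All; []; _∷_)
  open import Data.List.Relation.Unary.Any using (here; there)
  open import Data.Product.Base using (_×_; _,_; ∃-syntax)
  open import Data.Vec.Base using (lookup)
  open import Function.Base using (_∘_)
  open import Relation.Binary.PropositionalEquality
  open import Relation.Nullary.Decidable.Core using (Dec; yes; no; does)
  open import Relation.Nullary.Negation.Core using (contradiction)

  module _ {n : ℕ} where

    open DecMembership (_≟_ {n}) using (_∈?_)

    variableOf : Literal n → Fin n
    variableOf (pos i) = i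
    variableOf (neg i) = i

    variables : Clause n → List (Fin n)
    variables = List.map variableOf

    seen? : ∀ (V : List (Fin n)) (c : Clause n) → Dec (All (_∈ V) (variables c))
    seen? V c = All.all? (_∈? V) (variables c)

    -- A clause with an unseen variable passes, whatever its other literals say; the verdict thus
    -- depends only on the variables in `V`.
    unfalsified : CNF n → List (Fin n) → Cube n → Bool
    unfalsified []      V x = true
    unfalsified (c ∷ φ) V x = (not (does (seen? V c)) ∨ evalClause x c) ∧ unfalsified φ V x

    unfalsified-sat : ∀ φ V x → evalCNF φ x ≡ true → unfalsified φ V x ≡ true
    unfalsified-sat []      V x sat = refl
    unfalsified-sat (c ∷ φ) V x sat with does (seen? V c) | evalClause x c
    ... | false | true = unfalsified-sat φ V x sat
    ... | true  | true = unfalsified-sat φ V x sat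

    unfalsified-head : ∀ c φ V x → evalClause x c ≡ false → All (_∈ V) (variables c) →
                       unfalsified (c ∷ φ) V x ≡ false
    unfalsified-head c φ V x eq all∈V with seen? V c
    ... | no ¬all = contradiction all∈V ¬all
    ... | yes _   = cong (_∧ unfalsified φ V x) eq

    unfalsified-tail : ∀ c φ V x → unfalsified φ V x ≡ false → unfalsified (c ∷ φ) V x ≡ false
    unfalsified-tail c φ V x eq = trans (cong (clause ∧_) eq) (Bool.∧-zeroʳ clause)
      where clause = not (does (seen? V c)) ∨ evalClause x c

    -- The clause is chosen before `V`: one fixed set of variables has to serve all tuples, as the
    -- probability of covering it is what lowers the norm.
    falsified-clause : ∀ φ x → evalCNF φ x ≡ false → ∃[ c ] (c ∈ φ
      × (∀ V → All (_∈ V) (variables c) → unfalsified φ V x ≡ false))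
    falsified-clause (c ∷ φ) x unsat = split (evalClause x c) refl
      where
      split : ∀ b → evalClause x c ≡ b → ∃[ c′ ] (c′ ∈ c ∷ φ
        × (∀ V → All (_∈ V) (variables c′) → unfalsified (c ∷ φ) V x ≡ false))
      split false eq = c , here refl , λ V → unfalsified-head c φ V x eq
      split true  eq =
        let (c′ , c′∈φ , detects) = falsified-clause φ x (trans (sym (cong (_∧ evalCNF φ x) eq)) unsat)
        in c′ , there c′∈φ , λ V all∈V → unfalsified-tail c φ V x (detects V all∈V)

    evalClause-cong : ∀ (c : Clause n) x y → (∀ {i} → i ∈ variables c → lookup x i ≡ lookup y i) →
                      evalClause x c ≡ evalClause y c
    evalClause-cong []      x y x~y = refl
    evalClause-cong (l ∷ c) x y x~y = cong₂ _∨_ (literal l (x~y (here refl))) (evalClause-cong c x y (x~y ∘ there))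
      where
      literal : ∀ l → lookup x (variableOf l) ≡ lookup y (variableOf l) → evalLiteral x l ≡ evalLiteral y l
      literal (pos i) eq = eq
      literal (neg i) eq = cong not eq

    unfalsified-local : ∀ φ V x y → (∀ i → i ∈ V → lookup x i ≡ lookup y i) →
                        unfalsified φ V x ≡ unfalsified φ V y
    unfalsified-local []      V x y x~y = refl
    unfalsified-local (c ∷ φ) V x y x~y with seen? V c
    ... | no _      = unfalsified-local φ V x y x~y
    ... | yes all∈V = cong₂ _∧_ (evalClause-cong c x y (λ i∈c → x~y _ (All.lookup all∈V i∈c)))
                                (unfalsified-local φ V x y x~y)

    detector : CNF n → List (Fin n) → Cube n → ℚ
    detector φ V x = ι (bit (unfalsified φ V x))

    detector-junta : ∀ φ V → Junta V (detector φ V)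
    detector-junta φ V x y x~y = cong (ι ∘ bit) (unfalsified-local φ V x y x~y)

  ι-bit-bounded : ∀ b → ∣ ι (bit b) ∣ ≤ 1ℚ
  ι-bit-bounded false = 0≤1
  ι-bit-bounded true  = ≤-refl

  ι-bit-idem : ∀ b → ι (bit b) * ι (bit b) ≡ ι (bit b)
  ι-bit-idem false = refl
  ι-bit-idem true  = refl

-- The Chebyshev walk on satisfying and on falsifying inputs.

module Core where
  open import Defs using (CNF; evalCNF; HasWidthAtMost)
  open Rat
  open Mean
  open Walk
  open Multilinear
  open Hit
  open Relative
  open Detect
  open import Data.Rational.Base
  open import Data.Rational.Properties
  open import Data.Rational.Solver using (module +-*-Solver)
  open import Data.Bool.Base using (true; false; not)
  open import Data.Nat.Base as ℕ using (ℕ; zero; suc)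
  import Data.Nat.Properties as ℕ
  open import Data.List.Base using ([]; _++_; length)
  import Data.List.Properties as List
  open import Data.List.Relation.Unary.All as All using ()
  open import Data.Product.Base using (_×_; _,_; proj₁; proj₂; ∃-syntax)
  open import Data.Vec.Base using (toList)
  import Data.Vec.Properties as Vec
  open import Function.Base using (_∘_)
  open import Relation.Binary.PropositionalEquality

  -- The recurrence of `chebyshev` with the number `β` for the operator, which is how the operator
  -- acts on constants when no clause is falsified.
  chebyshevℚ : ℚ → ℕ → ℚ × ℚ
  chebyshevℚ β zero    = 1ℚ , 0ℚ
  chebyshevℚ β (suc n) = let (t , u) = chebyshevℚ β n ; e = t + β * u in β * e - u , e

  -- T_n((z + 1/z)/2) = (zⁿ + z⁻ⁿ)/2.
  chebyshevℚ-growth : ∀ z v n → z * v ≡ 1ℚ → 0ℚ ≤ v →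
    let t = proj₁ (chebyshevℚ (½ * (z + v)) n) in z ^ n ≤ t + t
  chebyshevℚ-growth z v n zv≡1 0≤v = p≡q+s⇒q≤p (v ^ n) (0≤p^n n 0≤v) (begin
    t n + t n                                        ≡⟨ solve 3 (λ t u γ → t :+ t := (t :+ γ :* u) :+ (t :- γ :* u)) refl (t n) (u n) γ ⟩
    (t n + γ * u n) + (t n - γ * u n)                ≡⟨ cong₂ _+_ (plus n) (minus n) ⟩
    z ^ n + v ^ n                                    ∎)
    where
    open ≡-Reasoning
    open +-*-Solver
    β = ½ * (z + v)
    γ = ½ * (z - v)
    t u : ℕ → ℚ
    t n = proj₁ (chebyshevℚ β n)
    u n = proj₂ (chebyshevℚ β n)
    -- `β * β - γ * γ` equals `z * v`, which is 1. Inserting this product turns the recurrences of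
    -- `t + γ u` and `t - γ u` into polynomial identities in `z` and `v`.
    1*u : ∀ n → u n ≡ z * v * u n
    1*u n = trans (sym (*-identityˡ (u n))) (cong (_* u n) (sym zv≡1))
    plus : ∀ n → t n + γ * u n ≡ z ^ n
    plus zero    = trans (cong (1ℚ +_) (*-zeroʳ γ)) (+-identityʳ 1ℚ)
    plus (suc n) = trans (cong (λ m → (β * (t n + β * u n) - m) + γ * (t n + β * u n)) (1*u n))
      (trans (solve 4 (λ z v t u → let β = con ½ :* (z :+ v) ; γ = con ½ :* (z :- v) in
          (β :* (t :+ β :* u) :- z :* v :* u) :+ γ :* (t :+ β :* u) := z :* (t :+ γ :* u)) refl z v (t n) (u n))
        (cong (z *_) (plus n)))
    minus : ∀ n → t n - γ * u n ≡ v ^ n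
    minus zero    = cong (λ m → 1ℚ - m) (*-zeroʳ γ)
    minus (suc n) = trans (cong (λ m → (β * (t n + β * u n) - m) - γ * (t n + β * u n)) (1*u n))
      (trans (solve 4 (λ z v t u → let β = con ½ :* (z :+ v) ; γ = con ½ :* (z :- v) in
          (β :* (t :+ β :* u) :- z :* v :* u) :- γ :* (t :+ β :* u) := v :* (t :- γ :* u)) refl z v (t n) (u n))
        (cong (v *_) (minus n)))

  reciprocal : ∀ p → 0ℚ < p → ∃[ q ] (p * q ≡ 1ℚ × 0ℚ < q)
  reciprocal p 0<p = 1/ p , *-inverseʳ p , positive⁻¹ (1/ p) {{1/pos⇒pos p}}
    where
    instance
      p-pos : Positive p
      p-pos = positive 0<p
      p-nonZero : NonZero p
      p-nonZero = pos⇒nonZero p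

  module Amplified (ℓ : ℕ) (w : ℚ) (0≤w : 0ℚ ≤ w) (w*ℓ≡1 : w * ι ℓ ≡ 1ℚ) (r : ℕ) (c : ℚ) (φ : CNF ℓ) where

    open ProductSpace ℓ w 0≤w w*ℓ≡1
    open Hitting ℓ w 0≤w w*ℓ≡1
    open RelativeMean ℓ w 0≤w w*ℓ≡1
    open InnerProduct (𝔼-isMean r)
    open IsMean (𝔼-isMean r)

    D : Cube ℓ → Tuple r → ℚ
    D x ω = detector φ (toList ω) x

    A : Cube ℓ → (Tuple r → ℚ) → Tuple r → ℚ
    A x f ω = D x ω * resample r (λ ω → D x ω * f ω) ω

    B : Cube ℓ → (Tuple r → ℚ) → Tuple r → ℚ
    B x f ω = c * A x f ω

    T U : ℕ → Cube ℓ → Tuple r → ℚ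
    T n x = proj₁ (chebyshev (B x) n)
    U n x = proj₂ (chebyshev (B x) n)

    -- 6 = 2 · 3: the scaling `c` reduces the `r` summands to a factor 2, and exchanging a variable
    -- contributes 3.
    B-rel : ∣ c ∣ * ι r ≤ ι 2 → ∀ {m N} {F : Cube ℓ → Tuple r → ℚ} → 0ℚ ≤ N →
            (∀ ω → RelPoly (toList ω) m N (λ x → F x ω)) →
            ∀ ω → RelPoly (toList ω) (suc m) (ι 6 * N) (λ x → B x (F x) ω)
    B-rel cr≤2 {m} {N} {F} 0≤N p ω = rel-weaken ℕ.≤-refl bound
      (rel-* c (rel-junta (detector-junta φ (toList ω)) (λ x → ι-bit-bounded (unfalsified φ (toList ω) x))
        (subst (λ V → RelPoly V (suc m) (ι r * (3ℚ * N)) (λ x → resample r (λ ω → D x ω * F x ω) ω))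
          (List.++-identityʳ (toList ω))
          (rel-resample r {U = []} {F = λ x ω → D x ω * F x ω} detected ω))))
      where
      open +-*-Solver
      detected : ∀ ω → RelPoly (toList ω ++ []) m N (λ x → D x ω * F x ω)
      detected ω = subst (λ V → RelPoly V m N (λ x → D x ω * F x ω)) (sym (List.++-identityʳ (toList ω)))
        (rel-junta (detector-junta φ (toList ω)) (λ x → ι-bit-bounded (unfalsified φ (toList ω) x)) (p ω))
      bound : ∣ c ∣ * (ι r * (3ℚ * N)) ≤ ι 6 * N
      bound = ≤-trans (≤-reflexive (sym (*-assoc ∣ c ∣ (ι r) (3ℚ * N))))
        (≤-trans (*-monoʳ-≤-0≤ (3ℚ * N) (0≤p*q (0≤ι 3) 0≤N) cr≤2)
          (≤-reflexive (sym (*-assoc (ι 2) 3ℚ N))))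

    -- One step applies `B` to `u` and then to `t + B u`: two exchanges, and the norm grows by 6 (1
    -- + 6) + 1 = 43.
    chebyshev-rel : ∣ c ∣ * ι r ≤ ι 2 → ∀ n ω →
      RelPoly (toList ω) (n ℕ.* 2) (ι 43 ^ n) (λ x → T n x ω) ×
      RelPoly (toList ω) (n ℕ.* 2) (ι 43 ^ n) (λ x → U n x ω)
    chebyshev-rel cr≤2 zero    ω = rel-1 , rel-weaken ℕ.≤-refl 0≤1 rel-0
    chebyshev-rel cr≤2 (suc n) ω =
        rel-weaken ℕ.≤-refl (≤-reflexive (solve 1 (λ N → con (ι 6) :* (N :+ con (ι 6) :* N) :+ N := con (ι 43) :* N) refl N))
          (rel-- (B-rel cr≤2 {F = λ x → T n x ⊕ B x (U n x)} (0≤p+q 0≤N (0≤p*q (0≤ι 6) 0≤N)) E-rel ω)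
                 (rel-weaken (ℕ.m≤n+m (n ℕ.* 2) 2) ≤-refl (proj₂ (chebyshev-rel cr≤2 n ω))))
      , rel-weaken (ℕ.n≤1+n _) (p≡q+s⇒q≤p (ι 36 * N) (0≤p*q (0≤ι 36) 0≤N)
          (solve 1 (λ N → con (ι 43) :* N := (N :+ con (ι 6) :* N) :+ con (ι 36) :* N) refl N)) (E-rel ω)
      where
      open +-*-Solver
      N = ι 43 ^ n
      0≤N : 0ℚ ≤ N
      0≤N = 0≤p^n n (0≤ι 43)
      E-rel : ∀ ω → RelPoly (toList ω) (suc (n ℕ.* 2)) (N + ι 6 * N) (λ x → T n x ω + B x (U n x) ω)
      E-rel ω = rel-+ (rel-weaken (ℕ.n≤1+n _) ≤-refl (proj₁ (chebyshev-rel cr≤2 n ω)))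
                      (B-rel cr≤2 {F = U n} 0≤N (λ ω → proj₂ (chebyshev-rel cr≤2 n ω)) ω)

    chebyshev-isPoly : ∣ c ∣ * ι r ≤ ι 2 → ∀ n →
      IsPoly (r ℕ.+ n ℕ.* 2) (3ℚ ^ r * ι 43 ^ n) (λ x → 𝔼 r (T n x))
    chebyshev-isPoly cr≤2 n = poly-𝔼 r λ ω → subst (λ l → IsPoly (l ℕ.+ n ℕ.* 2) (3ℚ ^ l * ι 43 ^ n) (λ x → T n x ω))
      (trans (ℕ.+-identityʳ (length (toList ω))) (Vec.length-toList ω))
      (poly-cong (λ x → *-identityˡ (T n x ω))
        -- The constant test function with no extra variables recovers the polynomial itself.
        (proj₁ (chebyshev-rel cr≤2 n ω) [] (λ _ → 1ℚ) (λ _ _ _ → refl) (λ _ → ≤-refl)))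

    chebyshev-sat : ∀ n x → evalCNF φ x ≡ true → 𝔼 r (T n x) ≡ proj₁ (chebyshevℚ (c * ι r) n)
    chebyshev-sat n x sat = trans (mean-cong (proj₁ (constant n))) (mean-const (proj₁ (chebyshevℚ β n)))
      where
      open +-*-Solver
      β = c * ι r
      D≡1 : ∀ ω → D x ω ≡ 1ℚ
      D≡1 ω = cong (ι ∘ bit) (unfalsified-sat φ (toList ω) x sat)
      B-constant : ∀ {f a} → (∀ ω → f ω ≡ a) → ∀ ω → B x f ω ≡ β * a
      B-constant {f} {a} f≡a ω = begin
        c * (D x ω * resample r (λ ω → D x ω * f ω) ω)
          ≡⟨ cong₂ (λ d e → c * (d * e)) (D≡1 ω)
               (resample-cong r (λ ω → trans (cong₂ _*_ (D≡1 ω) (f≡a ω)) (*-comm 1ℚ a)) ω) ⟩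
        c * (1ℚ * resample r (λ _ → a * 1ℚ) ω)
          ≡⟨ cong (λ e → c * (1ℚ * e)) (trans (resample-* r a (λ _ → 1ℚ) ω) (cong (a *_) (resample-1 r ω))) ⟩
        c * (1ℚ * (a * ι r))
          ≡⟨ solve 3 (λ c a r → c :* (con 1ℚ :* (a :* r)) := c :* r :* a) refl c a (ι r) ⟩
        β * a ∎
        where open ≡-Reasoning
      constant : ∀ n → (∀ ω → T n x ω ≡ proj₁ (chebyshevℚ β n)) × (∀ ω → U n x ω ≡ proj₂ (chebyshevℚ β n))
      constant zero    = (λ _ → refl) , (λ _ → refl)
      constant (suc n) = (λ ω → cong₂ _-_ (B-constant E≡e ω) (proj₂ (constant n) ω)) , E≡e
        where
        E≡e : ∀ ω → T n x ω + B x (U n x) ω ≡ proj₁ (chebyshevℚ β n) + β * proj₂ (chebyshevℚ β n)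
        E≡e ω = cong₂ _+_ (proj₁ (constant n) ω) (B-constant (proj₂ (constant n)) ω)

    chebyshev-unsat : ∀ k μ → HasWidthAtMost φ k → (∀ T → weight T ℕ.≤ k → μ ≤ hitProb r T) →
      μ < 1ℚ → μ < ι r → 0ℚ ≤ c → c * (ι r - μ) ≤ 1ℚ →
      ∀ n x → evalCNF φ x ≡ false → ∣ 𝔼 r (T n x) ∣ ≤ 1ℚ
    chebyshev-unsat k μ width μ≤hit μ<1 μ<r 0≤c cκ≤1 n x unsat =
      chebyshev-mean-≤1 (B x) B-0 B-sym B≤1 n
      where
      open +-*-Solver
      κ = ι r - μ
      0<κ : 0ℚ < κ
      0<κ = subst (_< κ) (+-inverseʳ μ) (+-monoˡ-< (- μ) μ<r)
      0<1-μ : 0ℚ < 1ℚ - μ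
      0<1-μ = subst (_< 1ℚ - μ) (+-inverseʳ μ) (+-monoˡ-< (- μ) μ<1)

      clause = proj₁ (falsified-clause φ x unsat)
      S = varSet (variables clause)

      missed : Tuple r → ℚ
      missed ω = ι (bit (not (hit S ω)))

      S≤k : weight S ℕ.≤ k
      S≤k = ℕ.≤-trans (weight-varSet (variables clause))
        (ℕ.≤-trans (ℕ.≤-reflexive (List.length-map variableOf clause))
          (All.lookup width (proj₁ (proj₂ (falsified-clause φ x unsat)))))

      missProb : 𝔼 r missed ≤ 1ℚ - μ
      missProb = ≤-trans (≤-reflexive eq) (+-monoʳ-≤ 1ℚ (neg-antimono-≤ (μ≤hit S S≤k)))
        where
        complement : ∀ b → ι (bit (not b)) + ι (bit b) ≡ 1ℚ
        complement false = refl
        complement true  = refl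
        eq : 𝔼 r missed ≡ 1ℚ - hitProb r S
        eq = trans (solve 2 (λ a b → a := (a :+ b) :- b) refl (𝔼 r missed) (hitProb r S))
          (cong (_- hitProb r S) (trans (sym (mean-+ missed (λ ω → ι (bit (hit S ω)))))
            (trans (mean-cong (λ ω → complement (hit S ω))) mean-1)))

      -- A tuple that hits `S` contains all variables of the falsified clause, so the detector
      -- vanishes there.
      D-missed : ∀ ω → D x ω * missed ω ≡ D x ω
      D-missed ω with hit S ω in hits
      ... | false = *-identityʳ (D x ω)
      ... | true  = trans (*-zeroʳ (D x ω)) (sym (cong (ι ∘ bit)
        (proj₂ (proj₂ (falsified-clause φ x unsat)) (toList ω)
          (All.tabulate (λ {i} i∈c → hit⇒∈ S ω hits i (∈-varSet (variables clause) i∈c))))))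

      Df : (Tuple r → ℚ) → Tuple r → ℚ
      Df f ω = D x ω * f ω

      A-ip : ∀ f g → ⟨ A x f , g ⟩ ≡ ⟨ resample r (Df f) , Df g ⟩
      A-ip f g = mean-cong (λ ω → solve 3 (λ d e g → d :* e :* g := e :* (d :* g)) refl
        (D x ω) (resample r (Df f) ω) (g ω))

      A-sym : ∀ f g → ⟨ A x f , g ⟩ ≡ ⟨ f , A x g ⟩
      A-sym f g = trans (A-ip f g) (trans (resample-sym r (Df f) (Df g))
        (trans (ip-comm (Df f) _) (trans (sym (A-ip g f)) (ip-comm (A x g) f))))

      A-psd : ∀ f → 0ℚ ≤ ⟨ A x f , f ⟩
      A-psd f = subst (0ℚ ≤_) (sym (A-ip f f)) (resample-psd r (Df f))

      A-* : ∀ a f ω → A x (a ⊙ f) ω ≡ a * A x f ω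
      A-* a f ω = trans (cong (D x ω *_) (trans
          (resample-cong r (λ ω → solve 3 (λ d a f → d :* (a :* f) := a :* (d :* f)) refl (D x ω) a (f ω)) ω)
          (resample-* r a (Df f) ω)))
        (solve 3 (λ d a e → d :* (a :* e) := a :* (d :* e)) refl (D x ω) a (resample r (Df f) ω))

      A-- : ∀ f g ω → A x (f ⊖ g) ω ≡ A x f ω - A x g ω
      A-- f g ω = trans (cong (D x ω *_) (trans
          (resample-cong r (λ ω → solve 3 (λ d f g → d :* (f :- g) := d :* f :+ (:- con 1ℚ) :* (d :* g)) refl (D x ω) (f ω) (g ω)) ω)
          (trans (resample-+ r (Df f) (λ ω → (- 1ℚ) * Df g ω) ω)
            (cong (resample r (Df f) ω +_) (resample-* r (- 1ℚ) (Df g) ω)))))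
        (solve 3 (λ d a b → d :* (a :+ (:- con 1ℚ) :* b) := d :* a :- d :* b) refl (D x ω)
          (resample r (Df f) ω) (resample r (Df g) ω))

      Df≤f : ∀ f → ⟨ Df f , Df f ⟩ ≤ ⟨ f , f ⟩
      Df≤f f = mean-mono (λ ω → subst₂ _≤_ (sym (square ω)) (*-identityˡ (f ω * f ω))
        (*-monoʳ-≤-0≤ (f ω * f ω) (0≤p² (f ω)) (≤-trans (p≤∣p∣ (D x ω)) (ι-bit-bounded (unfalsified φ (toList ω) x)))))
        where
        square : ∀ ω → Df f ω * Df f ω ≡ D x ω * (f ω * f ω)
        square ω = trans (solve 2 (λ d f → d :* f :* (d :* f) := d :* d :* (f :* f)) refl (D x ω) (f ω))
          (cong (_* (f ω * f ω)) (ι-bit-idem (unfalsified φ (toList ω) x)))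

      -- `Df f` vanishes wherever the clause is covered, so by Cauchy-Schwarz its squared mean is at
      -- most `1 - μ` times its squared norm. Used in the last term of Efron-Stein, this lowers the
      -- trivial bound `r` to `r - μ`.
      A≤κ : ∀ f → ⟨ A x f , f ⟩ ≤ κ * ⟨ f , f ⟩
      A≤κ f = ≤-trans (≤-reflexive (A-ip f f)) (≤-trans step (*-monoˡ-≤-0≤ κ (<⇒≤ 0<κ) (Df≤f f)))
        where
        open ≤-Reasoning
        h = Df f
        support : 𝔼 r h * 𝔼 r h ≤ (1ℚ - μ) * ⟨ h , h ⟩
        support = mean²-support h missed (1ℚ - μ) 0<1-μ missProb
          (λ ω → ι-bit-idem (not (hit S ω)))
          (λ ω → trans (solve 3 (λ d f m → d :* f :* m := d :* m :* f) refl (D x ω) (f ω) (missed ω))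
            (cong (_* f ω) (D-missed ω)))
        step : ⟨ resample r h , h ⟩ ≤ κ * ⟨ h , h ⟩
        step = begin
          ⟨ resample r h , h ⟩
            ≡⟨ solve 2 (λ a b → a := (a :+ b) :- b) refl ⟨ resample r h , h ⟩ ⟨ h , h ⟩ ⟩
          ⟨ resample r h , h ⟩ + ⟨ h , h ⟩ - ⟨ h , h ⟩
            ≤⟨ +-monoˡ-≤ (- ⟨ h , h ⟩) (≤-trans (efron-stein r h) (+-monoʳ-≤ (ι r * ⟨ h , h ⟩) support)) ⟩
          ι r * ⟨ h , h ⟩ + (1ℚ - μ) * ⟨ h , h ⟩ - ⟨ h , h ⟩
            ≡⟨ solve 3 (λ r m q → r :* q :+ (con 1ℚ :- m) :* q :- q := (r :- m) :* q) refl (ι r) μ ⟨ h , h ⟩ ⟩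
          κ * ⟨ h , h ⟩ ∎

      B-0 : ∀ ω → B x (λ _ → 0ℚ) ω ≡ 0ℚ
      B-0 ω = trans (cong (c *_) (A-* 0ℚ (λ _ → 0ℚ) ω)) (solve 2 (λ c a → c :* (con 0ℚ :* a) := con 0ℚ) refl c (A x (λ _ → 0ℚ) ω))

      B-sym : ∀ f g → ⟨ B x f , g ⟩ ≡ ⟨ f , B x g ⟩
      B-sym f g = trans (ip-* c (A x f) g) (trans (cong (c *_) (A-sym f g)) (sym (ip-*ʳ c f (A x g))))

      B≤1 : ∀ f → ⟨ B x f , B x f ⟩ ≤ ⟨ f , f ⟩
      B≤1 f = begin
        ⟨ B x f , B x f ⟩          ≡⟨ trans (ip-* c (A x f) (B x f)) (cong (c *_) (ip-*ʳ c (A x f) (A x f))) ⟩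
        c * (c * ⟨ A x f , A x f ⟩)
          ≤⟨ *-monoˡ-≤-0≤ c 0≤c (*-monoˡ-≤-0≤ c 0≤c (psd-norm-bound (A x) A-* A-- A-sym A-psd κ 0<κ A≤κ f)) ⟩
        c * (c * (κ * (κ * ⟨ f , f ⟩)))
          ≡⟨ solve 3 (λ c κ q → c :* (c :* (κ :* (κ :* q))) := (c :* κ) :* (c :* κ) :* q) refl c κ ⟨ f , f ⟩ ⟩
        (c * κ) * (c * κ) * ⟨ f , f ⟩
          ≤⟨ *-monoʳ-≤-0≤ ⟨ f , f ⟩ (ip-≥0 f) (*-mono-≤ 0≤cκ 0≤cκ cκ≤1 cκ≤1) ⟩
        1ℚ * ⟨ f , f ⟩             ≡⟨ *-identityˡ ⟨ f , f ⟩ ⟩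
        ⟨ f , f ⟩ ∎
        where
        open ≤-Reasoning
        0≤cκ : 0ℚ ≤ c * κ
        0≤cκ = 0≤p*q 0≤c (<⇒≤ 0<κ)

-- Integer parameters and the rational approximation.

module Choice where
  open import Defs using (CNF; evalCNF; HasWidthAtMost)
  open Rat
  open Walk
  open Multilinear
  open Hit
  open Detect
  open Core
  open import Data.Rational.Base
  open import Data.Rational.Properties
  open import Data.Rational.Solver using (module +-*-Solver)
  open import Data.Bool.Base using (true; false)
  open import Data.Nat.Base as ℕ using (ℕ; zero; suc)
  import Data.Nat.Properties as ℕ
  import Data.Nat.Solver as ℕ
  import Data.Nat.DivMod as ℕ
  open import Data.Product.Base using (_×_; _,_; proj₁; proj₂; ∃-syntax)
  open import Function.Base using (_∘_)
  open import Relation.Binary.PropositionalEquality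
  open import Relation.Nullary.Decidable.Core using (yes; no)

  1≤ℕ^ : ∀ m n → 1 ℕ.≤ m → 1 ℕ.≤ m ℕ.^ n
  1≤ℕ^ m n 1≤m = ℕ.m^n>0 m {{ℕ.>-nonZero 1≤m}} n

  ℕ^-distribʳ-* : ∀ m n k → (m ℕ.* n) ℕ.^ k ≡ m ℕ.^ k ℕ.* n ℕ.^ k
  ℕ^-distribʳ-* m n zero    = refl
  ℕ^-distribʳ-* m n (suc k) = trans (cong (m ℕ.* n ℕ.*_) (ℕ^-distribʳ-* m n k))
    (solve 4 (λ m n a b → m :* n :* (a :* b) := m :* a :* (n :* b)) refl m n (m ℕ.^ k) (n ℕ.^ k))
    where open ℕ.+-*-Solver

  n<m^n : ∀ m n → 2 ℕ.≤ m → n ℕ.< m ℕ.^ n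
  n<m^n m zero    2≤m = ℕ.≤-refl
  n<m^n m (suc n) 2≤m = begin
    suc (suc n)          ≤⟨ ℕ.s≤s (ℕ.m≤n+m (suc n) n) ⟩
    suc n ℕ.+ suc n      ≡⟨ cong (suc n ℕ.+_) (sym (ℕ.+-identityʳ (suc n))) ⟩
    2 ℕ.* suc n          ≤⟨ ℕ.*-mono-≤ 2≤m (n<m^n m n 2≤m) ⟩
    m ℕ.* m ℕ.^ n        ∎
    where open ℕ.≤-Reasoning

  module Parameters (ℓ k r M : ℕ) (1≤ℓ : 1 ℕ.≤ ℓ) (1≤k : 1 ℕ.≤ k) (1≤M : 1 ℕ.≤ M) (4r≤ℓ : 4 ℕ.* r ℕ.≤ ℓ)
    (large : M ℕ.* M ℕ.* (4 ℕ.* ℓ) ℕ.^ k ℕ.≤ r ℕ.^ suc k) where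

    private
      1≤M² : 1 ℕ.≤ M ℕ.* M
      1≤M² = ℕ.*-mono-≤ 1≤M 1≤M

    1≤r : 1 ℕ.≤ r
    1≤r = 1≤base r (ℕ.≤-trans (ℕ.*-mono-≤ 1≤M² (1≤ℕ^ (4 ℕ.* ℓ) k (ℕ.≤-trans 1≤ℓ (ℕ.m≤m+n ℓ _)))) large)
      where
      1≤base : ∀ r → 1 ℕ.≤ r ℕ.^ suc k → 1 ℕ.≤ r
      1≤base (suc r) _ = ℕ.s≤s ℕ.z≤n

    -- As `16 r ≤ 4 ℓ`, the power `r ^ k` cancels from `large`. What is left is strong enough for
    -- all side conditions: `M ≤ r`, `M² < r` and `2 k ≤ r`.
    M²16^k≤r : M ℕ.* M ℕ.* 16 ℕ.^ k ℕ.≤ r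
    M²16^k≤r = ℕ.*-cancelʳ-≤ (M ℕ.* M ℕ.* 16 ℕ.^ k) r (r ℕ.^ k) {{ℕ.>-nonZero (1≤ℕ^ r k 1≤r)}} (begin
      M ℕ.* M ℕ.* 16 ℕ.^ k ℕ.* r ℕ.^ k
        ≡⟨ trans (ℕ.*-assoc (M ℕ.* M) (16 ℕ.^ k) (r ℕ.^ k)) (cong (M ℕ.* M ℕ.*_) (sym (ℕ^-distribʳ-* 16 r k))) ⟩
      M ℕ.* M ℕ.* (16 ℕ.* r) ℕ.^ k
        ≤⟨ ℕ.*-monoʳ-≤ (M ℕ.* M) (ℕ.^-monoˡ-≤ k (ℕ.≤-trans (ℕ.≤-reflexive (ℕ.*-assoc 4 4 r)) (ℕ.*-monoʳ-≤ 4 4r≤ℓ))) ⟩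
      M ℕ.* M ℕ.* (4 ℕ.* ℓ) ℕ.^ k
        ≤⟨ large ⟩
      r ℕ.* r ℕ.^ k ∎)
      where open ℕ.≤-Reasoning

    M≤r : M ℕ.≤ r
    M≤r = begin
      M                       ≡⟨ sym (trans (ℕ.*-identityʳ _) (ℕ.*-identityʳ M)) ⟩
      M ℕ.* 1 ℕ.* 1           ≤⟨ ℕ.*-mono-≤ (ℕ.*-monoʳ-≤ M 1≤M) (1≤ℕ^ 16 k (ℕ.s≤s ℕ.z≤n)) ⟩
      M ℕ.* M ℕ.* 16 ℕ.^ k    ≤⟨ M²16^k≤r ⟩
      r                       ∎
      where open ℕ.≤-Reasoning

    M²<r : M ℕ.* M ℕ.< r
    M²<r = begin-strict
      M ℕ.* M                 ≡⟨ sym (ℕ.*-identityʳ _) ⟩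
      M ℕ.* M ℕ.* 1           <⟨ ℕ.*-monoʳ-< (M ℕ.* M) {{ℕ.>-nonZero 1≤M²}} (ℕ.≤-<-trans 1≤k (n<m^n 16 k (ℕ.s≤s (ℕ.s≤s ℕ.z≤n)))) ⟩
      M ℕ.* M ℕ.* 16 ℕ.^ k    ≤⟨ M²16^k≤r ⟩
      r                       ∎
      where open ℕ.≤-Reasoning

    2k≤r : 2 ℕ.* k ℕ.≤ r
    2k≤r = begin
      2 ℕ.* k                 ≡⟨ ℕ.*-comm 2 k ⟩
      k ℕ.* 2                 ≤⟨ ℕ.*-mono-≤ (ℕ.<⇒≤ (n<m^n 4 k (ℕ.s≤s (ℕ.s≤s ℕ.z≤n))))
                                             (ℕ.≤-trans (ℕ.s≤s 1≤k) (n<m^n 4 k (ℕ.s≤s (ℕ.s≤s ℕ.z≤n)))) ⟩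
      4 ℕ.^ k ℕ.* 4 ℕ.^ k     ≡⟨ sym (ℕ^-distribʳ-* 4 4 k) ⟩
      16 ℕ.^ k                ≡⟨ sym (ℕ.*-identityˡ (16 ℕ.^ k)) ⟩
      1 ℕ.* 16 ℕ.^ k          ≤⟨ ℕ.*-monoˡ-≤ (16 ℕ.^ k) 1≤M² ⟩
      M ℕ.* M ℕ.* 16 ℕ.^ k    ≤⟨ M²16^k≤r ⟩
      r                       ∎
      where open ℕ.≤-Reasoning

    private instance
      M-nonZero : ℕ.NonZero M
      M-nonZero = ℕ.>-nonZero 1≤M

    -- The first multiple of `M` beyond `r`: divisibility lets the growth be written as an `M`-th
    -- power, and staying below `2 r` keeps the degree linear in `r`.
    steps : ℕ
    steps = suc (r ℕ./ M) ℕ.* M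

    steps≤2r : steps ℕ.≤ 2 ℕ.* r
    steps≤2r = ℕ.+-mono-≤ M≤r (ℕ.≤-trans (ℕ.m/n*n≤m r M) (ℕ.m≤m+n r 0))

    r≤steps : r ℕ.≤ steps
    r≤steps = ℕ.≤-trans (ℕ.≤-reflexive (ℕ.m≡m%n+[m/n]*n r M)) (ℕ.+-monoˡ-≤ _ (ℕ.<⇒≤ (ℕ.m%n<n r M)))

    ρ = proj₁ (reciprocal (ι r) (0<ι 1≤r))
    w = proj₁ (reciprocal (ι ℓ) (0<ι 1≤ℓ))

    rρ≡1 : ι r * ρ ≡ 1ℚ
    rρ≡1 = proj₁ (proj₂ (reciprocal (ι r) (0<ι 1≤r)))

    0≤ρ : 0ℚ ≤ ρ
    0≤ρ = <⇒≤ (proj₂ (proj₂ (reciprocal (ι r) (0<ι 1≤r))))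

    w*ℓ≡1 : w * ι ℓ ≡ 1ℚ
    w*ℓ≡1 = trans (*-comm w (ι ℓ)) (proj₁ (proj₂ (reciprocal (ι ℓ) (0<ι 1≤ℓ))))

    0≤w : 0ℚ ≤ w
    0≤w = <⇒≤ (proj₂ (proj₂ (reciprocal (ι ℓ) (0<ι 1≤ℓ))))

    b = ι M * ρ
    z = 1ℚ + b

    0≤b : 0ℚ ≤ b
    0≤b = 0≤p*q (0≤ι M) 0≤ρ

    b≤1 : b ≤ 1ℚ
    b≤1 = subst (b ≤_) rρ≡1 (*-monoʳ-≤-0≤ ρ 0≤ρ (ι-mono-≤ M≤r))

    1≤z : 1ℚ ≤ z
    1≤z = p≡q+s⇒q≤p b 0≤b refl

    v = proj₁ (reciprocal z (<-≤-trans 0<1 1≤z))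

    zv≡1 : z * v ≡ 1ℚ
    zv≡1 = proj₁ (proj₂ (reciprocal z (<-≤-trans 0<1 1≤z)))

    0≤v : 0ℚ ≤ v
    0≤v = <⇒≤ (proj₂ (proj₂ (reciprocal z (<-≤-trans 0<1 1≤z))))

    v≤1 : v ≤ 1ℚ
    v≤1 = ≤-trans (≤-reflexive (sym (*-identityˡ v))) (≤-trans (*-monoʳ-≤-0≤ v 0≤v 1≤z) (≤-reflexive zv≡1))

    -- With `v = 1/z`, this is a point just above 1 at which Chebyshev polynomials grow like powers
    -- of `z`. The scale `c` sends `r` to `β`, and `μ = r b²` is a large enough gap for `c` to send
    -- `r - μ` to at most 1.
    β = ½ * (z + v)
    c = β * ρ
    μ = ι (M ℕ.* M) * ρ

    0≤c : 0ℚ ≤ c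
    0≤c = 0≤p*q (0≤p*q (nonNegative⁻¹ ½) (0≤p+q (≤-trans 0≤1 1≤z) 0≤v)) 0≤ρ

    cr≡β : c * ι r ≡ β
    cr≡β = trans (*-assoc β ρ (ι r)) (trans (cong (β *_) (trans (*-comm ρ (ι r)) rρ≡1)) (*-identityʳ β))

    cr≤2 : ∣ c ∣ * ι r ≤ ι 2
    cr≤2 = ≤-trans (≤-reflexive (trans (cong (_* ι r) (0≤p⇒∣p∣≡p 0≤c)) cr≡β))
      (≤-trans (*-monoˡ-≤-0≤ ½ (nonNegative⁻¹ ½) (+-mono-≤ (+-monoʳ-≤ 1ℚ b≤1) v≤1))
        -- From `z ≤ 2` and `v ≤ 1`, `β` is at most 3/2, which leaves a slack of ½.
        (p≡q+s⇒q≤p ½ (nonNegative⁻¹ ½) refl))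

    μ<1 : μ < 1ℚ
    μ<1 = subst (μ <_) rρ≡1 (*-monoˡ-<-pos ρ {{positive 0<ρ}} (ι-mono-< M²<r))
      where
      0<ρ : 0ℚ < ρ
      0<ρ = proj₂ (proj₂ (reciprocal (ι r) (0<ι 1≤r)))

    μ<r : μ < ι r
    μ<r = <-≤-trans μ<1 (ι-mono-≤ {1} {r} 1≤r)

    -- cκ = β (1 - b²) = 1 - b² z / 2.
    cκ≤1 : c * (ι r - μ) ≤ 1ℚ
    cκ≤1 = p≡q+s⇒q≤p (½ * (b * b * z)) (0≤p*q (nonNegative⁻¹ ½) (0≤p*q (0≤p² b) (≤-trans 0≤1 1≤z))) (sym (begin
      c * (ι r - μ) + ½ * (b * b * z)
        ≡⟨ cong (λ m → c * (ι r - m) + ½ * (b * b * z)) μ≡rb² ⟩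
      c * (ι r - ι r * (b * b)) + ½ * (b * b * z)
        ≡⟨ solve 4 (λ c r b y → c :* (r :- r :* (b :* b)) :+ con ½ :* (b :* b :* y)
             := c :* r :* (con 1ℚ :- b :* b) :+ con ½ :* (b :* b :* y)) refl c (ι r) b z ⟩
      c * ι r * (1ℚ - b * b) + ½ * (b * b * z)
        ≡⟨ cong (λ m → m * (1ℚ - b * b) + ½ * (b * b * z)) cr≡β ⟩
      ½ * (z + v) * (1ℚ - b * b) + ½ * (b * b * z)
        ≡⟨ solve 2 (λ b v → con ½ :* (con 1ℚ :+ b :+ v) :* (con 1ℚ :- b :* b) :+ con ½ :* (b :* b :* (con 1ℚ :+ b))
             := con ½ :* (con 1ℚ :+ b) :+ con ½ :* ((con 1ℚ :+ b) :* v :* (con 1ℚ :- b))) refl b v ⟩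
      ½ * (1ℚ + b) + ½ * (z * v * (1ℚ - b))
        ≡⟨ cong (λ m → ½ * (1ℚ + b) + ½ * (m * (1ℚ - b))) zv≡1 ⟩
      ½ * (1ℚ + b) + ½ * (1ℚ * (1ℚ - b))
        ≡⟨ solve 1 (λ b → con ½ :* (con 1ℚ :+ b) :+ con ½ :* (con 1ℚ :* (con 1ℚ :- b)) := con 1ℚ) refl b ⟩
      1ℚ ∎))
      where
      open ≡-Reasoning
      open +-*-Solver
      μ≡rb² : μ ≡ ι r * (b * b)
      μ≡rb² = sym (trans (solve 3 (λ r m p → r :* (m :* p :* (m :* p)) := r :* p :* (m :* m :* p)) refl (ι r) (ι M) ρ)
        (trans (cong (_* (ι M * ι M * ρ)) rρ≡1) (trans (*-identityˡ _) (cong (_* ρ) (sym (ι-* M M))))))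

    -- This is `large` divided by `r * (4 ℓ) ^ k`; it matches the gap `μ` with the bound of
    -- `hitProb-lower`.
    μ≤[rw/4]^k : μ ≤ (½ * (½ * (ι r * w))) ^ k
    μ≤[rw/4]^k = begin
      ι (M ℕ.* M) * ρ
        ≡⟨ trans (sym (*-identityʳ _)) (cong (ι (M ℕ.* M) * ρ *_) (sym 4ℓy≡1)) ⟩
      ι (M ℕ.* M) * ρ * (ι ((4 ℕ.* ℓ) ℕ.^ k) * y ^ k)
        ≡⟨ solve 4 (λ m p l y → m :* p :* (l :* y) := m :* l :* (p :* y)) refl (ι (M ℕ.* M)) ρ (ι ((4 ℕ.* ℓ) ℕ.^ k)) (y ^ k) ⟩
      ι (M ℕ.* M) * ι ((4 ℕ.* ℓ) ℕ.^ k) * (ρ * y ^ k)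
        ≡⟨ cong (_* (ρ * y ^ k)) (sym (ι-* (M ℕ.* M) ((4 ℕ.* ℓ) ℕ.^ k))) ⟩
      ι (M ℕ.* M ℕ.* (4 ℕ.* ℓ) ℕ.^ k) * (ρ * y ^ k)
        ≤⟨ *-monoʳ-≤-0≤ (ρ * y ^ k) (0≤p*q 0≤ρ (0≤p^n k 0≤y)) (ι-mono-≤ large) ⟩
      ι (r ℕ.^ suc k) * (ρ * y ^ k)
        ≡⟨ cong (_* (ρ * y ^ k)) (ι-^ r (suc k)) ⟩
      ι r * ι r ^ k * (ρ * y ^ k)
        ≡⟨ solve 4 (λ r s p y → r :* s :* (p :* y) := r :* p :* (s :* y)) refl (ι r) (ι r ^ k) ρ (y ^ k) ⟩
      ι r * ρ * (ι r ^ k * y ^ k)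
        ≡⟨ trans (cong (_* (ι r ^ k * y ^ k)) rρ≡1) (trans (*-identityˡ _) (sym (^-distrib-* (ι r) y k))) ⟩
      (ι r * y) ^ k
        ≡⟨ cong (_^ k) (solve 2 (λ r w → r :* (con ½ :* (con ½ :* w)) := con ½ :* (con ½ :* (r :* w))) refl (ι r) w) ⟩
      (½ * (½ * (ι r * w))) ^ k ∎
      where
      open ≤-Reasoning
      open +-*-Solver
      y = ½ * (½ * w)
      0≤y : 0ℚ ≤ y
      0≤y = 0≤p*q (nonNegative⁻¹ ½) (0≤p*q (nonNegative⁻¹ ½) 0≤w)
      4ℓy≡1 : ι ((4 ℕ.* ℓ) ℕ.^ k) * y ^ k ≡ 1ℚ
      4ℓy≡1 = trans (cong (_* y ^ k) (ι-^ (4 ℕ.* ℓ) k)) (trans (sym (^-distrib-* (ι (4 ℕ.* ℓ)) y k))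
        (trans (cong (_^ k) (trans (cong (_* y) (ι-* 4 ℓ))
          (trans (solve 2 (λ l w → con (ι 4) :* l :* (con ½ :* (con ½ :* w)) := w :* l) refl (ι ℓ) w) w*ℓ≡1))) (1^n≡1 k)))

    τ = proj₁ (chebyshevℚ β steps)

    -- By Bernoulli's inequality, `steps / M` factors `1 + M/r` already multiply to at least 2;
    -- `steps` is `M` such groups.
    2^M≤2τ : ι 2 ^ M ≤ τ + τ
    2^M≤2τ = begin
      ι 2 ^ M                           ≤⟨ ^-monoˡ-≤ M (0≤ι 2) 2≤z^ ⟩
      (z ^ suc (r ℕ./ M)) ^ M           ≡⟨ ^-assocʳ z (suc (r ℕ./ M)) M ⟩
      z ^ steps                         ≤⟨ chebyshevℚ-growth z v steps zv≡1 0≤v ⟩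
      τ + τ                             ∎
      where
      open ≤-Reasoning
      2≤z^ : ι 2 ≤ z ^ suc (r ℕ./ M)
      2≤z^ = begin
        1ℚ + 1ℚ                               ≡⟨ cong (1ℚ +_) (sym rρ≡1) ⟩
        1ℚ + ι r * ρ                          ≤⟨ +-monoʳ-≤ 1ℚ (*-monoʳ-≤-0≤ ρ 0≤ρ (ι-mono-≤ r≤steps)) ⟩
        1ℚ + ι steps * ρ                      ≡⟨ cong (λ m → 1ℚ + m * ρ) (ι-* (suc (r ℕ./ M)) M) ⟩
        1ℚ + ι (suc (r ℕ./ M)) * ι M * ρ      ≡⟨ cong (1ℚ +_) (*-assoc (ι (suc (r ℕ./ M))) (ι M) ρ) ⟩
        1ℚ + ι (suc (r ℕ./ M)) * b            ≤⟨ bernoulli b (suc (r ℕ./ M)) 0≤b ⟩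
        z ^ suc (r ℕ./ M)                     ∎

    1≤τ : 1ℚ ≤ τ
    1≤τ = *-cancelˡ-≤-0< (ι 2) (0<ι {2} (ℕ.s≤s ℕ.z≤n)) (begin
      ι 2 * 1ℚ     ≡⟨⟩
      ι 2 ^ 1      ≤⟨ ^-monoʳ-≤ (ι-mono-≤ {1} {2} (ℕ.s≤s ℕ.z≤n)) 1≤M ⟩
      ι 2 ^ M      ≤⟨ 2^M≤2τ ⟩
      τ + τ        ≡⟨ solve 1 (λ t → t :+ t := con (ι 2) :* t) refl τ ⟩
      ι 2 * τ      ∎)
      where
      open ≤-Reasoning
      open +-*-Solver

  -- The degree is 5 = 1 + 2 · 2 times `r`: the tuple itself, plus two exchanges in each of at most
  -- `2 r` steps. The error is 2 / 2^M because `τ` is only known to be at least half of `2 ^ M`.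
  approximation : ∀ ℓ k r M (φ : CNF ℓ) → HasWidthAtMost φ k → 1 ℕ.≤ ℓ → 1 ℕ.≤ k → 1 ℕ.≤ M →
    M ℕ.* M ℕ.* (4 ℕ.* ℓ) ℕ.^ k ℕ.≤ r ℕ.^ suc k →
    ∃[ F ] (IsPoly (5 ℕ.* r) (ι 32 ^ (5 ℕ.* r)) F
      × (∀ x → evalCNF φ x ≡ true → F x ≡ 1ℚ)
      × (∀ x → ∣ F x - ι (bit (evalCNF φ x)) ∣ * ι 2 ^ M ≤ ι 2))
  approximation ℓ k r M φ width 1≤ℓ 1≤k 1≤M large with 4 ℕ.* r ℕ.≤? ℓ
  ... | no 4r≰ℓ = F , poly-weaken ℓ≤5r bound (bounded-isPoly (λ x → ι-bit-bounded (evalCNF φ x)))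
      , (λ x → cong (ι ∘ bit))
      , (λ x → ≤-trans (≤-reflexive (trans (cong (λ p → ∣ p ∣ * ι 2 ^ M) (+-inverseʳ (F x))) (*-zeroˡ (ι 2 ^ M)))) (0≤ι 2))
    where
    F : Cube ℓ → ℚ
    F x = ι (bit (evalCNF φ x))
    ℓ≤5r : ℓ ℕ.≤ 5 ℕ.* r
    ℓ≤5r = ℕ.≤-trans (ℕ.<⇒≤ (ℕ.≰⇒> 4r≰ℓ)) (ℕ.*-monoˡ-≤ r {4} {5} (ℕ.n≤1+n 4))
    bound : 3ℚ ^ ℓ ≤ ι 32 ^ (5 ℕ.* r)
    bound = ≤-trans (^-monoʳ-≤ 1≤3 ℓ≤5r) (^-monoˡ-≤ (5 ℕ.* r) (0≤ι 3) (ι-mono-≤ {3} {32} (ℕ.m≤m+n 3 29)))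
  ... | yes 4r≤ℓ = F , poly-weaken degree≤ norm≤ (poly-* q (chebyshev-isPoly cr≤2 steps)) , sat
      , (λ x → error x (evalCNF φ x) refl)
    where
    open Parameters ℓ k r M 1≤ℓ 1≤k 1≤M 4r≤ℓ large
    open ProductSpace ℓ w 0≤w w*ℓ≡1
    open Hitting ℓ w 0≤w w*ℓ≡1
    open Amplified ℓ w 0≤w w*ℓ≡1 r c φ
    q = proj₁ (reciprocal τ (<-≤-trans 0<1 1≤τ))
    τq≡1 : τ * q ≡ 1ℚ
    τq≡1 = proj₁ (proj₂ (reciprocal τ (<-≤-trans 0<1 1≤τ)))
    0≤q : 0ℚ ≤ q
    0≤q = <⇒≤ (proj₂ (proj₂ (reciprocal τ (<-≤-trans 0<1 1≤τ))))
    q≤1 : q ≤ 1ℚ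
    q≤1 = ≤-trans (≤-reflexive (sym (*-identityˡ q))) (≤-trans (*-monoʳ-≤-0≤ q 0≤q 1≤τ) (≤-reflexive τq≡1))

    F : Cube ℓ → ℚ
    F x = q * 𝔼 r (T steps x)

    degree≤ : r ℕ.+ steps ℕ.* 2 ℕ.≤ 5 ℕ.* r
    degree≤ = ℕ.≤-trans (ℕ.+-monoʳ-≤ r (ℕ.*-monoˡ-≤ 2 steps≤2r))
      (ℕ.≤-reflexive (solve 1 (λ r → r :+ con 2 :* r :* con 2 := con 5 :* r) refl r))
      where open ℕ.+-*-Solver

    norm≤ : ∣ q ∣ * (3ℚ ^ r * ι 43 ^ steps) ≤ ι 32 ^ (5 ℕ.* r)
    norm≤ = begin
      ∣ q ∣ * (3ℚ ^ r * ι 43 ^ steps)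
        ≤⟨ *-monoʳ-≤-0≤ _ (0≤p*q (0≤3^n r) (0≤p^n steps (0≤ι 43))) (≤-trans (≤-reflexive (0≤p⇒∣p∣≡p 0≤q)) q≤1) ⟩
      1ℚ * (3ℚ ^ r * ι 43 ^ steps)
        ≡⟨ *-identityˡ _ ⟩
      3ℚ ^ r * ι 43 ^ steps
        ≤⟨ *-mono-≤ (0≤3^n r) (0≤p^n steps (0≤ι 43))
             (^-monoˡ-≤ r (0≤ι 3) (ι-mono-≤ {3} {32} (ℕ.m≤m+n 3 29)))
             -- A step raises the degree by 2 and so may multiply the norm by 32² = 1024, well above
             -- 43.
             (^-monoˡ-≤ steps (0≤ι 43) (ι-mono-≤ {43} {32 ℕ.^ 2} (ℕ.m≤m+n 43 981))) ⟩
      ι 32 ^ r * ι (32 ℕ.^ 2) ^ steps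
        ≡⟨ cong (ι 32 ^ r *_) (trans (cong (_^ steps) (ι-^ 32 2)) (trans (^-assocʳ (ι 32) 2 steps)
             (cong (ι 32 ^_) (ℕ.*-comm 2 steps)))) ⟩
      ι 32 ^ r * ι 32 ^ (steps ℕ.* 2)
        ≡⟨ sym (^-homo-* (ι 32) r (steps ℕ.* 2)) ⟩
      ι 32 ^ (r ℕ.+ steps ℕ.* 2)
        ≤⟨ ^-monoʳ-≤ (ι-mono-≤ {1} {32} (ℕ.m≤m+n 1 31)) degree≤ ⟩
      ι 32 ^ (5 ℕ.* r) ∎
      where open ≤-Reasoning

    sat : ∀ x → evalCNF φ x ≡ true → F x ≡ 1ℚ
    sat x holds = trans (cong (q *_) (trans (chebyshev-sat steps x holds) (cong (λ β → proj₁ (chebyshevℚ β steps)) cr≡β)))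
      (trans (*-comm q τ) τq≡1)

    error : ∀ x b → evalCNF φ x ≡ b → ∣ F x - ι (bit b) ∣ * ι 2 ^ M ≤ ι 2
    error x true holds = ≤-trans (≤-reflexive (trans (cong (λ p → ∣ p - 1ℚ ∣ * ι 2 ^ M) (sat x holds)) (*-zeroˡ (ι 2 ^ M)))) (0≤ι 2)
    error x false fails = begin
      ∣ F x - 0ℚ ∣ * ι 2 ^ M
        ≡⟨ cong (λ p → ∣ p ∣ * ι 2 ^ M) (+-identityʳ (F x)) ⟩
      ∣ F x ∣ * ι 2 ^ M
        ≡⟨ cong (_* ι 2 ^ M) (trans (∣p*q∣≡∣p∣*∣q∣ q (𝔼 r (T steps x))) (cong (_* ∣ 𝔼 r (T steps x) ∣) (0≤p⇒∣p∣≡p 0≤q))) ⟩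
      q * ∣ 𝔼 r (T steps x) ∣ * ι 2 ^ M
        ≤⟨ *-mono-≤ (0≤p*q 0≤q (0≤∣p∣ (𝔼 r (T steps x)))) (0≤p^n M (0≤ι 2))
             (*-monoˡ-≤-0≤ q 0≤q (chebyshev-unsat k μ width hits μ<1 μ<r 0≤c cκ≤1 steps x fails)) 2^M≤2τ ⟩
      q * 1ℚ * (τ + τ)
        ≡⟨ solve 2 (λ q t → q :* con 1ℚ :* (t :+ t) := con (ι 2) :* (t :* q)) refl q τ ⟩
      ι 2 * (τ * q)
        ≡⟨ trans (cong (ι 2 *_) τq≡1) (*-identityʳ (ι 2)) ⟩
      ι 2 ∎
      where
      open ≤-Reasoning
      open +-*-Solver
      hits : ∀ T → weight T ℕ.≤ k → μ ≤ hitProb r T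
      hits T T≤k = ≤-trans μ≤[rw/4]^k (hitProb-lower r k T 1≤r 2k≤r 4r≤ℓ T≤k)

-- Order and arithmetic of the Cauchy reals.

module Real where
  open import Defs
  open Rat using (ι; p≡q+s⇒q≤p; p≤q⇒0≤q-p; *-monoʳ-≤-0≤; *-monoˡ-≤-0≤; 0<1; 0≤1; p≤∣p∣;
    round-up; archimedean) renaming (_^_ to _ℚ^_)
  open import Data.Integer.Base using (+_)
  open import Data.Nat.Base as ℕ using (ℕ; zero; suc)
  import Data.Nat.Properties as ℕ
  open import Data.Product.Base using (_×_; _,_; proj₁; proj₂; ∃-syntax)
  open import Data.Rational.Base as ℚ using (ℚ; 0ℚ; 1ℚ; ½)
  import Data.Rational.Properties as ℚ
  open import Data.Rational.Solver using (module +-*-Solver)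
  open import Data.Sum.Base using (inj₁; inj₂)
  open import Data.Empty using (⊥-elim)
  open import Relation.Binary.PropositionalEquality using (_≡_; refl; sym; trans; cong; subst)
  open import Relation.Binary.Bundles using (Preorder)
  import Relation.Binary.Reasoning.Preorder as PreorderReasoning
  open import Relation.Nullary.Decidable.Core using (yes; no)
  open import Relation.Nullary.Negation.Core using (¬_)

  eventually-map : ∀ {P Q : ℕ → Set} → (∀ n → P n → Q n) → Eventually P → Eventually Q
  eventually-map f (N , p) = N , λ n N≤n → f n (p n N≤n)

  eventually-∧ : ∀ {P Q : ℕ → Set} → Eventually P → Eventually Q → Eventually (λ n → P n × Q n)
  eventually-∧ (N , p) (M , q) = N ℕ.⊔ M , λ n N⊔M≤n →
    p n (ℕ.≤-trans (ℕ.m≤m⊔n N M) N⊔M≤n) , q n (ℕ.≤-trans (ℕ.m≤n⊔m N M) N⊔M≤n)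

  p<p+q : ∀ p {q} → 0ℚ ℚ.< q → p ℚ.< p ℚ.+ q
  p<p+q p {q} 0<q = subst (ℚ._< p ℚ.+ q) (ℚ.+-identityʳ p) (ℚ.+-monoʳ-< p 0<q)

  p≡[p-q]+q : ∀ p q → p ≡ (p ℚ.- q) ℚ.+ q
  p≡[p-q]+q = solve 2 (λ p q → p := (p :- q) :+ q) refl
    where open +-*-Solver

  ∣p-q∣<δ⇒p<q+δ : ∀ {p q δ} → ℚ.∣ p ℚ.- q ∣ ℚ.< δ → p ℚ.< q ℚ.+ δ
  ∣p-q∣<δ⇒p<q+δ {p} {q} {δ} h = begin-strict
    p                        ≡⟨ trans (p≡[p-q]+q p q) (ℚ.+-comm _ q) ⟩
    q ℚ.+ (p ℚ.- q)          ≤⟨ ℚ.+-monoʳ-≤ q (p≤∣p∣ (p ℚ.- q)) ⟩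
    q ℚ.+ ℚ.∣ p ℚ.- q ∣      <⟨ ℚ.+-monoʳ-< q h ⟩
    q ℚ.+ δ                  ∎
    where open ℚ.≤-Reasoning

  ∣p-q∣≡∣q-p∣ : ∀ p q → ℚ.∣ p ℚ.- q ∣ ≡ ℚ.∣ q ℚ.- p ∣
  ∣p-q∣≡∣q-p∣ p q = trans (sym (ℚ.∣-p∣≡∣p∣ (p ℚ.- q)))
    (cong ℚ.∣_∣ (solve 2 (λ p q → :- (p :- q) := q :- p) refl p q))
    where open +-*-Solver

  ≈-sym : ∀ {x y} → x ≈ y → y ≈ x
  ≈-sym {x} {y} (mk≈ h) = mk≈ λ δ 0<δ →
    eventually-map (λ n → subst (ℚ._< δ) (∣p-q∣≡∣q-p∣ (seq x n) (seq y n))) (h δ 0<δ)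

  ≈⇒≤ : ∀ {x y} → x ≈ y → x ≤ y
  ≈⇒≤ (mk≈ h) = mk≤ λ δ 0<δ → eventually-map (λ n → ∣p-q∣<δ⇒p<q+δ) (h δ 0<δ)

  ≗⇒≈ : ∀ {x y} → (∀ n → seq x n ≡ seq y n) → x ≈ y
  ≗⇒≈ {x} {y} x≗y = mk≈ λ δ 0<δ → 0 , λ n _ →
    subst (ℚ._< δ) (sym (trans (cong (λ p → ℚ.∣ p ℚ.- seq y n ∣) (x≗y n)) (cong ℚ.∣_∣ (ℚ.+-inverseʳ (seq y n))))) 0<δ

  seq-≤ : ∀ {x y} → (∀ n → seq x n ℚ.≤ seq y n) → x ≤ y
  seq-≤ {x} {y} x≤y = mk≤ λ δ 0<δ → 0 , λ n _ → ℚ.≤-<-trans (x≤y n) (p<p+q (seq y n) 0<δ)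

  ≗⇒≤ : ∀ {x y} → (∀ n → seq x n ≡ seq y n) → x ≤ y
  ≗⇒≤ x≗y = seq-≤ (λ n → ℚ.≤-reflexive (x≗y n))

  ≤-trans : ∀ {x y z} → x ≤ y → y ≤ z → x ≤ z
  ≤-trans {x} {y} {z} (mk≤ p) (mk≤ q) = mk≤ λ δ 0<δ →
    eventually-map (λ n (u , v) → begin-strict
      seq x n                              <⟨ u ⟩
      seq y n ℚ.+ ½ ℚ.* δ                  <⟨ ℚ.+-monoˡ-< (½ ℚ.* δ) v ⟩
      seq z n ℚ.+ ½ ℚ.* δ ℚ.+ ½ ℚ.* δ      ≡⟨ trans (ℚ.+-assoc (seq z n) _ _) (cong (seq z n ℚ.+_) (halves δ)) ⟩
      seq z n ℚ.+ δ                        ∎)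
      (eventually-∧ (p (½ ℚ.* δ) (half-pos 0<δ)) (q (½ ℚ.* δ) (half-pos 0<δ)))
    where open ℚ.≤-Reasoning

  +-mono-≤ : ∀ {x y z w} → x ≤ y → z ≤ w → x + z ≤ y + w
  +-mono-≤ {x} {y} {z} {w} (mk≤ p) (mk≤ q) = mk≤ λ δ 0<δ →
    eventually-map (λ n (u , v) → begin-strict
      seq x n ℚ.+ seq z n                                       <⟨ ℚ.+-mono-< u v ⟩
      (seq y n ℚ.+ ½ ℚ.* δ) ℚ.+ (seq w n ℚ.+ ½ ℚ.* δ)           ≡⟨ regroup (seq y n) (½ ℚ.* δ) (seq w n) ⟩
      (seq y n ℚ.+ seq w n) ℚ.+ (½ ℚ.* δ ℚ.+ ½ ℚ.* δ)           ≡⟨ cong (seq y n ℚ.+ seq w n ℚ.+_) (halves δ) ⟩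
      seq y n ℚ.+ seq w n ℚ.+ δ                                 ∎)
      (eventually-∧ (p (½ ℚ.* δ) (half-pos 0<δ)) (q (½ ℚ.* δ) (half-pos 0<δ)))
    where
    open ℚ.≤-Reasoning
    open +-*-Solver
    regroup : ∀ y h w → (y ℚ.+ h) ℚ.+ (w ℚ.+ h) ≡ (y ℚ.+ w) ℚ.+ (h ℚ.+ h)
    regroup = solve 3 (λ y h w → (y :+ h) :+ (w :+ h) := (y :+ w) :+ (h :+ h)) refl

  fromℚ-mono : ∀ {p q} → p ℚ.≤ q → fromℚ p ≤ fromℚ q
  fromℚ-mono p≤q = seq-≤ (λ _ → p≤q)

  fromℚ-cancel : ∀ {p q} → fromℚ p ≤ fromℚ q → p ℚ.≤ q
  fromℚ-cancel {p} {q} (mk≤ h) with p ℚ.≤? q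
  ... | yes p≤q = p≤q
  ... | no p≰q with h (p ℚ.- q) (subst (ℚ._< p ℚ.- q) (ℚ.+-inverseʳ q) (ℚ.+-monoˡ-< (ℚ.- q) (ℚ.≰⇒> p≰q)))
  ...   | N , below = ⊥-elim (ℚ.<-irrefl (trans (p≡[p-q]+q p q) (ℚ.+-comm _ q)) (below N ℕ.≤-refl))

  -- Terms of `z` may be slightly negative although the limit is not. At nonnegative terms, the
  -- error in `x ≤ y` is scaled by a bound on `z`; at the others, `- z` is tiny and is scaled by a
  -- bound on `x - y`.
  *-monoʳ-≤ : ∀ {x y} z → 0ℝ ≤ z → x ≤ y → x * z ≤ y * z
  *-monoʳ-≤ {x} {y} z (mk≤ 0≤z) (mk≤ x≤y) = mk≤ λ δ 0<δ →
    let (B , 0≤B , bz) = cauchy⇒bounded (seq z) (cauchy z)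
        (E , 0≤E , bd) = cauchy⇒bounded (seq (x - y)) (cauchy (x - y))
        (η , 0<η , Bη<δ) = scale B 0≤B δ 0<δ
        (θ , 0<θ , Eθ<δ) = scale E 0≤E δ 0<δ
    in eventually-map (λ n ((z≤B , d≤E) , (x<y+η , 0<z+θ)) →
         product (seq x n) (seq y n) (seq z n) 0≤E (ℚ.<⇒≤ 0<η) z≤B d≤E x<y+η 0<z+θ Bη<δ Eθ<δ)
       (eventually-∧ (eventually-∧ bz bd) (eventually-∧ (x≤y η 0<η) (0≤z θ 0<θ)))
    where
    open +-*-Solver
    product : ∀ x y z {B E η θ δ} → 0ℚ ℚ.≤ E → 0ℚ ℚ.≤ η → ℚ.∣ z ∣ ℚ.≤ B → ℚ.∣ x ℚ.- y ∣ ℚ.≤ E →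
      x ℚ.< y ℚ.+ η → 0ℚ ℚ.< z ℚ.+ θ → B ℚ.* η ℚ.< δ → E ℚ.* θ ℚ.< δ → x ℚ.* z ℚ.< y ℚ.* z ℚ.+ δ
    product x y z {B} {E} {η} {θ} {δ} 0≤E 0≤η z≤B d≤E x<y+η 0<z+θ Bη<δ Eθ<δ with ℚ.≤-total 0ℚ z
    ... | inj₁ 0≤z = begin-strict
      x ℚ.* z                    ≤⟨ *-monoʳ-≤-0≤ z 0≤z (ℚ.<⇒≤ x<y+η) ⟩
      (y ℚ.+ η) ℚ.* z            ≡⟨ solve 3 (λ y η z → (y :+ η) :* z := y :* z :+ z :* η) refl y η z ⟩
      y ℚ.* z ℚ.+ z ℚ.* η        ≤⟨ ℚ.+-monoʳ-≤ (y ℚ.* z) (*-monoʳ-≤-0≤ η 0≤η (ℚ.≤-trans (p≤∣p∣ z) z≤B)) ⟩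
      y ℚ.* z ℚ.+ B ℚ.* η        <⟨ ℚ.+-monoʳ-< (y ℚ.* z) Bη<δ ⟩
      y ℚ.* z ℚ.+ δ              ∎
      where open ℚ.≤-Reasoning
    ... | inj₂ z≤0 = begin-strict
      x ℚ.* z                                    ≡⟨ solve 3 (λ x y z → x :* z := y :* z :+ (y :- x) :* (:- z)) refl x y z ⟩
      y ℚ.* z ℚ.+ (y ℚ.- x) ℚ.* (ℚ.- z)          ≤⟨ ℚ.+-monoʳ-≤ (y ℚ.* z) (*-monoʳ-≤-0≤ (ℚ.- z) (ℚ.neg-antimono-≤ z≤0) y-x≤E) ⟩
      y ℚ.* z ℚ.+ E ℚ.* (ℚ.- z)                  ≤⟨ ℚ.+-monoʳ-≤ (y ℚ.* z) (*-monoˡ-≤-0≤ E 0≤E -z≤θ) ⟩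
      y ℚ.* z ℚ.+ E ℚ.* θ                        <⟨ ℚ.+-monoʳ-< (y ℚ.* z) Eθ<δ ⟩
      y ℚ.* z ℚ.+ δ                              ∎
      where
      open ℚ.≤-Reasoning
      y-x≤E : y ℚ.- x ℚ.≤ E
      y-x≤E = ℚ.≤-trans (p≤∣p∣ (y ℚ.- x)) (ℚ.≤-trans (ℚ.≤-reflexive (∣p-q∣≡∣q-p∣ y x)) d≤E)
      -z≤θ : ℚ.- z ℚ.≤ θ
      -z≤θ = p≡q+s⇒q≤p (z ℚ.+ θ) (ℚ.<⇒≤ 0<z+θ) (solve 2 (λ z θ → θ := :- z :+ (z :+ θ)) refl z θ)

  *-monoˡ-≤ : ∀ {x y} z → 0ℝ ≤ z → x ≤ y → z * x ≤ z * y
  *-monoˡ-≤ {x} {y} z 0≤z x≤y = ≤-trans (≗⇒≤ (λ n → ℚ.*-comm (seq z n) (seq x n)))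
    (≤-trans (*-monoʳ-≤ z 0≤z x≤y) (≗⇒≤ (λ n → ℚ.*-comm (seq y n) (seq z n))))

  *-mono-≤ : ∀ {x y z w} → 0ℝ ≤ y → 0ℝ ≤ z → x ≤ y → z ≤ w → x * z ≤ y * w
  *-mono-≤ {y = y} {z} 0≤y 0≤z x≤y z≤w = ≤-trans (*-monoʳ-≤ z 0≤z x≤y) (*-monoˡ-≤ y 0≤y z≤w)

  0≤x*y : ∀ {x y} → 0ℝ ≤ x → 0ℝ ≤ y → 0ℝ ≤ x * y
  0≤x*y {x} {y} 0≤x 0≤y = ≤-trans (≗⇒≤ (λ n → sym (ℚ.*-zeroˡ (seq y n)))) (*-monoʳ-≤ y 0≤y 0≤x)

  0≤fromℕ : ∀ n → 0ℝ ≤ fromℕ n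
  0≤fromℕ n = fromℚ-mono (Rat.0≤ι n)

  0≤1ℝ : 0ℝ ≤ 1ℝ
  0≤1ℝ = fromℚ-mono 0≤1

  0≤x^n : ∀ {x} n → 0ℝ ≤ x → 0ℝ ≤ x ^ n
  0≤x^n zero    0≤x = 0≤1ℝ
  0≤x^n (suc n) 0≤x = 0≤x*y 0≤x (0≤x^n n 0≤x)

  ≤-refl : ∀ {x} → x ≤ x
  ≤-refl = seq-≤ (λ _ → ℚ.≤-refl)

  infix 4 _≗_

  -- Algebraic identities hold term by term and are left to the rational ring solver, so a chain of
  -- inequalities appeals to `_≈_` only where a hypothesis supplies it.
  _≗_ : ℝ → ℝ → Set
  x ≗ y = ∀ n → seq x n ≡ seq y n

  ≤-preorder : Preorder _ _ _
  ≤-preorder = record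
    { Carrier    = ℝ
    ; _≈_        = _≗_
    ; _≲_        = _≤_
    ; isPreorder = record
      { isEquivalence = record
        { refl  = λ n → refl
        ; sym   = λ x≗y n → sym (x≗y n)
        ; trans = λ x≗y y≗z n → trans (x≗y n) (y≗z n)
        }
      ; reflexive = ≗⇒≤
      ; trans     = ≤-trans
      }
    }

  module ℝ-Reasoning = PreorderReasoning ≤-preorder

  ^-monoˡ-≤ : ∀ {x y} n → 0ℝ ≤ x → x ≤ y → x ^ n ≤ y ^ n
  ^-monoˡ-≤ zero    0≤x x≤y = ≤-refl
  ^-monoˡ-≤ (suc n) 0≤x x≤y = *-mono-≤ (≤-trans 0≤x x≤y) (0≤x^n n 0≤x) x≤y (^-monoˡ-≤ n 0≤x x≤y)

  seq-^ : ∀ x m n → seq (x ^ m) n ≡ seq x n ℚ^ m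
  seq-^ x zero    n = refl
  seq-^ x (suc m) n = cong (seq x n ℚ.*_) (seq-^ x m n)

  x≤x+y : ∀ {x y} → 0ℝ ≤ y → x ≤ x + y
  x≤x+y {x} {y} 0≤y = ≤-trans (≗⇒≤ (λ n → sym (ℚ.+-identityʳ (seq x n)))) (+-mono-≤ (≤-refl {x}) 0≤y)

  <⇒≤ : ∀ {x y} → x < y → x ≤ y
  <⇒≤ {x} {y} (mk< g 0<g sep) = mk≤ λ δ 0<δ → eventually-map
    (λ n x+g<y → ℚ.<-trans (p<p+q (seq x n) 0<g) (ℚ.<-trans x+g<y (p<p+q (seq y n) 0<δ))) sep

  -- Beyond some index `N` both sequences move by less than δ/8, so one decidable comparison of
  -- rationals at `N` settles all later terms: either `x` stays below `y + δ`, or a permanent gap of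
  -- δ/8 contradicts the hypothesis.
  ≮⇒≥ : ∀ {x y} → ¬ (y < x) → x ≤ y
  ≮⇒≥ {x} {y} y≮x = mk≤ λ δ 0<δ → decide δ 0<δ (eventually-∧ (oscillation x δ 0<δ) (oscillation y δ 0<δ))
    where
    open ℚ.≤-Reasoning
    open +-*-Solver
    eighth : ℚ → ℚ
    eighth δ = ½ ℚ.* (½ ℚ.* (½ ℚ.* δ))
    0<eighth : ∀ {δ} → 0ℚ ℚ.< δ → 0ℚ ℚ.< eighth δ
    0<eighth 0<δ = half-pos (half-pos (half-pos 0<δ))
    Stable : ℝ → ℚ → ℕ → Set
    Stable x e n = ∀ m → n ℕ.≤ m → ℚ.∣ seq x m ℚ.- seq x n ∣ ℚ.< e
    oscillation : ∀ x δ → 0ℚ ℚ.< δ → Eventually (Stable x (eighth δ))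
    oscillation x δ 0<δ with cauchy x (eighth δ) (0<eighth 0<δ)
    ... | N , p = N , λ n N≤n m n≤m → p m n (ℕ.≤-trans N≤n n≤m) N≤n
    upper : ∀ x {e n} → Stable x e n → ∀ m → n ℕ.≤ m → seq x m ℚ.< seq x n ℚ.+ e
    upper x h m n≤m = ∣p-q∣<δ⇒p<q+δ (h m n≤m)
    lower : ∀ x {e n} → Stable x e n → ∀ m → n ℕ.≤ m → seq x n ℚ.< seq x m ℚ.+ e
    lower x {e} {n} h m n≤m = ∣p-q∣<δ⇒p<q+δ (subst (ℚ._< e) (∣p-q∣≡∣q-p∣ (seq x m) (seq x n)) (h m n≤m))
    decide : ∀ δ → 0ℚ ℚ.< δ → Eventually (λ n → Stable x (eighth δ) n × Stable y (eighth δ) n) →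
      Eventually (λ n → seq x n ℚ.< seq y n ℚ.+ δ)
    decide δ 0<δ (N , stable) with seq x N ℚ.≤? seq y N ℚ.+ ½ ℚ.* δ
    ... | yes close = N , λ m N≤m → begin-strict
      seq x m                                 <⟨ upper x stable-x m N≤m ⟩
      seq x N ℚ.+ e                           ≤⟨ ℚ.+-monoˡ-≤ e close ⟩
      seq y N ℚ.+ ½ ℚ.* δ ℚ.+ e               <⟨ ℚ.+-monoˡ-< e (ℚ.+-monoˡ-< (½ ℚ.* δ) (lower y stable-y m N≤m)) ⟩
      seq y m ℚ.+ e ℚ.+ ½ ℚ.* δ ℚ.+ e         <⟨ p<p+q _ (half-pos (half-pos 0<δ)) ⟩
      seq y m ℚ.+ e ℚ.+ ½ ℚ.* δ ℚ.+ e ℚ.+ ½ ℚ.* (½ ℚ.* δ)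
        ≡⟨ solve 2 (λ y δ → let e = con ½ :* (con ½ :* (con ½ :* δ)) in
             y :+ e :+ con ½ :* δ :+ e :+ con ½ :* (con ½ :* δ) := y :+ δ) refl (seq y m) δ ⟩
      seq y m ℚ.+ δ                           ∎
      where
      e = eighth δ
      stable-x = proj₁ (stable N ℕ.≤-refl)
      stable-y = proj₂ (stable N ℕ.≤-refl)
    ... | no far = ⊥-elim (y≮x (mk< e (0<eighth 0<δ) (N , separated)))
      where
      e = eighth δ
      separated : ∀ n → N ℕ.≤ n → seq y n ℚ.+ e ℚ.< seq x n
      separated n N≤n = begin-strict
        seq y n ℚ.+ e                         <⟨ ℚ.+-monoˡ-< e (upper y (proj₂ (stable N ℕ.≤-refl)) n N≤n) ⟩
        seq y N ℚ.+ e ℚ.+ e                   <⟨ p<p+q _ (0<eighth 0<δ) ⟩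
        seq y N ℚ.+ e ℚ.+ e ℚ.+ e
          ≡⟨ solve 2 (λ y δ → let e = con ½ :* (con ½ :* (con ½ :* δ)) in
               y :+ e :+ e :+ e := y :+ con ½ :* δ :- e) refl (seq y N) δ ⟩
        seq y N ℚ.+ ½ ℚ.* δ ℚ.- e             <⟨ ℚ.+-monoˡ-< (ℚ.- e) (ℚ.≰⇒> far) ⟩
        seq x N ℚ.- e                         <⟨ ℚ.+-monoˡ-< (ℚ.- e) (lower x (proj₁ (stable N ℕ.≤-refl)) n N≤n) ⟩
        seq x n ℚ.+ e ℚ.- e                   ≡⟨ solve 2 (λ x e → x :+ e :- e := x) refl (seq x n) e ⟩
        seq x n                               ∎

  -- If `y < 1`, then `y ^ suc n ≤ y`, and the hypothesis gives `1 ≤ y` after all.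
  1≤root : ∀ {y} n → 0ℝ ≤ y → 1ℝ ≤ y ^ suc n → 1ℝ ≤ y
  1≤root {y} n 0≤y 1≤y^n+1 = ≮⇒≥ λ y<1 → 1≰ y<1 (≤-trans 1≤y^n+1
    (≤-trans (*-monoˡ-≤ y 0≤y (≤-trans (^-monoˡ-≤ n 0≤y (<⇒≤ y<1)) (≗⇒≤ {y = 1ℝ} (λ m → trans (seq-^ 1ℝ n m) (Rat.1^n≡1 n)))))
      (≗⇒≤ {y * 1ℝ} {y} (λ m → ℚ.*-identityʳ (seq y m)))))
    where
    1≰ : y < 1ℝ → ¬ (1ℝ ≤ y)
    1≰ (mk< g 0<g (N , sep)) (mk≤ 1≤y) with 1≤y g 0<g
    ... | M , below = ℚ.<-irrefl refl (ℚ.<-trans (below (N ℕ.⊔ M) (ℕ.m≤n⊔m N M)) (sep (N ℕ.⊔ M) (ℕ.m≤m⊔n N M)))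

  -- The 2 consists of ½ to get above all later terms of the sequence, ½ to return to them, and 1
  -- for rounding up.
  natural-above : ∀ x → 0ℝ ≤ x → ∃[ N ] (x ≤ fromℕ N × fromℕ N ≤ x + fromℕ 2)
  natural-above x (mk≤ 0≤x) with cauchy x ½ (ℚ.positive⁻¹ ½) | 0≤x ½ (ℚ.positive⁻¹ ½)
  ... | N₀ , p | N₁ , q = N , x≤N , N≤x+2
    where
    open ℚ.≤-Reasoning
    open +-*-Solver
    a = seq x N₀ ℚ.+ ½
    n₁ = N₀ ℕ.⊔ N₁
    x≤a : ∀ n → N₀ ℕ.≤ n → seq x n ℚ.< a
    x≤a n N₀≤n = ∣p-q∣<δ⇒p<q+δ (p n N₀ N₀≤n ℕ.≤-refl)
    -1≤a : ℚ.- 1ℚ ℚ.≤ a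
    -1≤a = p≡q+s⇒q≤p (½ ℚ.+ (½ ℚ.+ a)) (ℚ.<⇒≤ (ℚ.+-mono-< (ℚ.positive⁻¹ ½) (ℚ.<-trans (q n₁ (ℕ.m≤n⊔m N₀ N₁))
        (subst (ℚ._< ½ ℚ.+ a) (ℚ.+-comm ½ (seq x n₁)) (ℚ.+-monoʳ-< ½ (x≤a n₁ (ℕ.m≤m⊔n N₀ N₁)))))))
      (solve 1 (λ a → a := (:- con 1ℚ) :+ (con ½ :+ (con ½ :+ a))) refl a)
    rounded = round-up (proj₁ (archimedean a)) a -1≤a (proj₂ (archimedean a))
    N = proj₁ rounded
    x≤N : x ≤ fromℕ N
    x≤N = mk≤ λ δ 0<δ → N₀ , λ n N₀≤n → ℚ.<-trans
      (ℚ.<-≤-trans (x≤a n N₀≤n) (proj₁ (proj₂ rounded))) (p<p+q (ι N) 0<δ)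
    N≤x+2 : fromℕ N ≤ x + fromℕ 2
    N≤x+2 = mk≤ λ δ 0<δ → N₀ , λ n N₀≤n → begin-strict
      ι N                                   ≤⟨ proj₂ (proj₂ rounded) ⟩
      1ℚ ℚ.+ (seq x N₀ ℚ.+ ½)               <⟨ ℚ.+-monoʳ-< 1ℚ (ℚ.+-monoˡ-< ½ {seq x N₀} {seq x n ℚ.+ ½} (∣p-q∣<δ⇒p<q+δ {seq x N₀} {seq x n} {½} (p N₀ n ℕ.≤-refl N₀≤n))) ⟩
      1ℚ ℚ.+ (seq x n ℚ.+ ½ ℚ.+ ½)          ≡⟨ solve 1 (λ x → con 1ℚ :+ (x :+ con ½ :+ con ½) := x :+ con (ι 2)) refl (seq x n) ⟩
      seq x n ℚ.+ ι 2                       <⟨ p<p+q (seq x n ℚ.+ ι 2) 0<δ ⟩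
      seq x n ℚ.+ ι 2 ℚ.+ δ                 ∎

-- From the rational approximation to real polynomials, and the real parameters.

open import Defs
open Rat using (ι; ι-*; ι-^) renaming (_^_ to _ℚ^_)
open Multilinear using (Cube; bit; weight; mon; coef; sumCube; expansion; IsPoly; degree; norm; sumCube-cong)
open Choice using (approximation; ℕ^-distribʳ-*)
open Core using (reciprocal)
open Real
open import Data.Bool.Base using (Bool; true; false)
open import Data.Integer.Base using (+_)
open import Data.List.Base as List using (List; []; _∷_; _++_)
import Data.List.Properties as List
open import Data.List.Membership.Propositional using (_∈_)
open import Data.List.Membership.Propositional.Properties using (∈-map⁻)
open import Data.List.Relation.Unary.All as All using (All; []; _∷_)
import Data.List.Relation.Unary.All.Properties as All
open import Data.List.Relation.Unary.Unique.Propositional using (Unique)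
open import Data.List.Relation.Unary.AllPairs using ([]; _∷_)
import Data.List.Relation.Unary.Unique.Propositional.Properties as Unique
open import Data.Nat.Base as ℕ using (ℕ; zero; suc)
import Data.Nat.Properties as ℕ
open import Data.Product.Base using (_×_; _,_; proj₁; proj₂; ∃-syntax)
open import Data.Rational.Base as ℚ using (ℚ; 0ℚ; 1ℚ)
import Data.Rational.Properties as ℚ
open import Data.Rational.Solver using (module +-*-Solver)
open import Data.Unit.Base using (tt)
open import Data.Vec.Base as Vec using (Vec; []; _∷_)
import Data.Vec.Properties as Vec
open import Function.Base using (_∘_)
open import Relation.Binary.PropositionalEquality using (_≡_; refl; sym; trans; cong; cong₂; subst)
open import Relation.Nullary.Decidable.Core using (yes; no; toWitnessFalse)
open import Relation.Nullary.Negation.Core using (¬_; contradiction)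

-- Listed in the order in which `sumCube` recurses, so that both kinds of sum agree by structural
-- induction.
cubes : ∀ n → List (Cube n)
cubes zero    = [] ∷ []
cubes (suc n) = List.map (false ∷_) (cubes n) ++ List.map (true ∷_) (cubes n)

cubes-unique : ∀ n → Unique (cubes n)
cubes-unique zero    = [] ∷ []
cubes-unique (suc n) = Unique.++⁺
  (Unique.map⁺ Vec.∷-injectiveʳ (cubes-unique n)) (Unique.map⁺ Vec.∷-injectiveʳ (cubes-unique n)) disjoint
  where
  disjoint : ∀ {α} → ¬ (α ∈ List.map (false ∷_) (cubes n) × α ∈ List.map (true ∷_) (cubes n))
  disjoint (p , q) with ∈-map⁻ (false ∷_) p | ∈-map⁻ (true ∷_) q
  ... | _ , _ , refl | _ , _ , ()

exponent : ∀ {n} → Cube n → Exponent n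
exponent = Vec.map bit

exponent-injective : ∀ {n} {α β : Cube n} → exponent α ≡ exponent β → α ≡ β
exponent-injective {α = []}    {[]}    _  = refl
exponent-injective {α = a ∷ α} {b ∷ β} eq =
  cong₂ _∷_ (bit-injective (Vec.∷-injectiveˡ eq)) (exponent-injective (Vec.∷-injectiveʳ eq))
  where
  bit-injective : ∀ {a b} → bit a ≡ bit b → a ≡ b
  bit-injective {false} {false} _ = refl
  bit-injective {true}  {true}  _ = refl

term : ∀ {n} → (Cube n → ℚ) → Cube n → ℝ × Exponent n
term F α = fromℚ (coef F α) , exponent α

interpolation : ∀ {n} → (Cube n → ℚ) → Polynomial n
interpolation {n} F = record
  { terms    = List.map (term F) (cubes n)
  ; distinct = subst Unique (List.map-∘ (cubes n)) (Unique.map⁺ exponent-injective (cubes-unique n))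
  }

seq-sum-++ : ∀ xs ys n → seq (sumℝ (xs ++ ys)) n ≡ seq (sumℝ xs) n ℚ.+ seq (sumℝ ys) n
seq-sum-++ []       ys n = sym (ℚ.+-identityˡ _)
seq-sum-++ (x ∷ xs) ys n = trans (cong (seq x n ℚ.+_) (seq-sum-++ xs ys n)) (sym (ℚ.+-assoc (seq x n) _ _))

seq-sum-cubes : ∀ {m} (f : Cube m → ℝ) n → seq (sumℝ (List.map f (cubes m))) n ≡ sumCube (λ α → seq (f α) n)
seq-sum-cubes {zero}  f n = ℚ.+-identityʳ _
seq-sum-cubes {suc m} f n = trans
  (cong (λ xs → seq (sumℝ xs) n) (trans (List.map-++ f _ (List.map (true ∷_) (cubes m)))
    (cong₂ _++_ (sym (List.map-∘ (cubes m))) (sym (List.map-∘ (cubes m))))))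
  (trans (seq-sum-++ (List.map (f ∘ (false ∷_)) (cubes m)) _ n)
    (cong₂ ℚ._+_ (seq-sum-cubes (f ∘ (false ∷_)) n) (seq-sum-cubes (f ∘ (true ∷_)) n)))

seq-monomial : ∀ {m} (α x : Cube m) n → seq (monomial (exponent α) (Vec.map ⟦_⟧ x)) n ≡ mon α x
seq-monomial []          []      n = refl
seq-monomial (false ∷ α) (b ∷ x) n = trans (ℚ.*-identityˡ _) (seq-monomial α x n)
seq-monomial (true  ∷ α) (b ∷ x) n = cong₂ ℚ._*_ (value b) (seq-monomial α x n)
  where
  value : ∀ b → seq (⟦ b ⟧ ^ 1) n ≡ ι (bit b)
  value false = refl
  value true  = refl

seq-eval : ∀ {m} (F : Cube m → ℚ) x n → seq (eval (interpolation F) (Vec.map ⟦_⟧ x)) n ≡ F x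
seq-eval {m} F x n = trans (cong (λ xs → seq (sumℝ xs) n) (sym (List.map-∘ (cubes m))))
  (trans (seq-sum-cubes {m} _ n)
  (trans (sumCube-cong (λ α → cong (coef F α ℚ.*_) (seq-monomial α x n))) (expansion F x)))

seq-coefficientNorm : ∀ {m} (F : Cube m → ℚ) n →
  seq (coefficientNorm (interpolation F)) n ≡ sumCube (λ α → ℚ.∣ coef F α ∣)
seq-coefficientNorm {m} F n = trans (cong (λ xs → seq (sumℝ xs) n) (sym (List.map-∘ (cubes m)))) (seq-sum-cubes {m} _ n)

interpolation-degree : ∀ {m D N} {F : Cube m → ℚ} {d} → IsPoly D N F → fromℕ D ≤ d → HasDegreeAtMost (interpolation F) d
interpolation-degree {m} {D} {F = F} {d} p D≤d = All.map⁺ (All.universal bounded (cubes m))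
  where
  bounded : ∀ α → ¬ (fromℚ (coef F α) ≈ 0ℝ) → fromℕ (Vec.sum (exponent α)) ≤ d
  bounded α coef≉0 with weight α ℕ.≤? D
  ... | yes α≤D = ≤-trans (fromℚ-mono (Rat.ι-mono-≤ α≤D)) D≤d
  ... | no α≰D  = contradiction (≗⇒≈ (λ _ → degree p α (ℕ.≰⇒> α≰D))) coef≉0

seq-⟦⟧ : ∀ b n → seq ⟦ b ⟧ n ≡ ι (bit b)
seq-⟦⟧ false n = refl
seq-⟦⟧ true  n = refl

-- A smaller logarithm would give `ε⁻¹ ≤ 2`, and with `ε < 0.1` the product would be at most 1/5.
-- The bound lets additive constants be absorbed into multiples of `L`.
1≤log : ∀ {ε ε⁻¹ L} → 0ℝ < ε → ε < fromℚ (+ 1 ℚ./ 10) → ε * ε⁻¹ ≈ 1ℝ → IsLog₂ ε⁻¹ L → 1ℝ ≤ L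
1≤log {ε} {ε⁻¹} {L} 0<ε ε<0·1 inverse log = ≮⇒≥ λ L<1 →
  toWitnessFalse {a? = 1ℚ ℚ.≤? tenth ℚ.* ι 2} tt (fromℚ-cancel (1≤1/5 L<1))
  where
  open ℝ-Reasoning
  open +-*-Solver
  tenth = + 1 ℚ./ 10
  1≤1/5 : L < 1ℝ → fromℚ 1ℚ ≤ fromℚ (tenth ℚ.* ι 2)
  1≤1/5 L<1 = begin
    1ℝ                         ≲⟨ ≈⇒≤ (≈-sym inverse) ⟩
    ε * ε⁻¹                    ≲⟨ *-monoʳ-≤ ε⁻¹ (<⇒≤ (IsExponential.positive log)) (<⇒≤ ε<0·1) ⟩
    fromℚ tenth * ε⁻¹          ≲⟨ *-monoˡ-≤ (fromℚ tenth) (fromℚ-mono (ℚ.nonNegative⁻¹ tenth)) ε⁻¹≤2 ⟩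
    fromℚ tenth * fromℕ 2      ≈⟨ (λ n → refl) ⟩
    fromℚ (tenth ℚ.* ι 2)      ∎
    where
    L≤1 : fromℕ 0 + fromℕ 1 * L ≤ fromℕ 1
    L≤1 = begin
      fromℕ 0 + fromℕ 1 * L    ≈⟨ (λ n → solve 1 (λ x → con 0ℚ :+ con 1ℚ :* x := x) refl (seq L n)) ⟩
      L                        ≲⟨ <⇒≤ L<1 ⟩
      fromℕ 1                  ∎
    ε⁻¹≤2 : ε⁻¹ ≤ fromℕ 2
    ε⁻¹≤2 = begin
      ε⁻¹                      ≈⟨ (λ n → solve 1 (λ x → x := con 1ℚ :* (x :* con 1ℚ)) refl (seq ε⁻¹ n)) ⟩
      fromℕ 2 ^ 0 * ε⁻¹ ^ 1    ≲⟨ IsExponential.upper log 1 0 1 (ℕ.s≤s ℕ.z≤n) L≤1 ⟩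
      fromℕ 2 ^ 1              ≈⟨ (λ n → ℚ.*-identityʳ (ι 2)) ⟩
      fromℕ 2                  ∎

module Parameters (ℓ k : ℕ) (1≤ℓ : 1 ℕ.≤ ℓ) (L a b : ℝ) (1≤L : 1ℝ ≤ L)
  (powa : IsRationalPower (fromℕ ℓ) k (suc k) a) (powb : IsRationalPower L 2 (suc k) b) where

  open IsRationalPower
  open ℝ-Reasoning
  open +-*-Solver

  private
    0≤L : 0ℝ ≤ L
    0≤L = ≤-trans {0ℝ} {1ℝ} {L} 0≤1ℝ 1≤L

    0≤ab : 0ℝ ≤ a * b
    0≤ab = 0≤x*y (nonNegative powa) (nonNegative powb)

    ^-distrib : ∀ x y n → (x * y) ^ n ≗ x ^ n * y ^ n
    ^-distrib x y n m = trans (seq-^ (x * y) n m) (trans (Rat.^-distrib-* (seq x m) (seq y m) n)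
      (sym (cong₂ ℚ._*_ (seq-^ x n m) (seq-^ y n m))))

    fromℕ-^ : ∀ m n → fromℕ (m ℕ.^ n) ≗ fromℕ m ^ n
    fromℕ-^ m n i = trans (ι-^ m n) (sym (seq-^ (fromℕ m) n i))

    fromℕ-mono : ∀ {m n} → m ℕ.≤ n → fromℕ m ≤ fromℕ n
    fromℕ-mono m≤n = fromℚ-mono (Rat.ι-mono-≤ m≤n)

    ab-power : fromℕ ℓ ^ k * L ^ 2 ≤ (a * b) ^ suc k
    ab-power = begin
      fromℕ ℓ ^ k * L ^ 2          ≲⟨ *-monoʳ-≤ (L ^ 2) (0≤x^n 2 0≤L) (≈⇒≤ (≈-sym (power powa))) ⟩
      a ^ suc k * L ^ 2            ≲⟨ *-monoˡ-≤ (a ^ suc k) (0≤x^n (suc k) (nonNegative powa)) (≈⇒≤ (≈-sym (power powb))) ⟩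
      a ^ suc k * b ^ suc k        ≈⟨ (λ n → sym (^-distrib a b (suc k) n)) ⟩
      (a * b) ^ suc k              ∎

    -- Allows the error made in rounding `r` to a natural number to be charged to `a * b`.
    1≤ab : 1ℝ ≤ a * b
    1≤ab = 1≤root k 0≤ab (begin
      1ℝ                           ≲⟨ fromℚ-mono (Rat.ι-mono-≤ (ℕ.m^n>0 ℓ {{ℕ.>-nonZero 1≤ℓ}} k)) ⟩
      fromℕ (ℓ ℕ.^ k)              ≈⟨ (λ n → trans (fromℕ-^ ℓ k n) (sym (ℚ.*-identityʳ (seq (fromℕ ℓ ^ k) n)))) ⟩
      fromℕ ℓ ^ k * 1ℝ             ≈⟨ (λ n → refl) ⟩
      fromℕ ℓ ^ k * (1ℝ ^ 2)       ≲⟨ *-monoˡ-≤ (fromℕ ℓ ^ k) (0≤x^n k (0≤fromℕ ℓ)) (^-monoˡ-≤ 2 0≤1ℝ 1≤L) ⟩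
      fromℕ ℓ ^ k * L ^ 2          ≲⟨ ab-power ⟩
      (a * b) ^ suc k              ∎)

    -- The extra 1 in `M` absorbs the factor 2 in the error. The 16 in `r` is taken so that
    -- `16 ^ suc k` covers both the 16 in `M ^ 2 ≤ 16 L ^ 2` and the `4 ^ k` in `(4 ℓ) ^ k`.
    aboveM = natural-above (fromℕ 1 + L) (≤-trans {0ℝ} {fromℕ 1} {fromℕ 1 + L} 0≤1ℝ (x≤x+y {fromℕ 1} {L} 0≤L))
    aboveR = natural-above (fromℕ 16 * (a * b)) (0≤x*y (0≤fromℕ 16) 0≤ab)

  M r : ℕ
  M = proj₁ aboveM
  r = proj₁ aboveR

  1+L≤M : fromℕ 1 + L ≤ fromℕ M
  1+L≤M = proj₁ (proj₂ aboveM)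

  1≤M : 1 ℕ.≤ M
  1≤M = Rat.ι-cancel-≤ (fromℚ-cancel (≤-trans {fromℕ 1} {fromℕ 1 + L} {fromℕ M} (x≤x+y {fromℕ 1} {L} 0≤L) 1+L≤M))

  private
    M≤4L : fromℕ M ≤ fromℕ 4 * L
    M≤4L = begin
      fromℕ M                      ≲⟨ proj₂ (proj₂ aboveM) ⟩
      fromℕ 1 + L + fromℕ 2        ≈⟨ (λ n → solve 1 (λ l → con 1ℚ :+ l :+ con (ι 2) := con (ι 3) :* con 1ℚ :+ l) refl (seq L n)) ⟩
      fromℕ 3 * 1ℝ + L             ≲⟨ +-mono-≤ (*-monoˡ-≤ (fromℕ 3) (0≤fromℕ 3) 1≤L) (≤-refl {L}) ⟩
      fromℕ 3 * L + L              ≈⟨ (λ n → solve 1 (λ l → con (ι 3) :* l :+ l := con (ι 4) :* l) refl (seq L n)) ⟩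
      fromℕ 4 * L                  ∎

    4^k≤16^k : 4 ℕ.^ k ℕ.≤ 16 ℕ.^ k
    4^k≤16^k = ℕ.^-monoˡ-≤ k (ℕ.m≤m+n 4 12)

  large : M ℕ.* M ℕ.* (4 ℕ.* ℓ) ℕ.^ k ℕ.≤ r ℕ.^ suc k
  large = Rat.ι-cancel-≤ (fromℚ-cancel (begin
    fromℕ (M ℕ.* M ℕ.* (4 ℕ.* ℓ) ℕ.^ k)
      ≈⟨ (λ n → trans (cong (λ m → ι (M ℕ.* M ℕ.* m)) (ℕ^-distribʳ-* 4 ℓ k))
           (trans (ι-* (M ℕ.* M) (4 ℕ.^ k ℕ.* ℓ ℕ.^ k)) (cong₂ ℚ._*_
             (trans (ι-* M M) (cong (ι M ℚ.*_) (sym (ℚ.*-identityʳ (ι M)))))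
             (trans (ι-* (4 ℕ.^ k) (ℓ ℕ.^ k)) (cong (ι (4 ℕ.^ k) ℚ.*_) (fromℕ-^ ℓ k n)))))) ⟩
    fromℕ M ^ 2 * (fromℕ (4 ℕ.^ k) * fromℕ ℓ ^ k)
      ≲⟨ *-monoʳ-≤ (fromℕ (4 ℕ.^ k) * fromℕ ℓ ^ k) (0≤x*y (0≤fromℕ (4 ℕ.^ k)) (0≤x^n k (0≤fromℕ ℓ)))
           (^-monoˡ-≤ 2 (0≤fromℕ M) M≤4L) ⟩
    (fromℕ 4 * L) ^ 2 * (fromℕ (4 ℕ.^ k) * fromℕ ℓ ^ k)
      ≈⟨ (λ n → solve 3 (λ l f p → (con (ι 4) :* l) :* ((con (ι 4) :* l) :* con 1ℚ) :* (f :* p)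
           := con (ι 16) :* f :* (p :* (l :* (l :* con 1ℚ)))) refl (seq L n) (ι (4 ℕ.^ k)) (seq (fromℕ ℓ ^ k) n)) ⟩
    fromℕ 16 * fromℕ (4 ℕ.^ k) * (fromℕ ℓ ^ k * L ^ 2)
      ≲⟨ *-monoʳ-≤ (fromℕ ℓ ^ k * L ^ 2) (0≤x*y (0≤x^n k (0≤fromℕ ℓ)) (0≤x^n 2 0≤L))
           (*-monoˡ-≤ (fromℕ 16) (0≤fromℕ 16) (fromℕ-mono 4^k≤16^k)) ⟩
    fromℕ 16 * fromℕ (16 ℕ.^ k) * (fromℕ ℓ ^ k * L ^ 2)
      ≈⟨ (λ n → cong (λ p → ι 16 ℚ.* p ℚ.* seq (fromℕ ℓ ^ k * L ^ 2) n) (fromℕ-^ 16 k n)) ⟩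
    fromℕ 16 ^ suc k * (fromℕ ℓ ^ k * L ^ 2)
      ≲⟨ *-monoˡ-≤ (fromℕ 16 ^ suc k) (0≤x^n (suc k) (0≤fromℕ 16)) ab-power ⟩
    fromℕ 16 ^ suc k * (a * b) ^ suc k
      ≈⟨ (λ n → sym (^-distrib (fromℕ 16) (a * b) (suc k) n)) ⟩
    (fromℕ 16 * (a * b)) ^ suc k
      ≲⟨ ^-monoˡ-≤ (suc k) (0≤x*y (0≤fromℕ 16) 0≤ab) (proj₁ (proj₂ aboveR)) ⟩
    fromℕ r ^ suc k
      ≈⟨ (λ n → sym (fromℕ-^ r (suc k) n)) ⟩
    fromℕ (r ℕ.^ suc k) ∎))

  -- The origin of `C`: 5 · 16 = 80 from the choice of `r`, at most 5 · 2 = 10 from rounding, and 90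
  -- is raised to the round number 100.
  5r≤100ab : fromℕ (5 ℕ.* r) ≤ fromℕ 100 * a * b
  5r≤100ab = begin
    fromℕ (5 ℕ.* r)                             ≈⟨ (λ n → ι-* 5 r) ⟩
    fromℕ 5 * fromℕ r                           ≲⟨ *-monoˡ-≤ (fromℕ 5) (0≤fromℕ 5) (proj₂ (proj₂ aboveR)) ⟩
    fromℕ 5 * (fromℕ 16 * (a * b) + fromℕ 2)    ≈⟨ (λ n → solve 1 (λ p → con (ι 5) :* (con (ι 16) :* p :+ con (ι 2))
                                                     := con (ι 80) :* p :+ con (ι 10) :* con 1ℚ) refl (seq (a * b) n)) ⟩
    fromℕ 80 * (a * b) + fromℕ 10 * 1ℝ          ≲⟨ +-mono-≤ (≤-refl {fromℕ 80 * (a * b)}) (*-monoˡ-≤ (fromℕ 10) (0≤fromℕ 10) 1≤ab) ⟩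
    fromℕ 80 * (a * b) + fromℕ 10 * (a * b)     ≲⟨ x≤x+y (0≤x*y (0≤fromℕ 10) 0≤ab) ⟩
    fromℕ 80 * (a * b) + fromℕ 10 * (a * b) + fromℕ 10 * (a * b)
      ≈⟨ (λ n → solve 2 (λ a b → con (ι 80) :* (a :* b) :+ con (ι 10) :* (a :* b) :+ con (ι 10) :* (a :* b)
           := con (ι 100) :* a :* b) refl (seq a n) (seq b n)) ⟩
    fromℕ 100 * a * b ∎

parameters : ∀ ℓ k → 1 ℕ.≤ ℓ → ∀ L a b → 1ℝ ≤ L →
  IsRationalPower (fromℕ ℓ) k (suc k) a → IsRationalPower L 2 (suc k) b →
  ∃[ M ] ∃[ r ] (1 ℕ.≤ M × fromℕ 1 + L ≤ fromℕ M
    × M ℕ.* M ℕ.* (4 ℕ.* ℓ) ℕ.^ k ℕ.≤ r ℕ.^ suc k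
    × fromℕ (5 ℕ.* r) ≤ fromℕ 100 * a * b)
parameters ℓ k 1≤ℓ L a b 1≤L powa powb = M , r , 1≤M , 1+L≤M , large , 5r≤100ab
  where open Parameters ℓ k 1≤ℓ L a b 1≤L powa powb

-- In exponents this is 2^(1 - M) ≤ 2^(-L). As the logarithm is given by its graph, `upper` at
-- `1 + L ≤ M` yields `2 ε⁻¹ ≤ 2 ^ M`, and multiplying by `ε / 2 ^ M` removes the inverse.
error≤ε : ∀ {ε ε⁻¹ L} M e → 0ℝ < ε → ε * ε⁻¹ ≈ 1ℝ → IsLog₂ ε⁻¹ L → fromℕ 1 + L ≤ fromℕ M →
          e ℚ.* ι 2 ℚ^ M ℚ.≤ ι 2 → fromℚ e ≤ ε
error≤ε {ε} {ε⁻¹} {L} M e 0<ε inverse log 1+L≤M eP≤2 = begin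
  fromℚ e                                   ≈⟨ (λ n → trans (sym (ℚ.*-identityʳ e)) (trans (cong (e ℚ.*_) (sym Pp≡1)) (sym (ℚ.*-assoc e P p)))) ⟩
  fromℚ (e ℚ.* P ℚ.* p)                     ≲⟨ fromℚ-mono (Rat.*-monoʳ-≤-0≤ p 0≤p eP≤2) ⟩
  fromℚ (ι 2 ℚ.* p)                         ≈⟨ (λ n → sym (ℚ.*-identityʳ (ι 2 ℚ.* p))) ⟩
  fromℚ (ι 2 ℚ.* p) * 1ℝ                    ≲⟨ *-monoˡ-≤ (fromℚ (ι 2 ℚ.* p)) (fromℚ-mono (Rat.0≤p*q (Rat.0≤ι 2) 0≤p)) (≈⇒≤ (≈-sym inverse)) ⟩
  fromℚ (ι 2 ℚ.* p) * (ε * ε⁻¹)             ≈⟨ (λ n → solve 3 (λ p x y → con (ι 2) :* p :* (x :* y)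
                                                 := x :* p :* (con (ι 2) :* con 1ℚ :* (y :* con 1ℚ))) refl p (seq ε n) (seq ε⁻¹ n)) ⟩
  ε * fromℚ p * (fromℕ 2 ^ 1 * ε⁻¹ ^ 1)     ≲⟨ *-monoˡ-≤ (ε * fromℚ p) (0≤x*y (<⇒≤ 0<ε) (fromℚ-mono 0≤p))
                                                 (IsExponential.upper log M 1 1 (ℕ.s≤s ℕ.z≤n) 1+1L≤M) ⟩
  ε * fromℚ p * fromℕ 2 ^ M                 ≈⟨ (λ n → trans (cong (seq ε n ℚ.* p ℚ.*_) (seq-^ (fromℕ 2) M n))
                                                 (trans (ℚ.*-assoc (seq ε n) p P) (trans (cong (seq ε n ℚ.*_) (trans (ℚ.*-comm p P) Pp≡1))
                                                   (ℚ.*-identityʳ (seq ε n))))) ⟩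
  ε                                         ∎
  where
  open ℝ-Reasoning
  open +-*-Solver
  P = ι 2 ℚ^ M
  inv = reciprocal P (Rat.0<p^n M (Rat.0<ι {2} (ℕ.s≤s ℕ.z≤n)))
  p = proj₁ inv
  Pp≡1 : P ℚ.* p ≡ 1ℚ
  Pp≡1 = proj₁ (proj₂ inv)
  0≤p : 0ℚ ℚ.≤ p
  0≤p = ℚ.<⇒≤ (proj₂ (proj₂ inv))
  1+1L≤M : fromℕ 1 + fromℕ 1 * L ≤ fromℕ M
  1+1L≤M = begin
    fromℕ 1 + fromℕ 1 * L    ≈⟨ (λ n → cong (1ℚ ℚ.+_) (ℚ.*-identityˡ (seq L n))) ⟩
    fromℕ 1 + L              ≲⟨ 1+L≤M ⟩
    fromℕ M                  ∎

transfer : ∀ {ℓ} D M {ε ε⁻¹ L d 32^d} (g : Vec Bool ℓ → Bool) (φ : CNF ℓ) → φ Computes g →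
  fromℕ D ≤ d → 0ℝ < ε → ε * ε⁻¹ ≈ 1ℝ → IsLog₂ ε⁻¹ L → fromℕ 1 + L ≤ fromℕ M → IsExponential (fromℕ 32) d 32^d →
  ∃[ F ] (IsPoly D (ι 32 ℚ^ D) F
    × (∀ x → evalCNF φ x ≡ true → F x ≡ 1ℚ)
    × (∀ x → ℚ.∣ F x ℚ.- ι (bit (evalCNF φ x)) ∣ ℚ.* ι 2 ℚ^ M ℚ.≤ ι 2)) →
  ∃[ q ] (HasDegreeAtMost q d
    × (∀ (x : Vec Bool ℓ) → g x ≡ true → eval q (Vec.map ⟦_⟧ x) ≈ 1ℝ)
    × (∀ (x : Vec Bool ℓ) → ∣ eval q (Vec.map ⟦_⟧ x) - ⟦ g x ⟧ ∣ ≤ ε)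
    × coefficientNorm q ≤ 32^d)
transfer D M {ε} {d = d} {32^d} g φ computes D≤d 0<ε inverse log 1+L≤M exp (F , isPoly , sat , close) =
  interpolation F , interpolation-degree isPoly D≤d , value-1 , error , norm≤
  where
  open ℝ-Reasoning
  value-1 : ∀ x → g x ≡ true → eval (interpolation F) (Vec.map ⟦_⟧ x) ≈ 1ℝ
  value-1 x gx = ≗⇒≈ (λ n → trans (seq-eval F x n) (sat x (trans (computes x) gx)))

  error : ∀ x → ∣ eval (interpolation F) (Vec.map ⟦_⟧ x) - ⟦ g x ⟧ ∣ ≤ ε
  error x = begin
    ∣ eval (interpolation F) (Vec.map ⟦_⟧ x) - ⟦ g x ⟧ ∣
      ≈⟨ (λ n → cong ℚ.∣_∣ (cong₂ ℚ._-_ (seq-eval F x n) (trans (seq-⟦⟧ (g x) n) (cong (ι ∘ bit) (sym (computes x)))))) ⟩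
    fromℚ ℚ.∣ F x ℚ.- ι (bit (evalCNF φ x)) ∣
      ≲⟨ error≤ε M ℚ.∣ F x ℚ.- ι (bit (evalCNF φ x)) ∣ 0<ε inverse log 1+L≤M (close x) ⟩
    ε ∎

  D≤0+1d : fromℕ D ≤ fromℕ 0 + fromℕ 1 * d
  D≤0+1d = begin
    fromℕ D                  ≲⟨ D≤d ⟩
    d                        ≈⟨ (λ n → sym (trans (ℚ.+-identityˡ _) (ℚ.*-identityˡ (seq d n)))) ⟩
    fromℕ 0 + fromℕ 1 * d    ∎

  norm≤ : coefficientNorm (interpolation F) ≤ 32^d
  norm≤ = begin
    coefficientNorm (interpolation F)            ≈⟨ seq-coefficientNorm F ⟩
    fromℚ (sumCube (λ α → ℚ.∣ coef F α ∣))       ≲⟨ fromℚ-mono (norm isPoly) ⟩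
    fromℚ (ι 32 ℚ^ D)                            ≈⟨ (λ n → sym (seq-^ (fromℕ 32) D n)) ⟩
    -- The integer `D ≤ d` serves as the rational exponent (D - 0)/1 in the graph of the
    -- exponential.
    fromℕ 32 ^ D                                 ≲⟨ IsExponential.lower exp D 0 1 (ℕ.s≤s ℕ.z≤n) D≤0+1d ⟩
    fromℕ 32 ^ 0 * 32^d ^ 1                      ≈⟨ (λ n → trans (ℚ.*-identityˡ _) (ℚ.*-identityʳ (seq 32^d n))) ⟩
    32^d                                         ∎

interpolant : ∀ {ℓ k} → 1 ℕ.≤ ℓ → 1 ℕ.≤ k → ∀ {ε ε⁻¹ L a b d 32^d} (g : Vec Bool ℓ → Bool) (φ : CNF ℓ) →
  φ Computes g → HasWidthAtMost φ k → 0ℝ < ε → ε * ε⁻¹ ≈ 1ℝ → IsLog₂ ε⁻¹ L →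
  d ≈ fromℕ 100 * a * b → IsExponential (fromℕ 32) d 32^d →
  ∃[ M ] ∃[ r ] (1 ℕ.≤ M × fromℕ 1 + L ≤ fromℕ M
    × M ℕ.* M ℕ.* (4 ℕ.* ℓ) ℕ.^ k ℕ.≤ r ℕ.^ suc k
    × fromℕ (5 ℕ.* r) ≤ fromℕ 100 * a * b) →
  ∃[ q ] (HasDegreeAtMost q d
    × (∀ (x : Vec Bool ℓ) → g x ≡ true → eval q (Vec.map ⟦_⟧ x) ≈ 1ℝ)
    × (∀ (x : Vec Bool ℓ) → ∣ eval q (Vec.map ⟦_⟧ x) - ⟦ g x ⟧ ∣ ≤ ε)
    × coefficientNorm q ≤ 32^d)
interpolant {ℓ} {k} 1≤ℓ 1≤k {a = a} {b} {d} g φ computes width 0<ε inverse log d≈ exp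
  (M , r , 1≤M , 1+L≤M , large , 5r≤100ab) =
  transfer (5 ℕ.* r) M g φ computes
    (≤-trans {fromℕ (5 ℕ.* r)} {fromℕ 100 * a * b} {d} 5r≤100ab (≈⇒≤ (≈-sym d≈))) 0<ε inverse log 1+L≤M exp
    (approximation ℓ k r M φ width 1≤ℓ 1≤k 1≤M large)

theorem8 : ∃[ C ] (0ℝ < C ×
    (∀ (ℓ k : ℕ) → 1 ℕ.≤ ℓ → 1 ℕ.≤ k →
    ∀ (ε : ℝ) → 0ℝ < ε → ε < fromℚ (+ 1 ℚ./ 10) →
    ∀ (g : Vec Bool ℓ → Bool) (φ : CNF ℓ) → φ Computes g → HasWidthAtMost φ k →
    ∀ (ε⁻¹ log₂ε⁻¹ ℓ^[k/k+1] log^[2/k+1] d 32^d : ℝ) →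
    ε * ε⁻¹ ≈ 1ℝ →
    IsLog₂ ε⁻¹ log₂ε⁻¹ →
    IsRationalPower (fromℕ ℓ) k (suc k) ℓ^[k/k+1] →
    IsRationalPower log₂ε⁻¹ 2 (suc k) log^[2/k+1] →
    d ≈ C * ℓ^[k/k+1] * log^[2/k+1] →
    IsExponential (fromℕ 32) d 32^d →
    ∃[ q ] (HasDegreeAtMost q d
    × (∀ (x : Vec Bool ℓ) → g x ≡ true → eval q (Vec.map ⟦_⟧ x) ≈ 1ℝ)
    × (∀ (x : Vec Bool ℓ) → ∣ eval q (Vec.map ⟦_⟧ x) - ⟦ g x ⟧ ∣ ≤ ε)
    × coefficientNorm q ≤ 32^d)))
theorem8 = fromℕ 100 , mk< 1ℚ Rat.0<1 (0 , λ n _ → Rat.ι-mono-< {1} {100} (ℕ.m≤m+n 2 98)) ,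
  λ ℓ k 1≤ℓ 1≤k ε 0<ε ε<0·1 g φ computes width ε⁻¹ L a b d 32^d inverse log powa powb d≈ exp →
    interpolant 1≤ℓ 1≤k g φ computes width 0<ε inverse log d≈ exp
      (parameters ℓ k 1≤ℓ L a b (1≤log 0<ε ε<0·1 inverse log) powa powb)
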